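{- Let $n\ge 2$, $a_1,\ldots,a_{n-1}$ positive integers and $\lambda=\sum a_i\omega_i$. Every simple vertex of $P_\lambda$ is of the form $x(E)$ for some $E\subset R$. For $E\subset R$, the point $x(E)$ is a simple vertex of $P_\lambda$ if and only if for any two segments in $E$ with nonempty intersection, this intersection coincides with one of the two segments.
   Context: Let $U=\mathbb R^{\binom n2}$ with coordinates $x_{i,j}$, $1\le i<j\le n$. A Dyck path is a sequence $d=((i_1,j_1),\ldots,(i_N,j_N))$ of pairs with $1\le i_k<j_k\le n$, $j_1-i_1=j_N-i_N=1$, and each $(i_{k+1},j_{k+1})$ equal to $(i_k+1,j_k)$ or $(i_k,j_k+1)$. Put $S(x,d)=\sum_{(i,j)\in d}x_{i,j}$ and $M(\lambda,d)=a_{i_1}+a_{i_1+1}+\ldots+a_{i_N}$. The FFLV polytope is $P_\lambda=\{x\in U: x\ge 0,\ S(x,d)\le M(\lambda,d)\ \forall d\}$. A vertex of a polytope is simple if the tangent cone of the polytope at it is simplicial and unimodular. Let $R$ be the set of segments $[i,j]$ with integers $1\le i<j\le n$. For $i<j$ let $d^{i,j}=((i,i+1),\ldots,(i,j),(i+1,j),\ldots,(j-1,j))$. For $E\subset R$, $x(E)\in U$ is the unique point with $x(E)_{i,j}=0$ if $[i,j]\notin E$ and $S(x(E),d^{i,j})=a_i+\ldots+a_{j-1}$ if $[i,j]\in E$.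
   Formalization: The space U, and with it the polytope, its vertices and tangent cones, is taken over the rational numbers instead of the real numbers; the polytope is rational, so its vertices are rational points. -}

module Defs where

open import Data.Nat as ℕ using (ℕ; zero; suc; _≤_; _<_; _∸_)
open import Data.Integer as ℤ using (ℤ; +_)
open import Data.Rational using (ℚ; 0ℚ; 1ℚ; _+_; _*_; _-_; _/_)
import Data.Rational as ℚ
open import Data.Fin using (Fin; zero; suc)
open import Data.List using (List; []; _∷_; _++_; map; foldr; applyUpTo)
open import Data.List.Relation.Unary.All using (All)
open import Data.Bool using (Bool; true; false)
open import Data.Product using (Σ; Σ-syntax; _×_; _,_)
open import Data.Sum using (_⊎_)
open import Data.Unit using (⊤)
open import Data.Empty using (⊥)
open import Function.Bundles using (_⇔_)
open import Relation.Binary.PropositionalEquality using (_≡_)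

ℤtoℚ : ℤ → ℚ
ℤtoℚ z = z / 1

ℕtoℚ : ℕ → ℚ
ℕtoℚ k = (+ k) / 1

-- index pair (i , j) is a coordinate of U = ℝ^(n choose 2): 1 ≤ i < j ≤ n
Valid : ℕ → ℕ → ℕ → Set
Valid n i j = (1 ≤ i) × (i < j) × (j ≤ n)

-- a point of U (rational coordinates); only values at Valid pairs matter
Point : Set
Point = ℕ → ℕ → ℚ

_≈[_]_ : Point → ℕ → Point → Set
x ≈[ n ] y = ∀ i j → Valid n i j → x i j ≡ y i j

range : ℕ → ℕ → List ℕ
range lo hi = applyUpTo (λ t → lo ℕ.+ t) (hi ∸ lo)

sumA : (ℕ → ℕ) → ℕ → ℕ → ℕ
sumA a lo hi = foldr ℕ._+_ 0 (map a (range lo (suc hi)))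

Step : ℕ × ℕ → ℕ × ℕ → Set
Step (i , j) (i' , j') = (i' ≡ suc i × j' ≡ j) ⊎ (i' ≡ i × j' ≡ suc j)

Chain : List (ℕ × ℕ) → Set
Chain [] = ⊤
Chain (p ∷ []) = ⊤
Chain (p ∷ q ∷ r) = Step p q × Chain (q ∷ r)

HeadDiag : List (ℕ × ℕ) → Set
HeadDiag [] = ⊥
HeadDiag ((i , j) ∷ _) = j ≡ suc i

LastDiag : List (ℕ × ℕ) → Set
LastDiag [] = ⊥
LastDiag ((i , j) ∷ []) = j ≡ suc i
LastDiag (_ ∷ q ∷ r) = LastDiag (q ∷ r)

IsDyck : ℕ → List (ℕ × ℕ) → Set
IsDyck n d = All (λ p → Valid n (Data.Product.proj₁ p) (Data.Product.proj₂ p)) d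
           × HeadDiag d × LastDiag d × Chain d

firstI : List (ℕ × ℕ) → ℕ
firstI [] = 0
firstI ((i , _) ∷ _) = i

lastI : List (ℕ × ℕ) → ℕ
lastI [] = 0
lastI ((i , _) ∷ []) = i
lastI (_ ∷ q ∷ r) = lastI (q ∷ r)

S : Point → List (ℕ × ℕ) → ℚ
S x d = foldr (λ p acc → x (Data.Product.proj₁ p) (Data.Product.proj₂ p) + acc) 0ℚ d

M : (ℕ → ℕ) → List (ℕ × ℕ) → ℚ
M a d = ℕtoℚ (sumA a (firstI d) (lastI d))

-- membership in the FFLV polytope P_λ (λ = Σ a_i ω_i)
InP : ℕ → (ℕ → ℕ) → Point → Set
InP n a x = (∀ i j → Valid n i j → 0ℚ ℚ.≤ x i j)
          × (∀ d → IsDyck n d → S x d ℚ.≤ M a d)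

IsVertex : ℕ → (ℕ → ℕ) → Point → Set
IsVertex n a v = InP n a v
  × (∀ y z t → InP n a y → InP n a z → 0ℚ ℚ.< t → t ℚ.< 1ℚ
       → v ≈[ n ] (λ i j → t * y i j + (1ℚ - t) * z i j) → y ≈[ n ] z)

InTangentCone : ℕ → (ℕ → ℕ) → Point → Point → Set
InTangentCone n a v u = Σ[ t ∈ ℚ ] (0ℚ ℚ.< t × InP n a (λ i j → v i j + t * u i j))

sumFin : (m : ℕ) → (Fin m → ℚ) → ℚ
sumFin zero f = 0ℚ
sumFin (suc m) f = f zero + sumFin m (λ k → f (suc k))

LVec : Set
LVec = ℕ → ℕ → ℤ

toPoint : LVec → Point
toPoint w i j = ℤtoℚ (w i j)

comb : (m : ℕ) → (Fin m → ℚ) → (Fin m → LVec) → Point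
comb m c w i j = sumFin m (λ k → c k * ℤtoℚ (w k i j))

LinIndep : ℕ → (m : ℕ) → (Fin m → LVec) → Set
LinIndep n m w = ∀ c → comb m c w ≈[ n ] (λ _ _ → 0ℚ) → ∀ k → c k ≡ 0ℚ

LatticeBasisOfSpan : ℕ → (m : ℕ) → (Fin m → LVec) → Set
LatticeBasisOfSpan n m w = ∀ (u : LVec) (c : Fin m → ℚ) → comb m c w ≈[ n ] toPoint u
  → Σ[ e ∈ (Fin m → ℤ) ] (comb m (λ k → ℤtoℚ (e k)) w ≈[ n ] toPoint u)

SimplicialUnimodularTangentCone : ℕ → (ℕ → ℕ) → Point → Set
SimplicialUnimodularTangentCone n a v =
  Σ[ m ∈ ℕ ] Σ[ w ∈ (Fin m → LVec) ]
    ( LinIndep n m w × LatticeBasisOfSpan n m w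
    × (∀ u → InTangentCone n a v u
             ⇔ (Σ[ c ∈ (Fin m → ℚ) ] ((∀ k → 0ℚ ℚ.≤ c k) × (u ≈[ n ] comb m c w)))))

IsSimpleVertex : ℕ → (ℕ → ℕ) → Point → Set
IsSimpleVertex n a v = IsVertex n a v × SimplicialUnimodularTangentCone n a v

-- a subset E ⊂ R: [i,j] ∈ E iff E i j ≡ true (only Valid pairs matter)
SegSet : Set
SegSet = ℕ → ℕ → Bool

dpath : ℕ → ℕ → List (ℕ × ℕ)
dpath i j = map (λ k → (i , k)) (range (suc i) (suc j))
         ++ map (λ k → (k , j)) (range (suc i) j)

IsXE : ℕ → (ℕ → ℕ) → SegSet → Point → Set
IsXE n a E x = ∀ i j → Valid n i j →
    (E i j ≡ false → x i j ≡ 0ℚ)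
  × (E i j ≡ true → S x (dpath i j) ≡ ℕtoℚ (sumA a i (j ∸ 1)))

Meet : ℕ → ℕ → ℕ → ℕ → Set
Meet i j k l = (k ≤ j) × (i ≤ l)

IntersectionIsFirst : ℕ → ℕ → ℕ → ℕ → Set
IntersectionIsFirst i j k l = (k ≤ i) × (j ≤ l)

Laminar : ℕ → SegSet → Set
Laminar n E = ∀ i j k l → Valid n i j → Valid n k l → E i j ≡ true → E k l ≡ true
  → Meet i j k l → IntersectionIsFirst i j k l ⊎ IntersectionIsFirst k l i j

{-# OPTIONS --safe #-}
module Submission where

open import Defs
open import Data.Bool using (Bool; true; false; if_then_else_)
open import Data.Empty using (⊥; ⊥-elim)
open import Data.Fin as Fin using (Fin; toℕ; fromℕ<; splitAt; join; _↑ˡ_; _↑ʳ_)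
open import Data.Fin.Properties as FinP using ()
open import Data.Integer as ℤ using (ℤ)
open import Data.Integer.Properties as ℤP using ()
open import Data.List using (List; []; _∷_; _++_; map; applyUpTo; foldr)
open import Data.List.Relation.Unary.All using (All; []; _∷_)
open import Data.Maybe using (Maybe; just; nothing)
open import Data.Nat as ℕ using (ℕ; zero; suc; _≤_; _<_; _∸_; z≤n; s≤s; _≤′_; ≤′-refl; ≤′-step)
open import Data.Nat.Coprimality as Coprime using ()
open import Data.Nat.Properties using
  (+-assoc; +-cancelʳ-<; +-cancelʳ-≡; +-cancelʳ-≤; +-cancelˡ-≡; +-comm; +-identityʳ;
   +-mono-≤; +-monoʳ-<; +-monoʳ-≤; +-suc; +-∸-assoc; <-asym; <-irrefl; <-trans; <-≤-trans;
   <⇒≤; <⇒≱; m+[n∸m]≡n; m+n∸n≡m; m<n⇒0<n∸m; m∸[m∸n]≡n; m∸n+n≡m; m∸n≤m; m≤n+m; m≤n⇒m<n∨m≡n;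
   m≤n⇒m≤1+n; m≤n⇒m⊓n≡m; m≥n⇒m⊓n≡n; n<1+n; n≤1+n; suc-injective; suc-pred; ∸-monoʳ-<;
   ∸-monoʳ-≤; ∸-monoˡ-<; ≤-<-connex; ≤-<-trans; ≤-antisym; ≤-pred; ≤-refl; ≤-reflexive;
   ≤-trans; ≤′⇒≤; ≤⇒≤′; ≤∧≢⇒<; ≮⇒≥; ≰⇒>)
open import Data.Product using (Σ; Σ-syntax; ∃; _×_; _,_; proj₁; proj₂)
open import Data.Rational as ℚ using (ℚ; 0ℚ; 1ℚ; ½; _+_; _*_; _-_; -_)
open import Data.Rational.Properties as ℚP using ()
open import Data.Sum using (_⊎_; inj₁; inj₂; [_,_]′)
open import Data.Unit using (tt)
open import Function using (_∋_; _∘_)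
open import Function.Bundles using (_⇔_; mk⇔; Equivalence)
open import Level using (0ℓ)
open import Relation.Binary.PropositionalEquality
open import Relation.Nullary using (¬_; Dec; yes; no)
open import Tactic.RingSolver using (solve-∀)
open import Tactic.RingSolver.Core.AlmostCommutativeRing using (AlmostCommutativeRing; fromCommutativeRing)

-- Let A be the prefix sums of a, so that a Dyck path from s to e has bound
-- A e - A s.  At a simple vertex the active inequalities are, up to scaling, the
-- basis dual to the generators of the tangent cone, so no two pairs of them have
-- the same sum (no-relation).  If [i , j] and [k , l] in E cross, exchanging the
-- ends of d^{i,j} and d^{k,l} where they meet gives such a relation; hence E is
-- laminar when x(E) is simple.
--
-- Let x be a simple vertex and φ i j the maximum of A s plus the sum of x along
-- a path from s to (i , j).  Moving a level set of φ shows that at a positive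
-- coordinate the maximum is attained from the left, and flipping a corner of a
-- tight path at a zero of x would be a forbidden relation.  So a tight path
-- through a positive x_{i,j} may be taken to start along row i and, by reflection,
-- to end along column j: d^{i,j} is tight, and x = x(E) for E the support of x.
--
-- If E is laminar, x(E)_{i,j} is for [i , j] ∈ E the A-length of an interval, and
-- the intervals met by a path are disjoint.  Hence only the paths d^{i,j} with
-- [i , j] ∈ E are tight, and together with the zero coordinates they form a
-- unitriangular system of active inequalities.

-- An active inequality that defines no facet is a nonnegative combination of several vectors of the
-- dual basis, so a relation between active inequalities is not contradictory by itself.
-- `no-relation` therefore asks for certificates: a point from which one can move freely along the
-- face of `f₁`, and points of P on the faces of `f₃` and `f₄` but off that of `f₁`. In every
-- application `f₁` is a hook or a coordinate, never the path produced by an exchange, because for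
-- those explicit points exist: ¼ everywhere with one coordinate changed, a large mass at the corner
-- of a hook, or each a_g placed on a point (p , q) with p ≤ g < q.
--
-- Walks are never enumerated. A slack common to all inactive walks comes from carrying an
-- alternative along each walk: it has already lost a fixed amount, or it is still exact.
--
-- The geometry is stated for any potential with increments at least 1. Reflection turns A into k ↦
-- - A (n + 1 - k), again of this kind, so statements about rows give those about columns.

isZero : ∀ p → Maybe (0ℚ ≡ p)
isZero p with 0ℚ ℚ.≟ p
... | yes e = just e
... | no  _ = nothing

ℚ-ring : AlmostCommutativeRing 0ℓ 0ℓ
ℚ-ring = fromCommutativeRing ℚP.+-*-commutativeRing isZero

-- Linear arithmetic: p ≤ q is derived by exhibiting q - p as a sum of
-- quantities known to be nonnegative.

≤-by : ∀ {p q r} → 0ℚ ℚ.≤ r → p + r ≡ q → p ℚ.≤ q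
≤-by {p} h e = subst₂ ℚ._≤_ (ℚP.+-identityʳ p) e (ℚP.+-monoʳ-≤ p h)

<-by : ∀ {p q r} → 0ℚ ℚ.< r → p + r ≡ q → p ℚ.< q
<-by {p} h e = subst₂ ℚ._<_ (ℚP.+-identityʳ p) e (ℚP.+-monoʳ-< p h)

0≤- : ∀ {p q} → p ℚ.≤ q → 0ℚ ℚ.≤ q - p
0≤- {p} {q} h = subst (ℚ._≤ q - p) (ℚP.+-inverseʳ p) (ℚP.+-monoˡ-≤ (- p) h)

0<- : ∀ {p q} → p ℚ.< q → 0ℚ ℚ.< q - p
0<- {p} {q} h = subst (ℚ._< q - p) (ℚP.+-inverseʳ p) (ℚP.+-monoˡ-< (- p) h)

infixl 5 _⊹_ _⊹<_

_⊹_ : ∀ {p q} → 0ℚ ℚ.≤ p → 0ℚ ℚ.≤ q → 0ℚ ℚ.≤ p + q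
h ⊹ k = ℚP.+-mono-≤ h k

_⊹<_ : ∀ {p q} → 0ℚ ℚ.≤ p → 0ℚ ℚ.< q → 0ℚ ℚ.< p + q
h ⊹< k = ℚP.+-mono-≤-< h k

0≤* : ∀ {p q} → 0ℚ ℚ.≤ p → 0ℚ ℚ.≤ q → 0ℚ ℚ.≤ p * q
0≤* {p} {q} h k = subst (ℚ._≤ p * q) (ℚP.*-zeroʳ p)
  (ℚP.*-monoˡ-≤-nonNeg p ⦃ ℚ.nonNegative h ⦄ k)

0<* : ∀ {p q} → 0ℚ ℚ.< p → 0ℚ ℚ.< q → 0ℚ ℚ.< p * q
0<* {p} {q} h k = subst (ℚ._< p * q) (ℚP.*-zeroʳ p)
  (ℚP.*-monoʳ-<-pos p ⦃ ℚ.positive h ⦄ k)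

0<1 : 0ℚ ℚ.< 1ℚ
0<1 = ℚP.positive⁻¹ 1ℚ

0≤1 : 0ℚ ℚ.≤ 1ℚ
0≤1 = ℚP.<⇒≤ 0<1

≤⇒<⇒⊥ : ∀ {p q} → p ℚ.≤ q → q ℚ.< p → ⊥
≤⇒<⇒⊥ h k = ℚP.<-irrefl refl (ℚP.≤-<-trans h k)

0≤*⇒0≤ : ∀ {t p} → 0ℚ ℚ.< t → 0ℚ ℚ.≤ t * p → 0ℚ ℚ.≤ p
0≤*⇒0≤ {t} {p} t>0 h = ℚP.*-cancelˡ-≤-pos t ⦃ ℚ.positive t>0 ⦄
  (subst (ℚ._≤ t * p) (sym (ℚP.*-zeroʳ t)) h)

small-factor : ∀ {K δ} → 0ℚ ℚ.≤ K → 0ℚ ℚ.< δ → Σ[ t ∈ ℚ ] (0ℚ ℚ.< t × t * K ℚ.≤ δ)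
-- The factor is δ / (1 + K); the added 1 covers K = 0.
small-factor {K} {δ} K≥0 δ>0 = δ * r , 0<* δ>0 r>0 , ≤-by (ℚP.<⇒≤ (0<* δ>0 r>0))
    (trans (((∀ δ r K → δ * r * K + δ * r ≡ δ * (r * (1ℚ + K))) ∋ solve-∀ ℚ-ring) δ r K)
      (trans (cong (δ *_) (ℚP.*-inverseˡ (1ℚ + K) ⦃ nz ⦄)) (ℚP.*-identityʳ δ)))
  where
  pos : 0ℚ ℚ.< 1ℚ + K
  pos = subst (0ℚ ℚ.<_) (ℚP.+-comm K 1ℚ) (K≥0 ⊹< 0<1)
  nz : ℚ.NonZero (1ℚ + K)
  nz = ℚP.pos⇒nonZero (1ℚ + K) ⦃ ℚ.positive pos ⦄
  r : ℚ
  r = (ℚ.1/ (1ℚ + K)) ⦃ nz ⦄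
  r>0 : 0ℚ ℚ.< r
  r>0 = ℚP.positive⁻¹ r ⦃ ℚP.1/pos⇒pos (1ℚ + K) ⦃ ℚ.positive pos ⦄ ⦄

ℤtoℚ-+ : ∀ y z → ℤtoℚ (y ℤ.+ z) ≡ ℤtoℚ y + ℤtoℚ z
ℤtoℚ-+ y z = trans
    (cong ℤtoℚ (sym (cong₂ ℤ._+_ (ℤP.*-identityʳ y) (ℤP.*-identityʳ z))))
    (sym (cong₂ _+_ (as-mkℚ y) (as-mkℚ z)))
  where
  as-mkℚ : ∀ z → ℤtoℚ z ≡ ℚ.mkℚ z 0 (Coprime.sym (Coprime.1-coprimeTo ℤ.∣ z ∣))
  as-mkℚ z = ℚP.↥p/↧p≡p (ℚ.mkℚ z 0 _)

ℤtoℚ-neg : ∀ z → ℤtoℚ (ℤ.- z) ≡ - ℤtoℚ z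
ℤtoℚ-neg z = trans
    (((∀ a b → b ≡ (b + a) - a) ∋ solve-∀ ℚ-ring) (ℤtoℚ z) (ℤtoℚ (ℤ.- z)))
    (trans (cong (_- ℤtoℚ z) (trans (sym (ℤtoℚ-+ (ℤ.- z) z)) (cong ℤtoℚ (ℤP.+-inverseˡ z))))
      (ℚP.+-identityˡ _))

ℕtoℚ-+ : ∀ k l → ℕtoℚ (k ℕ.+ l) ≡ ℕtoℚ k + ℕtoℚ l
ℕtoℚ-+ k l = ℤtoℚ-+ (ℤ.+ k) (ℤ.+ l)

0≤ℕtoℚ : ∀ k → 0ℚ ℚ.≤ ℕtoℚ k
0≤ℕtoℚ zero    = ℚP.≤-refl
0≤ℕtoℚ (suc k) = subst (0ℚ ℚ.≤_) (sym (ℕtoℚ-+ 1 k)) (0≤1 ⊹ 0≤ℕtoℚ k)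

-- A walk starts at the virtual point (s , s); its first step is up, and from
-- then on it stays in the region i < j.  Dyck paths are the walks ending at
-- some (e , suc e).
data Walk (s : ℕ) : ℕ → ℕ → Set where
  start : Walk s s s
  right : ∀ {i j} → Walk s i j → suc i < j → Walk s (suc i) j
  up    : ∀ {i j} → Walk s i j → Walk s i (suc j)

total : ∀ {s i j} → Point → Walk s i j → ℚ
total x start                = 0ℚ
total x (right {i} {j} w _)  = total x w + x (suc i) j
total x (up {i} {j} w)       = total x w + x i (suc j)

walk-s≤i : ∀ {s i j} → Walk s i j → s ≤ i
walk-s≤i start       = ≤-refl
walk-s≤i (right w _) = m≤n⇒m≤1+n (walk-s≤i w)
walk-s≤i (up w)      = walk-s≤i w

walk-i≤j : ∀ {s i j} → Walk s i j → i ≤ j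
walk-i≤j start       = ≤-refl
walk-i≤j (right w h) = <⇒≤ h
walk-i≤j (up w)      = m≤n⇒m≤1+n (walk-i≤j w)

off-diagonal : ∀ {s i j} → (w : Walk s i j) → i < j ⊎ (s ≡ i × s ≡ j)
off-diagonal start       = inj₂ (refl , refl)
off-diagonal (right w h) = inj₁ h
off-diagonal (up w)      = inj₁ (s≤s (walk-i≤j w))

total-cong : ∀ {n x y s i j} → x ≈[ n ] y → 1 ≤ s → j ≤ n → (w : Walk s i j) → total x w ≡ total y w
total-cong e 1≤s j≤n start = refl
total-cong e 1≤s j≤n (right {i} {j} w h) =
  cong₂ _+_ (total-cong e 1≤s j≤n w) (e (suc i) j (s≤s z≤n , h , j≤n))
total-cong e 1≤s j≤n (up {i} {j} w) =
  cong₂ _+_ (total-cong e 1≤s (<⇒≤ j≤n) w)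
    (e i (suc j) (≤-trans 1≤s (walk-s≤i w) , s≤s (walk-i≤j w) , j≤n))

total-lin : ∀ {s i j} (x y : Point) c d (w : Walk s i j) →
  total (λ i j → c * x i j + d * y i j) w ≡ c * total x w + d * total y w
total-lin x y c d start = sym (((∀ c d → c * 0ℚ + d * 0ℚ ≡ 0ℚ) ∋ solve-∀ ℚ-ring) c d)
total-lin x y c d (right {i} {j} w h) = trans (cong (_+ _) (total-lin x y c d w))
  (((∀ c d X Y p q → (c * X + d * Y) + (c * p + d * q) ≡ c * (X + p) + d * (Y + q)) ∋ solve-∀ ℚ-ring)
    c d (total x w) (total y w) (x (suc i) j) (y (suc i) j))
total-lin x y c d (up {i} {j} w) = trans (cong (_+ _) (total-lin x y c d w))
  (((∀ c d X Y p q → (c * X + d * Y) + (c * p + d * q) ≡ c * (X + p) + d * (Y + q)) ∋ solve-∀ ℚ-ring)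
    c d (total x w) (total y w) (x i (suc j)) (y i (suc j)))

-- The polytope described by walks and a potential.

Member : ℕ → (ℕ → ℚ) → Point → Set
Member n A x = (∀ i j → Valid n i j → 0ℚ ℚ.≤ x i j)
  × (∀ {s e} → 1 ≤ s → suc e ≤ n → (w : Walk s e (suc e)) → total x w + A s ℚ.≤ A (suc e))

prefix : (ℕ → ℕ) → ℕ → ℕ
prefix a zero    = 0
prefix a (suc k) = prefix a k ℕ.+ a k

potential : (ℕ → ℕ) → ℕ → ℚ
potential a k = ℕtoℚ (prefix a k)

sum-applyUpTo : ∀ (a : ℕ → ℕ) lo len (f : ℕ → ℕ) → (∀ t → f t ≡ lo ℕ.+ t) →
  foldr ℕ._+_ 0 (map a (applyUpTo f len)) ℕ.+ prefix a lo ≡ prefix a (lo ℕ.+ len)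
sum-applyUpTo a lo zero f eq = cong (prefix a) (sym (+-identityʳ lo))
sum-applyUpTo a lo (suc len) f eq = begin
  a (f 0) ℕ.+ rest ℕ.+ prefix a lo       ≡⟨ +-assoc (a (f 0)) rest _ ⟩
  a (f 0) ℕ.+ (rest ℕ.+ prefix a lo)     ≡⟨ +-comm (a (f 0)) _ ⟩
  rest ℕ.+ prefix a lo ℕ.+ a (f 0)       ≡⟨ +-assoc rest _ _ ⟩
  rest ℕ.+ (prefix a lo ℕ.+ a (f 0))     ≡⟨ cong (λ k → rest ℕ.+ (prefix a lo ℕ.+ a k)) (trans (eq 0) (+-identityʳ lo)) ⟩
  rest ℕ.+ prefix a (suc lo)
    ≡⟨ sum-applyUpTo a (suc lo) len (f ∘ suc) (λ t → trans (eq (suc t)) (+-suc lo t)) ⟩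
  prefix a (suc lo ℕ.+ len)              ≡⟨ cong (prefix a) (sym (+-suc lo len)) ⟩
  prefix a (lo ℕ.+ suc len)              ∎
  where
  open ≡-Reasoning
  rest : ℕ
  rest = foldr ℕ._+_ 0 (map a (applyUpTo (f ∘ suc) len))

sumA-potential : ∀ a {s e} → s ≤ suc e → ℕtoℚ (sumA a s e) + potential a s ≡ potential a (suc e)
sumA-potential a {s} {e} h = trans (sym (ℕtoℚ-+ (sumA a s e) (prefix a s)))
  (cong ℕtoℚ (trans (sum-applyUpTo a s (suc e ∸ s) _ (λ _ → refl)) (cong (prefix a) (m+[n∸m]≡n h))))

private
  ValidPt : ℕ → ℕ × ℕ → Set
  ValidPt n p = Valid n (proj₁ p) (proj₂ p)

  lastValid : ∀ {n} p q → All (ValidPt n) (p ∷ q) → LastDiag (p ∷ q) → suc (lastI (p ∷ q)) ≤ n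
  lastValid p [] ((_ , _ , v) ∷ []) refl = v
  lastValid p (r ∷ q) (_ ∷ vs) l = lastValid r q vs l

-- The walk `w` is the accumulator: the part of the path already read, ending at the head of the
-- remaining list.
fromList : ∀ {n s i j} (w : Walk s i j) q → All (ValidPt n) ((i , j) ∷ q) →
  LastDiag ((i , j) ∷ q) → Chain ((i , j) ∷ q) →
  Σ[ e ∈ ℕ ] Σ[ w′ ∈ Walk s e (suc e) ] (e ≡ lastI ((i , j) ∷ q) × (∀ x → total x w′ ≡ total x w + S x q))
fromList {i = i} w [] vs refl c = i , w , refl , λ x → sym (ℚP.+-identityʳ _)
fromList w (_ ∷ q) (v ∷ v′ ∷ vs) l (inj₁ (refl , refl) , c) =
  let e , w′ , p , t = fromList (right w (proj₁ (proj₂ v′))) q (v′ ∷ vs) l c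
  in e , w′ , p , λ x → trans (t x) (ℚP.+-assoc (total x w) _ _)
fromList w (_ ∷ q) (v ∷ v′ ∷ vs) l (inj₂ (refl , refl) , c) =
  let e , w′ , p , t = fromList (up w) q (v′ ∷ vs) l c
  in e , w′ , p , λ x → trans (t x) (ℚP.+-assoc (total x w) _ _)

toList : ∀ {s i j} → Walk s i j → List (ℕ × ℕ) → List (ℕ × ℕ)
toList start               q = q
toList (right {i} {j} w _) q = toList w ((suc i , j) ∷ q)
toList (up {i} {j} w)      q = toList w ((i , suc j) ∷ q)

S-toList : ∀ {s i j} x (w : Walk s i j) q → S x (toList w q) ≡ total x w + S x q
S-toList x start q = sym (ℚP.+-identityˡ _)
S-toList x (right w _) q = trans (S-toList x w _) (sym (ℚP.+-assoc (total x w) _ _))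
S-toList x (up w) q = trans (S-toList x w _) (sym (ℚP.+-assoc (total x w) _ _))

toList-valid : ∀ {n s i j} → 1 ≤ s → j ≤ n → (w : Walk s i j) → ∀ {q} → All (ValidPt n) q → All (ValidPt n) (toList w q)
toList-valid 1≤s j≤n start vs = vs
toList-valid 1≤s j≤n (right w h) vs = toList-valid 1≤s j≤n w ((s≤s z≤n , h , j≤n) ∷ vs)
toList-valid 1≤s j≤n (up w) vs =
  toList-valid 1≤s (<⇒≤ j≤n) w ((≤-trans 1≤s (walk-s≤i w) , s≤s (walk-i≤j w) , j≤n) ∷ vs)

toList-chain : ∀ {s i j} (w : Walk s i j) q → Chain ((i , j) ∷ q) → Chain (toList w q)
toList-chain start [] c = tt
toList-chain start (_ ∷ _) (_ , c) = c
toList-chain (right w _) q c = toList-chain w _ (inj₁ (refl , refl) , c)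
toList-chain (up w) q c = toList-chain w _ (inj₂ (refl , refl) , c)

toList-head : ∀ {s i j} (w : Walk s i j) q → i < j → Σ[ q′ ∈ List (ℕ × ℕ) ] toList w q ≡ (s , suc s) ∷ q′
toList-head start q h = ⊥-elim (<-irrefl refl h)
toList-head (right w h′) q h = toList-head w _ (<⇒≤ h′)
toList-head (up w) q h with off-diagonal w
... | inj₁ h′ = toList-head w _ h′
toList-head (up start) q h | inj₂ _ = q , refl
toList-head (up (right w h′)) q h | inj₂ _ = toList-head w _ (<⇒≤ h′)
toList-head (up (up w)) q h | inj₂ (refl , refl) = ⊥-elim (<-irrefl refl (walk-i≤j w))

toList-last : ∀ {s i j} (w : Walk s i j) p q →
  (LastDiag (p ∷ q) → LastDiag (toList w (p ∷ q))) × lastI (toList w (p ∷ q)) ≡ lastI (p ∷ q)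
toList-last start p q = (λ l → l) , refl
toList-last (right w _) p q = toList-last w _ (p ∷ q)
toList-last (up w) p q = toList-last w _ (p ∷ q)

toList-end : ∀ {s e} (w : Walk s e (suc e)) → LastDiag (toList w []) × lastI (toList w []) ≡ e
toList-end (right w _) = let l , i = toList-last w _ [] in l refl , i
toList-end (up w) = let l , i = toList-last w _ [] in l refl , i

InP⇒Member : ∀ {n a x} → InP n a x → Member n (potential a) x
InP⇒Member {n} {a} {x} (nonneg , bound) = nonneg , λ {s} {e} 1≤s e<n w →
  let q′ , eq     = toList-head w [] ≤-refl
      last , lastE = toList-end w
      dyck : IsDyck n (toList w [])
      dyck = toList-valid 1≤s e<n w [] , subst HeadDiag (sym eq) refl , last , toList-chain w [] tt
      M≡ : M a (toList w []) ≡ ℕtoℚ (sumA a s e)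
      M≡ = cong₂ (λ s e → ℕtoℚ (sumA a s e)) (cong firstI eq) lastE
  in subst₂ ℚ._≤_
       (cong (_+ potential a s) (trans (S-toList x w []) (ℚP.+-identityʳ (total x w))))
       (sumA-potential a (m≤n⇒m≤1+n (walk-s≤i w)))
       (ℚP.+-monoˡ-≤ (potential a s) (subst (S x (toList w []) ℚ.≤_) M≡ (bound _ dyck)))

Member⇒InP : ∀ {n a x} → Member n (potential a) x → InP n a x
Member⇒InP {n} {a} {x} (nonneg , bound) = nonneg , dyck-bound
  where
  dyck-bound : ∀ d → IsDyck n d → S x d ℚ.≤ M a d
  dyck-bound ((s , _) ∷ q) (v ∷ vs , refl , l , c)
    with fromList {n} (up start) q (v ∷ vs) l c
  ... | e , w , refl , t = ≤-by
      (0≤- (bound (proj₁ v) (lastValid (s , suc s) q (v ∷ vs) l) w))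
      (trans (cong₂ (λ T B → S x ((s , suc s) ∷ q) + (B - (T + potential a s)))
               (trans (t x) (cong (_+ S x q) (ℚP.+-identityˡ (x s (suc s)))))
               (sym (sumA-potential a (m≤n⇒m≤1+n (walk-s≤i w)))))
        (((∀ X M P → X + ((M + P) - (X + P)) ≡ M) ∋ solve-∀ ℚ-ring) (S x ((s , suc s) ∷ q)) (ℕtoℚ (sumA a s e)) (potential a s)))

-- Vertices and tangent cones for an arbitrary potential.

Vertex : ℕ → (ℕ → ℚ) → Point → Set
Vertex n A v = Member n A v
  × (∀ y z t → Member n A y → Member n A z → 0ℚ ℚ.< t → t ℚ.< 1ℚ
       → v ≈[ n ] (λ i j → t * y i j + (1ℚ - t) * z i j) → y ≈[ n ] z)

Tangent : ℕ → (ℕ → ℚ) → Point → Point → Set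
Tangent n A v u = Σ[ t ∈ ℚ ] (0ℚ ℚ.< t × Member n A (λ i j → v i j + t * u i j))

combo : (m : ℕ) → (Fin m → ℚ) → (Fin m → Point) → Point
combo m c w i j = sumFin m (λ k → c k * w k i j)

Simplicial : ℕ → (ℕ → ℚ) → Point → Set
Simplicial n A v = Σ[ m ∈ ℕ ] Σ[ w ∈ (Fin m → Point) ]
    ((∀ c → combo m c w ≈[ n ] (λ _ _ → 0ℚ) → ∀ k → c k ≡ 0ℚ)
   × (∀ u → Tangent n A v u ⇔ (Σ[ c ∈ (Fin m → ℚ) ] ((∀ k → 0ℚ ℚ.≤ c k) × (u ≈[ n ] combo m c w)))))

simple⇒vertex : ∀ {n a v} → IsSimpleVertex n a v → Vertex n (potential a) v
simple⇒vertex ((v∈P , extreme) , _) = InP⇒Member v∈P ,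
  λ y z t y∈ z∈ → extreme y z t (Member⇒InP y∈) (Member⇒InP z∈)

simple⇒simplicial : ∀ {n a v} → IsSimpleVertex n a v → Simplicial n (potential a) v
simple⇒simplicial (_ , m , w , indep , _ , cone) = m , (λ k → toPoint (w k)) , indep , λ u → mk⇔
  (λ (t , t>0 , h) → Equivalence.to (cone u) (t , t>0 , Member⇒InP h))
  (λ h → let t , t>0 , h′ = Equivalence.from (cone u) h in t , t>0 , InP⇒Member h′)

Member-cong : ∀ {n A x y} → x ≈[ n ] y → Member n A x → Member n A y
Member-cong {n} {A} e (nonneg , bound) =
  (λ i j v → subst (0ℚ ℚ.≤_) (e i j v) (nonneg i j v)) ,
  λ {s} 1≤s e<n w → subst (λ T → T + A s ℚ.≤ _) (total-cong e 1≤s e<n w) (bound 1≤s e<n w)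

zero⊎positive : ∀ {p} → 0ℚ ℚ.≤ p → p ≡ 0ℚ ⊎ 0ℚ ℚ.< p
zero⊎positive {p} h with 0ℚ ℚP.<? p
... | yes p>0 = inj₂ p>0
... | no  p≯0 = inj₁ (ℚP.≤-antisym (ℚP.≮⇒≥ p≯0) h)

positive-factor : ∀ {p q} → 0ℚ ℚ.≤ p → 0ℚ ℚ.≤ q → 0ℚ ℚ.< p * q → 0ℚ ℚ.< p × 0ℚ ℚ.< q
positive-factor {p} {q} p≥0 q≥0 pq>0 with zero⊎positive p≥0 | zero⊎positive q≥0
... | inj₂ p>0  | inj₂ q>0  = p>0 , q>0
... | inj₁ refl | _         = ⊥-elim (ℚP.<-irrefl (sym (ℚP.*-zeroˡ q)) pq>0)
... | _         | inj₁ refl = ⊥-elim (ℚP.<-irrefl (sym (ℚP.*-zeroʳ p)) pq>0)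

sumFin-cong : ∀ m {f g : Fin m → ℚ} → (∀ k → f k ≡ g k) → sumFin m f ≡ sumFin m g
sumFin-cong zero    e = refl
sumFin-cong (suc m) e = cong₂ _+_ (e Fin.zero) (sumFin-cong m (λ k → e (Fin.suc k)))

sumFin-lin : ∀ m (f g : Fin m → ℚ) c d →
  sumFin m (λ k → c * f k + d * g k) ≡ c * sumFin m f + d * sumFin m g
sumFin-lin zero f g c d = sym (((∀ c d → c * 0ℚ + d * 0ℚ ≡ 0ℚ) ∋ solve-∀ ℚ-ring) c d)
sumFin-lin (suc m) f g c d = trans (cong ((c * f Fin.zero + d * g Fin.zero) +_) (sumFin-lin m (f ∘ Fin.suc) (g ∘ Fin.suc) c d))
  (((∀ c d p q X Y → (c * p + d * q) + (c * X + d * Y) ≡ c * (p + X) + d * (q + Y)) ∋ solve-∀ ℚ-ring)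
    c d (f Fin.zero) (g Fin.zero) (sumFin m (f ∘ Fin.suc)) (sumFin m (g ∘ Fin.suc)))

sumFin-nonneg : ∀ m {f : Fin m → ℚ} → (∀ k → 0ℚ ℚ.≤ f k) → 0ℚ ℚ.≤ sumFin m f
sumFin-nonneg zero    h = ℚP.≤-refl
sumFin-nonneg (suc m) h = h Fin.zero ⊹ sumFin-nonneg m (λ k → h (Fin.suc k))

term≤sumFin : ∀ m {f : Fin m → ℚ} → (∀ k → 0ℚ ℚ.≤ f k) → ∀ k → f k ℚ.≤ sumFin m f
term≤sumFin (suc m) {f} h Fin.zero = ≤-by (sumFin-nonneg m (λ k → h (Fin.suc k))) refl
term≤sumFin (suc m) {f} h (Fin.suc k) = ≤-by (h Fin.zero ⊹ 0≤- (term≤sumFin m (λ k → h (Fin.suc k)) k))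
  (((∀ g z X → g + (z + (X - g)) ≡ z + X) ∋ solve-∀ ℚ-ring) (f (Fin.suc k)) (f Fin.zero) (sumFin m (f ∘ Fin.suc)))

positive-term : ∀ m {f : Fin m → ℚ} → 0ℚ ℚ.< sumFin m f → Σ[ k ∈ Fin m ] 0ℚ ℚ.< f k
positive-term zero h = ⊥-elim (ℚP.<-irrefl refl h)
positive-term (suc m) {f} h with 0ℚ ℚP.<? f Fin.zero
... | yes p = Fin.zero , p
... | no ¬p = let k , q = positive-term m (ℚP.<-≤-trans h (≤-by (0≤- (ℚP.≮⇒≥ ¬p))
                    (((∀ z X → z + X + (0ℚ - z) ≡ X) ∋ solve-∀ ℚ-ring) (f Fin.zero) (sumFin m (f ∘ Fin.suc)))))
              in Fin.suc k , q

unit : ∀ {m} → Fin m → Fin m → ℚ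
unit Fin.zero    Fin.zero    = 1ℚ
unit Fin.zero    (Fin.suc _) = 0ℚ
unit (Fin.suc _) Fin.zero    = 0ℚ
unit (Fin.suc k) (Fin.suc l) = unit k l

unit-diagonal : ∀ {m} (k : Fin m) → unit k k ≡ 1ℚ
unit-diagonal Fin.zero    = refl
unit-diagonal (Fin.suc k) = unit-diagonal k

unit-off-diagonal : ∀ {m} {k l : Fin m} → k ≢ l → unit k l ≡ 0ℚ
unit-off-diagonal {k = Fin.zero}  {Fin.zero}  h = ⊥-elim (h refl)
unit-off-diagonal {k = Fin.zero}  {Fin.suc l} h = refl
unit-off-diagonal {k = Fin.suc k} {Fin.zero}  h = refl
unit-off-diagonal {k = Fin.suc k} {Fin.suc l} h = unit-off-diagonal (λ e → h (cong Fin.suc e))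

unit-nonneg : ∀ {m} (k l : Fin m) → 0ℚ ℚ.≤ unit k l
unit-nonneg Fin.zero    Fin.zero    = 0≤1
unit-nonneg Fin.zero    (Fin.suc _) = ℚP.≤-refl
unit-nonneg (Fin.suc _) Fin.zero    = ℚP.≤-refl
unit-nonneg (Fin.suc k) (Fin.suc l) = unit-nonneg k l

sumFin-zero : ∀ m (g : Fin m → ℚ) → sumFin m (λ l → 0ℚ * g l) ≡ 0ℚ
sumFin-zero zero    g = refl
sumFin-zero (suc m) g = trans (cong₂ _+_ (ℚP.*-zeroˡ (g Fin.zero)) (sumFin-zero m (g ∘ Fin.suc))) (ℚP.+-identityˡ 0ℚ)

sumFin-unit : ∀ m (k : Fin m) (g : Fin m → ℚ) → sumFin m (λ l → unit k l * g l) ≡ g k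
sumFin-unit (suc m) Fin.zero g = trans (cong₂ _+_ (ℚP.*-identityˡ (g Fin.zero)) (sumFin-zero m (g ∘ Fin.suc))) (ℚP.+-identityʳ (g Fin.zero))
sumFin-unit (suc m) (Fin.suc k) g = trans (cong₂ _+_ (ℚP.*-zeroˡ (g Fin.zero)) (sumFin-unit m k (g ∘ Fin.suc))) (ℚP.+-identityˡ (g (Fin.suc k)))

combo-lin : ∀ m (c d : Fin m → ℚ) p q (w : Fin m → Point) i j →
  combo m (λ k → p * c k + q * d k) w i j ≡ p * combo m c w i j + q * combo m d w i j
combo-lin m c d p q w i j = trans
  (sumFin-cong m (λ k → ((∀ p c q d x → (p * c + q * d) * x ≡ p * (c * x) + q * (d * x)) ∋ solve-∀ ℚ-ring)
    p (c k) q (d k) (w k i j)))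
  (sumFin-lin m (λ k → c k * w k i j) (λ k → d k * w k i j) p q)

-- Linear functionals on the generators of a simplicial cone.

record Functional (n : ℕ) : Set where
  field
    ev   : Point → ℚ
    ev-≈ : ∀ {x y} → x ≈[ n ] y → ev x ≡ ev y
    lin  : ∀ x y c d → ev (λ i j → c * x i j + d * y i j) ≡ c * ev x + d * ev y

  ev-zero : ev (λ _ _ → 0ℚ) ≡ 0ℚ
  ev-zero = trans (ev-≈ (λ i j _ → sym (((∀ p q → 0ℚ * p + 0ℚ * q ≡ 0ℚ) ∋ solve-∀ ℚ-ring) 0ℚ 0ℚ)))
    (trans (lin (λ _ _ → 0ℚ) (λ _ _ → 0ℚ) 0ℚ 0ℚ)
      (((∀ p q → 0ℚ * p + 0ℚ * q ≡ 0ℚ) ∋ solve-∀ ℚ-ring) (ev (λ _ _ → 0ℚ)) (ev (λ _ _ → 0ℚ))))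

  ev-combo : ∀ m c w → ev (combo m c w) ≡ sumFin m (λ k → c k * ev (w k))
  ev-combo zero c w = ev-zero
  ev-combo (suc m) c w = trans
    (ev-≈ (λ i j _ → cong (c Fin.zero * w Fin.zero i j +_) (sym (ℚP.*-identityˡ (combo m (c ∘ Fin.suc) (w ∘ Fin.suc) i j)))))
    (trans (lin (w Fin.zero) (combo m (c ∘ Fin.suc) (w ∘ Fin.suc)) (c Fin.zero) 1ℚ)
      (cong (c Fin.zero * ev (w Fin.zero) +_)
        (trans (ℚP.*-identityˡ (ev (combo m (c ∘ Fin.suc) (w ∘ Fin.suc)))) (ev-combo m (c ∘ Fin.suc) (w ∘ Fin.suc)))))


open Functional using (ev; ev-≈; lin; ev-zero; ev-combo)

coordinate : ∀ {n} i j → Valid n i j → Functional n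
coordinate i j v = record { ev = λ x → x i j ; ev-≈ = λ e → e i j v ; lin = λ x y c d → refl }

negTotal : ∀ {n s e} → 1 ≤ s → suc e ≤ n → Walk s e (suc e) → Functional n
negTotal 1≤s e<n w = record
  { ev   = λ x → - total x w
  ; ev-≈ = λ e → cong -_ (total-cong e 1≤s e<n w)
  ; lin  = λ x y c d → trans (cong -_ (total-lin x y c d w))
      (((∀ c d X Y → - (c * X + d * Y) ≡ c * - X + d * - Y) ∋ solve-∀ ℚ-ring) c d (total x w) (total y w)) }

-- A point of P on the face where f is minimal, from which one can move in P
-- in every direction along that face.
Inner : ∀ n → (ℕ → ℚ) → Functional n → Point → Point → Set
Inner n A f v y = Member n A y × ev f y ≡ ev f v
  × (∀ z → ev f z ≡ 0ℚ → Σ[ ε ∈ ℚ ] (0ℚ ℚ.< ε × Member n A (λ i j → y i j + ε * z i j)))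

module _ {n A v} (simplicial : Simplicial n A v) where

  private
    m = proj₁ simplicial
    w = proj₁ (proj₂ simplicial)
    independent = proj₁ (proj₂ (proj₂ simplicial))
    cone = proj₂ (proj₂ (proj₂ simplicial))

    Minimal : Functional n → Set
    Minimal f = ∀ {y} → Member n A y → ev f v ℚ.≤ ev f y

    _∙_ : Functional n → Fin m → ℚ
    f ∙ k = ev f (w k)

    unique : ∀ c d → combo m c w ≈[ n ] combo m d w → ∀ k → c k ≡ d k
    unique c d e k = trans (((∀ c d → c ≡ (1ℚ * c + - 1ℚ * d) + d) ∋ solve-∀ ℚ-ring) (c k) (d k))
      (trans (cong (_+ d k) (independent (λ k → 1ℚ * c k + - 1ℚ * d k) zero-combo k)) (ℚP.+-identityˡ (d k)))
      where
      zero-combo : combo m (λ k → 1ℚ * c k + - 1ℚ * d k) w ≈[ n ] (λ _ _ → 0ℚ)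
      zero-combo i j valid = trans (combo-lin m c d 1ℚ (- 1ℚ) w i j)
        (trans (cong (λ p → 1ℚ * p + - 1ℚ * combo m d w i j) (e i j valid))
          (((∀ p → 1ℚ * p + - 1ℚ * p ≡ 0ℚ) ∋ solve-∀ ℚ-ring) (combo m d w i j)))

    w∈cone : ∀ k → Tangent n A v (w k)
    w∈cone k = Equivalence.from (cone (w k))
      (unit k , unit-nonneg k , λ i j _ → sym (sumFin-unit m k (λ l → w l i j)))

    nonneg : ∀ f → Minimal f → ∀ k → 0ℚ ℚ.≤ f ∙ k
    nonneg f min k = let t , t>0 , h = w∈cone k in 0≤*⇒0≤ t>0
      (≤-by (0≤- (min h)) (trans
        (cong (λ p → 0ℚ + (p - ev f v)) (trans
          (Functional.ev-≈ f (λ i j _ → cong (_+ t * w k i j) (sym (ℚP.*-identityˡ (v i j)))))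
          (Functional.lin f v (w k) 1ℚ t)))
        (((∀ V t W → 0ℚ + ((1ℚ * V + t * W) - V) ≡ t * W) ∋ solve-∀ ℚ-ring) (ev f v) t (f ∙ k))))

    coordinates : ∀ {y} → Member n A y → Σ[ c ∈ (Fin m → ℚ) ] ((∀ k → 0ℚ ℚ.≤ c k)
      × (λ i j → 1ℚ * y i j + - 1ℚ * v i j) ≈[ n ] combo m c w)
    coordinates {y} y∈ = Equivalence.to (cone _) (1ℚ , 0<1 , Member-cong
      (λ i j _ → ((∀ Y V → Y ≡ V + 1ℚ * (1ℚ * Y + - 1ℚ * V)) ∋ solve-∀ ℚ-ring) (y i j) (v i j)) y∈)

    difference : ∀ f {y} (y∈ : Member n A y) →
      ev f y ≡ ev f v + sumFin m (λ k → proj₁ (coordinates y∈) k * (f ∙ k))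
    difference f {y} y∈ = trans
      (((∀ Y V → Y ≡ V + (1ℚ * Y + - 1ℚ * V)) ∋ solve-∀ ℚ-ring) (ev f y) (ev f v))
      (cong (ev f v +_) (trans (sym (Functional.lin f y v 1ℚ (- 1ℚ)))
        (trans (Functional.ev-≈ f (proj₂ (proj₂ (coordinates y∈))))
          (Functional.ev-combo f m (proj₁ (coordinates y∈)) w))))

    -- The difference `ev f y - ev f v` is a sum of nonnegative terms `c k * (f ∙ k)`; when it
    -- vanishes, so does each term.
    zero-term : ∀ f → Minimal f → ∀ {y} (y∈ : Member n A y) → ev f y ≡ ev f v →
      ∀ k → 0ℚ ℚ.< proj₁ (coordinates y∈) k → f ∙ k ≡ 0ℚ
    zero-term f min {y} y∈ e k c>0 = [ (λ f≡0 → f≡0) , (λ f>0 → ⊥-elim (≤⇒<⇒⊥ (ℚP.≤-reflexive sum≡0)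
        (ℚP.<-≤-trans (0<* c>0 f>0)
          (term≤sumFin m (λ k → 0≤* (proj₁ (proj₂ (coordinates y∈)) k) (nonneg f min k)) k)))) ]′
        (zero⊎positive (nonneg f min k))
      where
      sum≡0 : sumFin m (λ k → proj₁ (coordinates y∈) k * (f ∙ k)) ≡ 0ℚ
      sum≡0 = trans
        (((∀ V X → X ≡ (V + X) - V) ∋ solve-∀ ℚ-ring) (ev f v) (sumFin m (λ k → proj₁ (coordinates y∈) k * (f ∙ k))))
        (trans (cong (_- ev f v) (trans (sym (difference f y∈)) e)) (ℚP.+-inverseʳ (ev f v)))

    -- Some term `c k * (f ∙ k)` of the expansion of y - v must be positive. Its generator then
    -- occurs in y - v, and since y lies on the face of g, g vanishes on it.
    witness : ∀ f g → Minimal f → Minimal g → ∀ {y} → Member n A y → ev f v ℚ.< ev f y → ev g y ≡ ev g v →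
      Σ[ k ∈ Fin m ] (0ℚ ℚ.< f ∙ k × g ∙ k ≡ 0ℚ)
    witness f g f-min g-min {y} y∈ f< g≡ =
      let c , c≥0 , _ = coordinates y∈
          k , h = positive-term m (subst (0ℚ ℚ.<_) (trans (cong (_- ev f v) (difference f y∈))
                    (((∀ V X → (V + X) - V ≡ X) ∋ solve-∀ ℚ-ring) (ev f v) (sumFin m (λ k → c k * (f ∙ k))))) (0<- f<))
          c>0 , f>0 = positive-factor (c≥0 k) (nonneg f f-min k) h
      in k , f>0 , zero-term g g-min y∈ g≡ k c>0

    -- An inner point of the face f = min makes this face a facet of the cone,
    -- so f is positive on a single generator.
    facet : ∀ f → Minimal f → ∀ {y} → Inner n A f v y → ∀ {k l} → k ≢ l → 0ℚ ℚ.< f ∙ k → 0ℚ ℚ.< f ∙ l → ⊥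
    facet f min {y} (y∈ , e , move) {k} {l} k≢l fk fl =
        ℚP.<-irrefl (sym (zero-term f min y∈ e l cl>0)) fl
      where
      z : Point
      -- The combination of the two generators that f kills. Moving along it lowers the coefficient
      -- of `w l`, so that coefficient was positive at y, although y lies on the face of f.
      z i j = (f ∙ l) * w k i j + - (f ∙ k) * w l i j
      fz : ev f z ≡ 0ℚ
      fz = trans (Functional.lin f (w k) (w l) (f ∙ l) (- (f ∙ k)))
        (((∀ p q → p * q + - q * p ≡ 0ℚ) ∋ solve-∀ ℚ-ring) (f ∙ l) (f ∙ k))
      ε = proj₁ (move z fz)
      ε>0 = proj₁ (proj₂ (move z fz))
      y′∈ = proj₂ (proj₂ (move z fz))
      c = proj₁ (coordinates y∈)
      c′ = proj₁ (coordinates y′∈)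
      d : Fin m → ℚ
      d q = (f ∙ l) * unit k q + - (f ∙ k) * unit l q
      coefficients : ∀ q → c′ q ≡ 1ℚ * c q + ε * d q
      coefficients = unique c′ (λ q → 1ℚ * c q + ε * d q) λ i j valid → trans
        (sym (proj₂ (proj₂ (coordinates y′∈)) i j valid))
        (trans (((∀ Y V ε Z → 1ℚ * (Y + ε * Z) + - 1ℚ * V ≡ 1ℚ * (1ℚ * Y + - 1ℚ * V) + ε * Z) ∋ solve-∀ ℚ-ring)
            (y i j) (v i j) ε (z i j))
          (trans (cong₂ (λ a b → 1ℚ * a + ε * b) (proj₂ (proj₂ (coordinates y∈)) i j valid)
              (trans (sym (cong₂ (λ a b → (f ∙ l) * a + - (f ∙ k) * b)
                  (sumFin-unit m k (λ q → w q i j)) (sumFin-unit m l (λ q → w q i j))))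
                (sym (combo-lin m (unit k) (unit l) (f ∙ l) (- (f ∙ k)) w i j))))
            (sym (combo-lin m c d 1ℚ ε w i j))))
      cl>0 : 0ℚ ℚ.< c l
      cl>0 = subst (0ℚ ℚ.<_) (sym cl≡) (proj₁ (proj₂ (coordinates y′∈)) l ⊹< 0<* ε>0 fk)
        where
        dl≡ : d l ≡ - (f ∙ k)
        dl≡ = trans (cong₂ (λ a b → (f ∙ l) * a + - (f ∙ k) * b) (unit-off-diagonal k≢l) (unit-diagonal l))
          (((∀ p q → p * 0ℚ + - q * 1ℚ ≡ - q) ∋ solve-∀ ℚ-ring) (f ∙ l) (f ∙ k))
        cl≡ : c l ≡ c′ l + ε * (f ∙ k)
        cl≡ = trans (((∀ c ε p → c ≡ (1ℚ * c + ε * - p) + ε * p) ∋ solve-∀ ℚ-ring) (c l) ε (f ∙ k))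
          (cong (_+ ε * (f ∙ k)) (sym (trans (coefficients l) (cong (λ p → 1ℚ * c l + ε * p) dl≡))))

  -- The inequalities active at a vertex with simplicial tangent cone satisfy
  -- no relation f₁ + f₂ = f₃ + f₄ in which f₁ defines a facet other than
  -- those of f₃ and f₄.
  no-relation : ∀ f₁ f₂ f₃ f₄ → Minimal f₁ → Minimal f₂ → Minimal f₃ → Minimal f₄ →
    (∀ u → ev f₁ u + ev f₂ u ≡ ev f₃ u + ev f₄ u) → (∃ λ y → Inner n A f₁ v y) →
    (∃ λ y → Member n A y × ev f₁ v ℚ.< ev f₁ y × ev f₃ y ≡ ev f₃ v) →
    (∃ λ y → Member n A y × ev f₁ v ℚ.< ev f₁ y × ev f₄ y ≡ ev f₄ v) → ⊥
  no-relation f₁ f₂ f₃ f₄ min₁ min₂ min₃ min₄ rel (_ , inner) (_ , y₃∈ , lt₃ , eq₃) (_ , y₄∈ , lt₄ , eq₄) =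
      conclude (witness f₁ f₃ min₁ min₃ y₃∈ lt₃ eq₃) (witness f₁ f₄ min₁ min₄ y₄∈ lt₄ eq₄)
    where
    conclude : Σ[ k ∈ Fin m ] (0ℚ ℚ.< f₁ ∙ k × f₃ ∙ k ≡ 0ℚ) → Σ[ k ∈ Fin m ] (0ℚ ℚ.< f₁ ∙ k × f₄ ∙ k ≡ 0ℚ) → ⊥
    conclude (k , f₁k>0 , f₃k≡0) (l , f₁l>0 , f₄l≡0) = same (k FinP.≟ l)
      where
      -- The facet property makes the two generators equal. On this one the left side of the
      -- relation is positive and the right side zero.
      same : Dec (k ≡ l) → ⊥
      same (no k≢l)   = facet f₁ min₁ inner k≢l f₁k>0 f₁l>0
      same (yes refl) = ℚP.<-irrefl (sym (trans (trans (ℚP.+-comm (f₂ ∙ k) (f₁ ∙ k)) (rel (w k)))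
        (trans (cong₂ _+_ f₃k≡0 f₄l≡0) (ℚP.+-identityˡ 0ℚ)))) (nonneg f₂ min₂ k ⊹< f₁k>0)

-- One constant that serves finitely many indices. `join` merges two constants: addition for upper
-- bounds (`bounded`), minimum for positive lower bounds (`smallest`).
uniform : (Q : ℚ → Set) (P : ℕ → ℚ → Set) →
  (∀ {p q} → Q p → Q q → Σ[ r ∈ ℚ ] (Q r × (∀ k → P k p → P k r) × (∀ k → P k q → P k r))) →
  (∀ k → Σ[ p ∈ ℚ ] (Q p × P k p)) → ∀ n → Σ[ p ∈ ℚ ] (Q p × (∀ k → k ≤ n → P k p))
uniform Q P join each zero = let p , Qp , Pp = each zero in p , Qp , λ { zero z≤n → Pp }
uniform Q P join each (suc n) =
  let p , Qp , Pp = uniform Q P join each n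
      q , Qq , Pq = each (suc n)
      r , Qr , pr , qr = join Qp Qq
  in r , Qr , λ k k≤ → [ (λ k< → pr k (Pp k (≤-pred k<))) , (λ { refl → qr (suc n) Pq }) ]′ (m≤n⇒m<n∨m≡n k≤)

uniform₂ : (Q : ℚ → Set) (P : ℕ → ℕ → ℚ → Set) →
  (∀ {p q} → Q p → Q q → Σ[ r ∈ ℚ ] (Q r × (∀ k l → P k l p → P k l r) × (∀ k l → P k l q → P k l r))) →
  (∀ k l → Σ[ p ∈ ℚ ] (Q p × P k l p)) → ∀ n → Σ[ p ∈ ℚ ] (Q p × (∀ k l → k ≤ n → l ≤ n → P k l p))
uniform₂ Q P join each n =
  let p , Qp , h = uniform Q (λ k p → ∀ l → l ≤ n → P k l p)
        (λ Qp Qq → let r , Qr , f , g = join Qp Qq in r , Qr ,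
          (λ k h l l≤ → f k l (h l l≤)) , (λ k h l l≤ → g k l (h l l≤)))
        (λ k → uniform Q (P k) (λ Qp Qq → let r , Qr , f , g = join Qp Qq in r , Qr , f k , g k) (each k) n) n
  in p , Qp , λ k l k≤ l≤ → h k k≤ l l≤

bounded : ∀ n (z : Point) → Σ[ B ∈ ℚ ] (0ℚ ℚ.≤ B × (∀ i j → i ≤ n → j ≤ n → - B ℚ.≤ z i j × z i j ℚ.≤ B))
bounded n z = uniform₂ (0ℚ ℚ.≤_) (λ i j B → - B ℚ.≤ z i j × z i j ℚ.≤ B)
    (λ {p} {q} p≥0 q≥0 → p + q , p≥0 ⊹ q≥0 ,
      (λ k l (a , b) →
          ≤-by (0≤- a ⊹ q≥0) (((∀ p q z → - (p + q) + ((z - - p) + q) ≡ z) ∋ solve-∀ ℚ-ring) p q (z k l)) ,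
          ≤-by (0≤- b ⊹ q≥0) (((∀ p q z → z + ((p - z) + q) ≡ p + q) ∋ solve-∀ ℚ-ring) p q (z k l))) ,
      (λ k l (a , b) →
          ≤-by (0≤- a ⊹ p≥0) (((∀ p q z → - (p + q) + ((z - - q) + p) ≡ z) ∋ solve-∀ ℚ-ring) p q (z k l)) ,
          ≤-by (0≤- b ⊹ p≥0) (((∀ p q z → z + ((q - z) + p) ≡ p + q) ∋ solve-∀ ℚ-ring) p q (z k l))))
    (λ i j → ℚ.∣ z i j ∣ , ℚP.0≤∣p∣ (z i j) , abs-bound (z i j)) n
  where
  abs-bound : ∀ p → - ℚ.∣ p ∣ ℚ.≤ p × p ℚ.≤ ℚ.∣ p ∣
  abs-bound p with ℚP.∣p∣≡p∨∣p∣≡-p p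
  ... | inj₁ e = ≤-by (subst (0ℚ ℚ.≤_) e (ℚP.0≤∣p∣ p) ⊹ subst (0ℚ ℚ.≤_) e (ℚP.0≤∣p∣ p))
                   (trans (cong (λ a → - a + (p + p)) e) (((∀ p → - p + (p + p) ≡ p) ∋ solve-∀ ℚ-ring) p))
               , ℚP.≤-reflexive (sym e)
  ... | inj₂ e = ℚP.≤-reflexive (trans (cong -_ e) (((∀ p → - - p ≡ p) ∋ solve-∀ ℚ-ring) p))
               , ≤-by (subst (0ℚ ℚ.≤_) e (ℚP.0≤∣p∣ p) ⊹ subst (0ℚ ℚ.≤_) e (ℚP.0≤∣p∣ p))
                   (trans (((∀ p → p + (- p + - p) ≡ - p) ∋ solve-∀ ℚ-ring) p) (sym e))

-- Perturbing a point of the polytope.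

total-shift : ∀ {s i j} (x z : Point) t (w : Walk s i j) →
  total (λ i j → x i j + t * z i j) w ≡ total x w + t * total z w
total-shift x z t w = trans
  (total-cong′ w)
  (trans (total-lin x z 1ℚ t w) (cong (_+ t * total z w) (ℚP.*-identityˡ (total x w))))
  where
  total-cong′ : ∀ {s i j} (w : Walk s i j) →
    total (λ i j → x i j + t * z i j) w ≡ total (λ i j → 1ℚ * x i j + t * z i j) w
  total-cong′ start = refl
  total-cong′ (right {i} {j} w _) = cong₂ (λ a b → a + (b + t * z (suc i) j)) (total-cong′ w) (sym (ℚP.*-identityˡ (x (suc i) j)))
  total-cong′ (up {i} {j} w) = cong₂ (λ a b → a + (b + t * z i (suc j))) (total-cong′ w) (sym (ℚP.*-identityˡ (x i (suc j))))

ℕtoℚ-suc : ∀ k → ℕtoℚ (suc k) ≡ 1ℚ + ℕtoℚ k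
ℕtoℚ-suc = ℕtoℚ-+ 1

ℕtoℚ-mono : ∀ {k l} → k ≤ l → ℕtoℚ k ℚ.≤ ℕtoℚ l
ℕtoℚ-mono {k} {l} h = ≤-by (0≤ℕtoℚ (l ∸ k)) (trans (sym (ℕtoℚ-+ k (l ∸ k))) (cong ℕtoℚ (m+[n∸m]≡n h)))

-- Each step adds at most B and raises i + j by one.
total-bound : ∀ {n B z s i j} → 0ℚ ℚ.≤ B → (∀ i j → Valid n i j → z i j ℚ.≤ B) → 1 ≤ s → j ≤ n →
  (w : Walk s i j) → total z w ℚ.≤ B * ℕtoℚ (i ℕ.+ j)
total-bound {B = B} {s = s} B≥0 h 1≤s j≤n start = 0≤* B≥0 (0≤ℕtoℚ (s ℕ.+ s))
total-bound {B = B} {z} B≥0 h 1≤s j≤n (right {i} {j} w i<j) =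
  subst (λ N → total z w + z (suc i) j ℚ.≤ B * N) (sym (ℕtoℚ-suc (i ℕ.+ j)))
    (≤-by (0≤- (total-bound B≥0 h 1≤s j≤n w) ⊹ 0≤- (h (suc i) j (s≤s z≤n , i<j , j≤n)))
      (((∀ T x B N → T + x + ((B * N - T) + (B - x)) ≡ B * (1ℚ + N)) ∋ solve-∀ ℚ-ring)
        (total z w) (z (suc i) j) B (ℕtoℚ (i ℕ.+ j))))
total-bound {B = B} {z} B≥0 h 1≤s j≤n (up {i} {j} w) =
  subst (λ N → total z w + z i (suc j) ℚ.≤ B * N) (sym (trans (cong ℕtoℚ (+-suc i j)) (ℕtoℚ-suc (i ℕ.+ j))))
    (≤-by (0≤- (total-bound B≥0 h 1≤s (<⇒≤ j≤n) w)
           ⊹ 0≤- (h i (suc j) (≤-trans 1≤s (walk-s≤i w) , s≤s (walk-i≤j w) , j≤n)))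
      (((∀ T x B N → T + x + ((B * N - T) + (B - x)) ≡ B * (1ℚ + N)) ∋ solve-∀ ℚ-ring)
        (total z w) (z i (suc j)) B (ℕtoℚ (i ℕ.+ j))))

-- Moving from y by a small multiple of z does not leave P if all inequalities
-- against which z moves have slack at least δ; the step depends only on δ and
-- on a bound for z.
perturb : ∀ {n A y δ B} → 0ℚ ℚ.< δ → 0ℚ ℚ.≤ B → Σ[ t ∈ ℚ ] (0ℚ ℚ.< t × (∀ z →
  (∀ i j → Valid n i j → - B ℚ.≤ z i j × z i j ℚ.≤ B) →
  (∀ i j → Valid n i j → δ ℚ.≤ y i j ⊎ (0ℚ ℚ.≤ y i j × 0ℚ ℚ.≤ z i j)) →
  (∀ {s e} → 1 ≤ s → suc e ≤ n → (w : Walk s e (suc e)) →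
     total y w + A s + δ ℚ.≤ A (suc e) ⊎ (total y w + A s ℚ.≤ A (suc e) × total z w ℚ.≤ 0ℚ)) →
  Member n A (λ i j → y i j + t * z i j)))
perturb {n} {A} {y} {δ} {B} δ>0 B≥0 = t , t>0 , λ z bound pos slack →
    (λ i j valid → [ (λ h → ≤-by
         (0≤- h ⊹ 0≤- t≤ ⊹ 0≤* t≥0 (0≤* B≥0 (0≤ℕtoℚ (n ℕ.+ n))) ⊹ 0≤* t≥0 (0≤- (proj₁ (bound i j valid))))
         (((∀ y δ t B N z → 0ℚ + ((y - δ) + (δ - t * (B + B * N)) + t * (B * N) + t * (z - - B)) ≡ y + t * z) ∋ solve-∀ ℚ-ring)
            (y i j) δ t B (ℕtoℚ (n ℕ.+ n)) (z i j)))
       , (λ (y≥0 , z≥0) → y≥0 ⊹ 0≤* t≥0 z≥0) ]′ (pos i j valid)) ,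
    (λ {s} {e} 1≤s e<n w → subst (λ T → T + A s ℚ.≤ A (suc e)) (sym (total-shift y z t w))
      ([ (λ h → ≤-by
           (0≤- h ⊹ 0≤- t≤ ⊹ 0≤* t≥0 B≥0 ⊹ 0≤* t≥0 (0≤- (ℚP.≤-trans
              (total-bound B≥0 (λ i j v → proj₂ (bound i j v)) 1≤s e<n w)
              (ℚP.*-monoˡ-≤-nonNeg B ⦃ ℚ.nonNegative B≥0 ⦄
                (ℕtoℚ-mono (+-mono-≤ (<⇒≤ e<n) e<n))))))
           (((∀ Y s e δ t B N Z → Y + t * Z + s + ((e - (Y + s + δ)) + (δ - t * (B + B * N)) + t * B + t * (B * N - Z)) ≡ e) ∋ solve-∀ ℚ-ring)
              (total y w) (A s) (A (suc e)) δ t B (ℕtoℚ (n ℕ.+ n)) (total z w)))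
       , (λ (h , z≤0) → ≤-by (0≤- h ⊹ 0≤* t≥0 (0≤- z≤0))
           (((∀ Y s e t Z → Y + t * Z + s + ((e - (Y + s)) + t * (0ℚ - Z)) ≡ e) ∋ solve-∀ ℚ-ring)
              (total y w) (A s) (A (suc e)) t (total z w))) ]′ (slack 1≤s e<n w)))
  where
  factor : Σ[ t ∈ ℚ ] (0ℚ ℚ.< t × t * (B + B * ℕtoℚ (n ℕ.+ n)) ℚ.≤ δ)
  -- One factor for both kinds of inequality: a coordinate changes by at most t * B, the sum along a
  -- walk grows by at most t * B * 2n.
  factor = small-factor (B≥0 ⊹ 0≤* B≥0 (0≤ℕtoℚ (n ℕ.+ n))) δ>0
  t = proj₁ factor
  t>0 = proj₁ (proj₂ factor)
  t≤ = proj₂ (proj₂ factor)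
  t≥0 : 0ℚ ℚ.≤ t
  t≥0 = ℚP.<⇒≤ t>0

total-neg : ∀ {s i j} (z : Point) (w : Walk s i j) → total (λ i j → - z i j) w ≡ - total z w
total-neg z start = refl
total-neg z (right {i} {j} w _) = trans (cong (_+ - z (suc i) j) (total-neg z w)) (sym (ℚP.neg-distrib-+ (total z w) (z (suc i) j)))
total-neg z (up {i} {j} w) = trans (cong (_+ - z i (suc j)) (total-neg z w)) (sym (ℚP.neg-distrib-+ (total z w) (z i (suc j))))

-- If z is invisible to every inequality with slack below δ, both v + t z and v - t z lie in P for
-- small t, and v is their midpoint. This is how extremality of a vertex is used below.
rigid : ∀ {n A v} → Vertex n A v → ∀ {δ} z → 0ℚ ℚ.< δ →
  (∀ i j → Valid n i j → δ ℚ.≤ v i j ⊎ z i j ≡ 0ℚ) →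
  (∀ {s e} → 1 ≤ s → suc e ≤ n → (w : Walk s e (suc e)) → total v w + A s + δ ℚ.≤ A (suc e) ⊎ total z w ≡ 0ℚ) →
  z ≈[ n ] (λ _ _ → 0ℚ)
rigid {n} {A} {v} (v∈ , extreme) {δ} z δ>0 pos slack = λ i j valid → cancel (v i j) (z i j)
      (extreme _ _ ½ (move z (λ i j v → bound i j (<⇒≤ (<-≤-trans (proj₁ (proj₂ v)) (proj₂ (proj₂ v)))) (proj₂ (proj₂ v)))
          (λ i j v → [ inj₁ , (λ e → inj₂ (proj₁ v∈ i j v , ℚP.≤-reflexive (sym e))) ]′ (pos i j v))
          (λ 1≤s e<n w → [ inj₁ , (λ e → inj₂ (proj₂ v∈ 1≤s e<n w , ℚP.≤-reflexive e)) ]′ (slack 1≤s e<n w)))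
        (move (λ i j → - z i j)
          (λ i j v → let a , b = bound i j (<⇒≤ (<-≤-trans (proj₁ (proj₂ v)) (proj₂ (proj₂ v)))) (proj₂ (proj₂ v))
                     in ℚP.neg-antimono-≤ b , subst (- z i j ℚ.≤_) (((∀ p → - - p ≡ p) ∋ solve-∀ ℚ-ring) B) (ℚP.neg-antimono-≤ a))
          (λ i j v → [ inj₁ , (λ e → inj₂ (proj₁ v∈ i j v , ℚP.≤-reflexive (sym (cong -_ e)))) ]′ (pos i j v))
          (λ 1≤s e<n w → [ inj₁ , (λ e → inj₂ (proj₂ v∈ 1≤s e<n w ,
              ℚP.≤-reflexive (trans (total-neg z w) (cong -_ e)))) ]′ (slack 1≤s e<n w)))
        (ℚP.positive⁻¹ ½) ½<1
        (λ i j _ → ((∀ v t z → v ≡ ½ * (v + t * z) + (1ℚ - ½) * (v + t * - z)) ∋ solve-∀ ℚ-ring) (v i j) t (z i j))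
        i j valid)
  where
  B = proj₁ (bounded n z)
  bound = proj₂ (proj₂ (bounded n z))
  step = perturb {n} {A} {v} {δ} {B} δ>0 (proj₁ (proj₂ (bounded n z)))
  t = proj₁ step
  t>0 = proj₁ (proj₂ step)
  move = proj₂ (proj₂ step)
  ½<1 : ½ ℚ.< 1ℚ
  ½<1 = <-by (ℚP.positive⁻¹ ½) refl
  cancel : ∀ v p → v + t * p ≡ v + t * - p → p ≡ 0ℚ
  cancel v p e = ℚP.≤-antisym
      (≤-by (0≤*⇒0≤ t>0 (ℚP.≤-reflexive (sym tp≡0))) (ℚP.+-inverseʳ p))
      (0≤*⇒0≤ t>0 (ℚP.≤-reflexive (sym tp≡0′)))
    where
    tp≡0′ : t * p ≡ 0ℚ
    tp≡0′ = trans (((∀ v t p → t * p ≡ ½ * ((v + t * p) - (v + t * - p))) ∋ solve-∀ ℚ-ring) v t p)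
      (trans (cong (λ q → ½ * (q - (v + t * - p))) e) (((∀ q → ½ * (q - q) ≡ 0ℚ) ∋ solve-∀ ℚ-ring) (v + t * - p)))
    tp≡0 : t * - p ≡ 0ℚ
    tp≡0 = trans (sym (ℚP.neg-distribʳ-* t p)) (cong -_ tp≡0′)

-- Points on a walk, hooks, row and column sums.

On : ∀ {s i j} → Walk s i j → ℕ → ℕ → Set
On start               p q = ⊥
On (right {i} {j} w _) p q = (suc i ≡ p × j ≡ q) ⊎ On w p q
On (up {i} {j} w)      p q = (i ≡ p × suc j ≡ q) ⊎ On w p q

On-bounds : ∀ {s i j p q} (w : Walk s i j) → On w p q → s ≤ p × p ≤ i × q ≤ j
On-bounds (right w _) (inj₁ (refl , refl)) = m≤n⇒m≤1+n (walk-s≤i w) , ≤-refl , ≤-refl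
On-bounds (right w _) (inj₂ o) = let a , b , c = On-bounds w o in a , m≤n⇒m≤1+n b , c
On-bounds (up w) (inj₁ (refl , refl)) = walk-s≤i w , ≤-refl , ≤-refl
On-bounds (up w) (inj₂ o) = let a , b , c = On-bounds w o in a , b , m≤n⇒m≤1+n c

ind : ℕ → ℕ → Point
ind p q i j with i ℕ.≟ p | j ℕ.≟ q
... | yes _ | yes _ = 1ℚ
... | yes _ | no  _ = 0ℚ
... | no  _ | _     = 0ℚ

ind-at : ∀ {p q i j} → i ≡ p → j ≡ q → ind p q i j ≡ 1ℚ
ind-at {p} {q} {i} {j} e f with i ℕ.≟ p | j ℕ.≟ q
... | yes _ | yes _ = refl
... | yes _ | no ¬f = ⊥-elim (¬f f)
... | no ¬e | _     = ⊥-elim (¬e e)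

ind-off : ∀ {p q i j} → ¬ (i ≡ p × j ≡ q) → ind p q i j ≡ 0ℚ
ind-off {p} {q} {i} {j} h with i ℕ.≟ p | j ℕ.≟ q
... | yes e | yes f = ⊥-elim (h (e , f))
... | yes _ | no  _ = refl
... | no  _ | _     = refl

ind-cases : ∀ p q i j → (ind p q i j ≡ 1ℚ × i ≡ p × j ≡ q) ⊎ (ind p q i j ≡ 0ℚ × ¬ (i ≡ p × j ≡ q))
ind-cases p q i j with i ℕ.≟ p | j ℕ.≟ q
... | yes e | yes f = inj₁ (refl , e , f)
... | yes _ | no ¬f = inj₂ (refl , λ (_ , f) → ¬f f)
... | no ¬e | _     = inj₂ (refl , λ (e , _) → ¬e e)

ind-nonneg : ∀ p q i j → 0ℚ ℚ.≤ ind p q i j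
ind-nonneg p q i j = [ (λ (e , _) → subst (0ℚ ℚ.≤_) (sym e) 0≤1) , (λ (e , _) → ℚP.≤-reflexive (sym e)) ]′ (ind-cases p q i j)

-- No index decreases and one grows at each step, so a point cannot be met twice.
total-ind : ∀ {s i j} p q (w : Walk s i j) →
  (total (ind p q) w ≡ 1ℚ × On w p q) ⊎ (total (ind p q) w ≡ 0ℚ × ¬ On w p q)
total-ind p q start = inj₂ (refl , λ ())
total-ind p q (right {i} {j} w _) with ind-cases p q (suc i) j | total-ind p q w
... | inj₂ (e , h)        | inj₁ (t , o)  = inj₁ (trans (cong₂ _+_ t e) (ℚP.+-identityʳ 1ℚ) , inj₂ o)
... | inj₂ (e , h)        | inj₂ (t , ¬o) = inj₂ (trans (cong₂ _+_ t e) (ℚP.+-identityʳ 0ℚ) , λ { (inj₁ h′) → h h′ ; (inj₂ o) → ¬o o })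
... | inj₁ (e , f , g)    | inj₂ (t , _)  = inj₁ (trans (cong₂ _+_ t e) (ℚP.+-identityˡ 1ℚ) , inj₁ (f , g))
... | inj₁ (_ , f , _)    | inj₁ (_ , o)  = ⊥-elim (<-irrefl (sym f) (s≤s (proj₁ (proj₂ (On-bounds w o)))))
total-ind p q (up {i} {j} w) with ind-cases p q i (suc j) | total-ind p q w
... | inj₂ (e , h)        | inj₁ (t , o)  = inj₁ (trans (cong₂ _+_ t e) (ℚP.+-identityʳ 1ℚ) , inj₂ o)
... | inj₂ (e , h)        | inj₂ (t , ¬o) = inj₂ (trans (cong₂ _+_ t e) (ℚP.+-identityʳ 0ℚ) , λ { (inj₁ h′) → h h′ ; (inj₂ o) → ¬o o })
... | inj₁ (e , f , g)    | inj₂ (t , _)  = inj₁ (trans (cong₂ _+_ t e) (ℚP.+-identityˡ 1ℚ) , inj₁ (f , g))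
... | inj₁ (_ , _ , g)    | inj₁ (_ , o)  = ⊥-elim (<-irrefl (sym g) (s≤s (proj₂ (proj₂ (On-bounds w o)))))

total-ind≥0 : ∀ {s i j} p q (w : Walk s i j) → 0ℚ ℚ.≤ total (ind p q) w
total-ind≥0 p q w = [ (λ (e , _) → ℚP.≤-trans 0≤1 (ℚP.≤-reflexive (sym e))) , (λ (e , _) → ℚP.≤-reflexive (sym e)) ]′ (total-ind p q w)

-- Cumulative row and column sums; only differences of them are meaningful,
-- since they include the values at positions that are not coordinates.
row : Point → ℕ → ℕ → ℚ
row x i zero    = 0ℚ
row x i (suc j) = row x i j + x i (suc j)

col : Point → ℕ → ℕ → ℚ
col x j zero    = 0ℚ
col x j (suc i) = col x j i + x (suc i) j

ups : ∀ {s i j j′} → j ≤′ j′ → Walk s i j → Walk s i j′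
ups ≤′-refl     w = w
ups (≤′-step h) w = up (ups h w)

rights : ∀ {s i i′ j} → i ≤′ i′ → i′ < j → Walk s i j → Walk s i′ j
rights ≤′-refl     i<j w = w
rights (≤′-step h) i<j w = right (rights h (<⇒≤ i<j) w) i<j

total-ups : ∀ {s i j j′} x (h : j ≤′ j′) (w : Walk s i j) →
  total x (ups h w) ≡ total x w + (row x i j′ - row x i j)
total-ups {i = i} {j} x ≤′-refl w = ((∀ T r → T ≡ T + (r - r)) ∋ solve-∀ ℚ-ring) (total x w) (row x i j)
total-ups {i = i} {j} x (≤′-step {j′} h) w = trans (cong (_+ x i (suc j′)) (total-ups x h w))
  (((∀ T r r′ p → T + (r′ - r) + p ≡ T + (r′ + p - r)) ∋ solve-∀ ℚ-ring) (total x w) (row x i j) (row x i j′) (x i (suc j′)))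

total-rights : ∀ {s i i′ j} x (h : i ≤′ i′) (i<j : i′ < j) (w : Walk s i j) →
  total x (rights h i<j w) ≡ total x w + (col x j i′ - col x j i)
total-rights {i = i} {j = j} x ≤′-refl i<j w = ((∀ T r → T ≡ T + (r - r)) ∋ solve-∀ ℚ-ring) (total x w) (col x j i)
total-rights {i = i} {j = j} x (≤′-step {i′} h) i<j w = trans (cong (_+ x (suc i′) j) (total-rights x h (<⇒≤ i<j) w))
  (((∀ T r r′ p → T + (r′ - r) + p ≡ T + (r′ + p - r)) ∋ solve-∀ ℚ-ring) (total x w) (col x j i) (col x j i′) (x (suc i′) j))

-- the path d^{i,j} with j = suc e
hook : ∀ i e → i ≤ e → Walk i e (suc e)
hook i e h = rights (≤⇒≤′ h) ≤-refl (ups (≤⇒≤′ (m≤n⇒m≤1+n h)) start)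

hookSum : Point → ℕ → ℕ → ℚ
hookSum x i e = (row x i (suc e) - row x i i) + (col x (suc e) e - col x (suc e) i)

total-hook : ∀ x i e h → total x (hook i e h) ≡ hookSum x i e
total-hook x i e h = trans (total-rights x (≤⇒≤′ h) ≤-refl (ups (≤⇒≤′ (m≤n⇒m≤1+n h)) start))
  (cong (_+ (col x (suc e) e - col x (suc e) i))
    (trans (total-ups x (≤⇒≤′ (m≤n⇒m≤1+n h)) start) (ℚP.+-identityˡ (row x i (suc e) - row x i i))))

total-first-row : ∀ {s i j} x (w : Walk s i j) → i ≡ s → total x w ≡ row x s j - row x s s
total-first-row {s} x start e = sym (ℚP.+-inverseʳ (row x s s))
total-first-row x (right w _) e = ⊥-elim (<-irrefl (sym e) (s≤s (walk-s≤i w)))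
total-first-row {s} x (up {i} {j} w) refl = trans (cong (_+ x s (suc j)) (total-first-row x w refl))
  (((∀ r r′ p → (r′ - r) + p ≡ (r′ + p) - r) ∋ solve-∀ ℚ-ring) (row x s s) (row x s j) (x s (suc j)))

-- A walk that starts in row s, ends in column m and visits (s , m) has no freedom: it runs along
-- the row, then along the column. So `On w s (suc e)` can stand for "w is the hook", and no
-- equality of walks is ever needed.
total-through-corner : ∀ {s i m} x (w : Walk s i m) → On w s m →
  total x w ≡ (row x s m - row x s s) + (col x m i - col x m s)
total-through-corner {s} {m = m} x (right w _) (inj₁ (e , _)) = ⊥-elim (<-irrefl (sym e) (s≤s (walk-s≤i w)))
total-through-corner {s} {m = m} x (right {i} w _) (inj₂ o) = trans (cong (_+ x (suc i) m) (total-through-corner x w o))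
  (((∀ R c c′ p → R + (c′ - c) + p ≡ R + (c′ + p - c)) ∋ solve-∀ ℚ-ring) (row x s m - row x s s) (col x m s) (col x m i) (x (suc i) m))
total-through-corner {s} x (up {i} {j} w) (inj₁ (refl , _)) = trans (total-first-row x (up w) refl)
  (((∀ R c → R ≡ R + (c - c)) ∋ solve-∀ ℚ-ring) (row x s (suc j) - row x s s) (col x (suc j) s))
total-through-corner x (up w) (inj₂ o) = ⊥-elim (<-irrefl refl (proj₂ (proj₂ (On-bounds w o))))

total-const : ∀ {s i j} c (w : Walk s i j) → total (λ _ _ → c) w + c * ℕtoℚ (s ℕ.+ s) ≡ c * ℕtoℚ (i ℕ.+ j)
total-const {s} c start = ℚP.+-identityˡ (c * ℕtoℚ (s ℕ.+ s))
total-const {s} c (right {i} {j} w _) = trans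
  (((∀ T c S → T + c + c * S ≡ c + (T + c * S)) ∋ solve-∀ ℚ-ring) (total (λ _ _ → c) w) c (ℕtoℚ (s ℕ.+ s)))
  (trans (cong (c +_) (total-const c w)) (trans (((∀ c N → c + c * N ≡ c * (1ℚ + N)) ∋ solve-∀ ℚ-ring) c (ℕtoℚ (i ℕ.+ j)))
    (cong (c *_) (sym (ℕtoℚ-suc (i ℕ.+ j))))))
total-const {s} c (up {i} {j} w) = trans
  (((∀ T c S → T + c + c * S ≡ c + (T + c * S)) ∋ solve-∀ ℚ-ring) (total (λ _ _ → c) w) c (ℕtoℚ (s ℕ.+ s)))
  (trans (cong (c +_) (total-const c w)) (trans (((∀ c N → c + c * N ≡ c * (1ℚ + N)) ∋ solve-∀ ℚ-ring) c (ℕtoℚ (i ℕ.+ j)))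
    (cong (c *_) (sym (trans (cong ℕtoℚ (+-suc i j)) (ℕtoℚ-suc (i ℕ.+ j)))))))


-- Explicit points inside facets.

¼ : ℚ
¼ = ½ * ½

0<¼ : 0ℚ ℚ.< ¼
0<¼ = ℚP.positive⁻¹ ¼

0≤½ : 0ℚ ℚ.≤ ½
0≤½ = ℚP.<⇒≤ (ℚP.positive⁻¹ ½)

-- For prefix sums this is a_k ≥ 1. It is kept as a property of A because the reflected potential
-- has it too, without being a sequence of prefix sums.
record Gap (n : ℕ) (A : ℕ → ℚ) : Set where
  field
    gap-at : ∀ k → 1 ≤ k → k < n → A k + 1ℚ ℚ.≤ A (suc k)

open Gap using (gap-at)

growth : ∀ {n A} → Gap n A → ∀ {k} → 1 ≤ k → ∀ d → d ℕ.+ k ≤ n → A k + ℕtoℚ d ℚ.≤ A (d ℕ.+ k)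
growth {A = A} gap {k} 1≤k zero h = ℚP.≤-reflexive (ℚP.+-identityʳ (A k))
growth {A = A} gap {k} 1≤k (suc d) h = subst (λ D → A k + D ℚ.≤ A (suc d ℕ.+ k)) (sym (ℕtoℚ-suc d))
  (≤-by (0≤- (growth gap 1≤k d (<⇒≤ h)) ⊹ 0≤- (gap-at gap (d ℕ.+ k) (≤-trans 1≤k (m≤n+m k d)) h))
    (((∀ a D b c → a + (1ℚ + D) + ((b - (a + D)) + (c - (b + 1ℚ))) ≡ c) ∋ solve-∀ ℚ-ring)
      (A k) (ℕtoℚ d) (A (d ℕ.+ k)) (A (suc d ℕ.+ k))))

monotone : ∀ {n A} → Gap n A → ∀ {k l} → 1 ≤ k → k ≤ l → l ≤ n → A k ℚ.≤ A l
monotone {A = A} gap {k} {l} 1≤k k≤l l≤n = ≤-by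
  (0≤ℕtoℚ (l ∸ k) ⊹ 0≤- (growth gap 1≤k (l ∸ k) (subst (_≤ _) (sym eq) l≤n)))
  (trans (cong (λ m → A k + (ℕtoℚ (l ∸ k) + (A m - (A k + ℕtoℚ (l ∸ k))))) eq)
    (((∀ a D b → a + (D + (b - (a + D))) ≡ b) ∋ solve-∀ ℚ-ring) (A k) (ℕtoℚ (l ∸ k)) (A l)))
  where
  eq : (l ∸ k) ℕ.+ k ≡ l
  eq = m∸n+n≡m k≤l

strict : ∀ {n A} → Gap n A → ∀ {k l} → 1 ≤ k → k < l → l ≤ n → A k + 1ℚ ℚ.≤ A l
strict gap 1≤k k<l l≤n = ℚP.≤-trans (gap-at gap _ 1≤k (<-≤-trans k<l l≤n)) (monotone gap (s≤s z≤n) k<l l≤n)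

total-¼ : ∀ {s e} (w : Walk s e (suc e)) d → d ℕ.+ s ≡ e → total (λ _ _ → ¼) w ≡ ¼ * (1ℚ + ℕtoℚ d + ℕtoℚ d)
total-¼ {s} w d refl = trans (((∀ T X → T ≡ (T + X) - X) ∋ solve-∀ ℚ-ring) (total (λ _ _ → ¼) w) (¼ * ℕtoℚ (s ℕ.+ s)))
  (trans (cong₂ _-_ (trans (total-const ¼ w) (cong (¼ *_)
      (trans (ℕtoℚ-+ (d ℕ.+ s) (suc (d ℕ.+ s))) (cong₂ _+_ (ℕtoℚ-+ d s)
        (trans (ℕtoℚ-suc (d ℕ.+ s)) (cong (1ℚ +_) (ℕtoℚ-+ d s)))))))
      (cong (¼ *_) (ℕtoℚ-+ s s)))
    (((∀ c D S → c * ((D + S) + (1ℚ + (D + S))) - c * (S + S) ≡ c * (1ℚ + D + D)) ∋ solve-∀ ℚ-ring) ¼ (ℕtoℚ d) (ℕtoℚ s)))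

bump : ℕ → ℕ → ℚ → Point
bump p q β i j = ¼ + β * ind p q i j

inner-point : ∀ {n A v δ} (f : Functional n) y → 0ℚ ℚ.< δ → ev f y ≡ ev f v →
  (∀ z → ev f z ≡ 0ℚ → ∀ i j → Valid n i j → δ ℚ.≤ y i j ⊎ (0ℚ ℚ.≤ y i j × 0ℚ ℚ.≤ z i j)) →
  (∀ z → ev f z ≡ 0ℚ → ∀ {s e} → 1 ≤ s → suc e ≤ n → (w : Walk s e (suc e)) →
     total y w + A s + δ ℚ.≤ A (suc e) ⊎ (total y w + A s ℚ.≤ A (suc e) × total z w ℚ.≤ 0ℚ)) →
  Inner n A f v y
inner-point {n} {A} {v} {δ} f y δ>0 e pos slack =
    Member-cong (λ i j _ → ((∀ y t → y + t * 0ℚ ≡ y) ∋ solve-∀ ℚ-ring) (y i j) (proj₁ still)) (proj₂ (proj₂ still))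
  , e , move
  where
  move : ∀ z → ev f z ≡ 0ℚ → Σ[ ε ∈ ℚ ] (0ℚ ℚ.< ε × Member n A (λ i j → y i j + ε * z i j))
  move z fz =
    let B , B≥0 , bound = bounded n z
        t , t>0 , m = perturb {n} {A} {y} {δ} {B} δ>0 B≥0
    in t , t>0 , m z (λ i j (_ , i<j , j≤n) → bound i j (<⇒≤ (<-≤-trans i<j j≤n)) j≤n) (pos z fz) (slack z fz)
  -- Membership of y itself, obtained as the move along 0.
  still = move (λ _ _ → 0ℚ) (ev-zero f)

-- A walk from s to e = s + d has 2d + 1 points, hence sum d/2 + 1/4, while its bound is at least d
-- + 1. The constant ¼ leaves room for both a slack and a change of one coordinate.
¼-slack : ∀ {n A} → Gap n A → ∀ {s e} → 1 ≤ s → suc e ≤ n → (w : Walk s e (suc e)) →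
  total (λ _ _ → ¼) w + A s + ½ ℚ.≤ A (suc e)
¼-slack {n} {A} gap {s} {e} 1≤s e<n w = ≤-by
    (0≤- (growth gap 1≤s (suc d) (subst (λ e → suc e ≤ n) (sym eq) e<n)) ⊹ 0≤* 0≤½ (0≤ℕtoℚ d) ⊹ ℚP.<⇒≤ 0<¼)
    (trans (cong₂ (λ T m → T + A s + ½ + ((A m - (A s + ℕtoℚ (suc d))) + ½ * ℕtoℚ d + ¼)) (total-¼ w d eq) (cong suc eq))
      (trans (cong (λ D → ¼ * (1ℚ + ℕtoℚ d + ℕtoℚ d) + A s + ½ + ((A (suc e) - (A s + D)) + ½ * ℕtoℚ d + ¼)) (ℕtoℚ-suc d))
        (((∀ D a b → ½ * ½ * (1ℚ + D + D) + a + ½ + ((b - (a + (1ℚ + D))) + ½ * D + ½ * ½) ≡ b) ∋ solve-∀ ℚ-ring) (ℕtoℚ d) (A s) (A (suc e)))))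
  where
  d : ℕ
  d = e ∸ s
  eq : d ℕ.+ s ≡ e
  eq = m∸n+n≡m (walk-s≤i w)

puncture : ℕ → ℕ → Point
puncture p q = bump p q (- ¼)

puncture-at : ∀ p q → puncture p q p q ≡ 0ℚ
puncture-at p q = cong (λ u → ¼ + - ¼ * u) (ind-at {p} {q} refl refl)

puncture-off : ∀ {p q i j} → ¬ (i ≡ p × j ≡ q) → puncture p q i j ≡ ¼
puncture-off h = cong (λ u → ¼ + - ¼ * u) (ind-off h)

-- Other coordinates are ¼ and setting one coordinate to zero only lowers sums, so x_{p,q} ≥ 0 is
-- the only inequality without slack.
puncture-inner : ∀ {n A v p q} → Gap n A → (valid : Valid n p q) → v p q ≡ 0ℚ →
  Inner n A (coordinate p q valid) v (puncture p q)
puncture-inner {n} {A} {v} {p} {q} gap valid v≡0 = inner-point {v = v} (coordinate p q valid) (puncture p q) 0<¼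
    (trans (puncture-at p q) (sym v≡0))
    (λ z z≡0 i j _ → [ (λ { (_ , refl , refl) → inj₂ (ℚP.≤-reflexive (sym (puncture-at p q)) , ℚP.≤-reflexive (sym z≡0)) })
                     , (λ (_ , h) → inj₁ (ℚP.≤-reflexive (sym (puncture-off h)))) ]′ (ind-cases p q i j))
    (λ z _ {s} {e} 1≤s e<n w → inj₁ (≤-by
      (0≤- (¼-slack gap 1≤s e<n w) ⊹ ℚP.<⇒≤ 0<¼ ⊹ 0≤* (ℚP.<⇒≤ 0<¼) (total-ind≥0 p q w))
      (trans (cong (λ T → T + A s + ¼ + ((A (suc e) - (total (λ _ _ → ¼) w + A s + ½)) + ¼ + ¼ * total (ind p q) w))
               (total-shift (λ _ _ → ¼) (ind p q) (- ¼) w))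
        (((∀ T I s e → T + - (½ * ½) * I + s + ½ * ½ + ((e - (T + s + ½)) + ½ * ½ + ½ * ½ * I) ≡ e) ∋ solve-∀ ℚ-ring)
          (total (λ _ _ → ¼) w) (total (ind p q) w) (A s) (A (suc e))))))

On-rights : ∀ {s i i′ j p q} (h : i ≤′ i′) (i<j : i′ < j) (w : Walk s i j) → On w p q → On (rights h i<j w) p q
On-rights ≤′-refl     i<j w o = o
On-rights (≤′-step h) i<j w o = inj₂ (On-rights h (<⇒≤ i<j) w o)

On-hook : ∀ i e h → On (hook i e h) i (suc e)
On-hook i e h = On-rights (≤⇒≤′ h) ≤-refl _ (go (≤⇒≤′ (m≤n⇒m≤1+n h)))
  where
  go : (h′ : i ≤′ suc e) → On (ups h′ start) i (suc e)
  go ≤′-refl      = ⊥-elim (<-irrefl refl h)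
  go (≤′-step h′) = inj₁ (refl , refl)

total-hit : ∀ {s i j p q} (w : Walk s i j) → On w p q → total (ind p q) w ≡ 1ℚ
total-hit w o = [ proj₁ , (λ (_ , ¬o) → ⊥-elim (¬o o)) ]′ (total-ind _ _ w)

total-miss : ∀ {s i j p q} (w : Walk s i j) → ¬ On w p q → total (ind p q) w ≡ 0ℚ
total-miss w ¬o = [ (λ (_ , o) → ⊥-elim (¬o o)) , proj₁ ]′ (total-ind _ _ w)

-- The hook from k to suc (d + k) is a facet: the points of P given by ¼ off
-- the corner and by the remaining mass at the corner are tight only on it.
module HookPoint {n A} (gap : Gap n A) {k} d (1≤k : 1 ≤ k) (e<n : suc (d ℕ.+ k) ≤ n) where
  private
    D = ℕtoℚ d
    E = suc (d ℕ.+ k)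

  β : ℚ
  β = A E - A k - ¼ * (1ℚ + D + D)

  point : Point
  point = bump k E β

  β≥0 : 0ℚ ℚ.≤ β
  β≥0 = ≤-by (0≤- (growth gap 1≤k (suc d) e<n) ⊹ 0≤* 0≤½ (0≤ℕtoℚ d) ⊹ ℚP.<⇒≤ 0<¼ ⊹ 0≤½)
    (trans (cong (λ X → 0ℚ + ((A E - (A k + X)) + ½ * D + ¼ + ½)) (ℕtoℚ-suc d))
      (((∀ D a b → 0ℚ + ((b - (a + (1ℚ + D))) + ½ * D + ½ * ½ + ½) ≡ b - a - ½ * ½ * (1ℚ + D + D)) ∋ solve-∀ ℚ-ring) D (A k) (A E)))

  total-point : ∀ {s e} (w : Walk s e (suc e)) → total point w ≡ total (λ _ _ → ¼) w + β * total (ind k E) w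
  total-point w = total-shift (λ _ _ → ¼) (ind k E) β w

  tight : ∀ (w : Walk k (d ℕ.+ k) E) → On w k E → total point w + A k ≡ A E
  tight w o = trans (cong (_+ A k) (trans (total-point w) (cong₂ (λ T u → T + β * u) (total-¼ w d refl) (total-hit w o))))
    (((∀ c D a b → c * (1ℚ + D + D) + (b - a - c * (1ℚ + D + D)) * 1ℚ + a ≡ b) ∋ solve-∀ ℚ-ring) ¼ D (A k) (A E))

  -- Starting b earlier and ending f later than the hook adds 2 (b + f) points of value ¼, that is
  -- (b + f) / 2, but raises the bound by at least b + f.
  loose : ∀ {s e} (w : Walk s e (suc e)) b f → b ℕ.+ s ≡ k → f ℕ.+ (d ℕ.+ k) ≡ e → 1 ≤ s → suc e ≤ n →
    1 ≤ b ℕ.+ f → On w k E → total point w + A s + ¼ ℚ.≤ A (suc e)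
  loose {s} w b f refl refl 1≤s e<n′ h o = ≤-by
      (0≤- grow₁ ⊹ 0≤- grow₂ ⊹ 0≤* 0≤½ (0≤- b+f≥1) ⊹ ℚP.<⇒≤ 0<¼)
      (trans (cong₂ (λ T X → T + A s + ¼ + ((A X - (A E + F)) + (A k - (A s + B)) + ½ * (B + F - 1ℚ) + ¼))
               (trans (total-point w) (cong₂ (λ T u → T + β * u) len (total-hit w o)))
               (+-suc f (d ℕ.+ (b ℕ.+ s))))
        (((∀ D a b c e B F → ½ * ½ * (1ℚ + (F + (D + B)) + (F + (D + B))) + (b - a - ½ * ½ * (1ℚ + D + D)) * 1ℚ + c + ½ * ½
            + ((e - (b + F)) + (a - (c + B)) + ½ * (B + F - 1ℚ) + ½ * ½) ≡ e) ∋ solve-∀ ℚ-ring)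
          D (A k) (A E) (A s) (A (suc (f ℕ.+ (d ℕ.+ (b ℕ.+ s))))) B F))
    where
    B = ℕtoℚ b
    F = ℕtoℚ f
    grow₁ : A E + F ℚ.≤ A (f ℕ.+ E)
    grow₁ = growth gap (s≤s z≤n) f (subst (_≤ n) (sym (+-suc f (d ℕ.+ (b ℕ.+ s)))) e<n′)
    grow₂ : A s + B ℚ.≤ A (b ℕ.+ s)
    grow₂ = growth gap 1≤s b (≤-trans (m≤n⇒m≤1+n (m≤n+m (b ℕ.+ s) d)) e<n)
    b+f≥1 : 1ℚ ℚ.≤ B + F
    b+f≥1 = subst (1ℚ ℚ.≤_) (ℕtoℚ-+ b f) (ℕtoℚ-mono h)
    len : total (λ _ _ → ¼) w ≡ ¼ * (1ℚ + (F + (D + B)) + (F + (D + B)))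
    len = trans (total-¼ w (f ℕ.+ (d ℕ.+ b))
        (trans (+-assoc f (d ℕ.+ b) s) (cong (f ℕ.+_) (+-assoc d b s))))
      (cong (λ X → ¼ * (1ℚ + X + X)) (trans (ℕtoℚ-+ f (d ℕ.+ b)) (cong (F +_) (ℕtoℚ-+ d b))))

  module _ {v} (v-tight : total v (hook k (d ℕ.+ k) (m≤n+m k d)) + A k ≡ A E) where
    private
      H = hook k (d ℕ.+ k) (m≤n+m k d)

    hook-inner : Inner n A (negTotal 1≤k e<n H) v point
    hook-inner = inner-point {v = v} (negTotal 1≤k e<n H) point 0<¼
        (cong -_ (trans (((∀ T a → T ≡ (T + a) - a) ∋ solve-∀ ℚ-ring) (total point H) (A k))
          (trans (cong (_- A k) (trans (tight H (On-hook k (d ℕ.+ k) (m≤n+m k d))) (sym v-tight)))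
            (((∀ T a → (T + a) - a ≡ T) ∋ solve-∀ ℚ-ring) (total v H) (A k)))))
        (λ z _ i j _ → inj₁ (≤-by (0≤* β≥0 (ind-nonneg k E i j)) refl))
        slack
      where
      slack : ∀ z → - total z H ≡ 0ℚ → ∀ {s e} → 1 ≤ s → suc e ≤ n → (w : Walk s e (suc e)) →
        total point w + A s + ¼ ℚ.≤ A (suc e) ⊎ (total point w + A s ℚ.≤ A (suc e) × total z w ℚ.≤ 0ℚ)
      slack z z≡0 {s} {e} 1≤s e<n′ w = [ hit , miss ]′ (total-ind k E w)
        where
        miss : total (ind k E) w ≡ 0ℚ × ¬ On w k E → _
        miss (t , _) = inj₁ (≤-by (0≤- (¼-slack gap 1≤s e<n′ w) ⊹ ℚP.<⇒≤ 0<¼)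
          (trans (cong (λ T → T + A s + ¼ + ((A (suc e) - (total (λ _ _ → ¼) w + A s + ½)) + ¼))
                   (trans (total-point w) (cong (λ u → total (λ _ _ → ¼) w + β * u) t)))
            (((∀ T β s e → T + β * 0ℚ + s + ½ * ½ + ((e - (T + s + ½)) + ½ * ½) ≡ e) ∋ solve-∀ ℚ-ring)
              (total (λ _ _ → ¼) w) β (A s) (A (suc e)))))
        hit : total (ind k E) w ≡ 1ℚ × On w k E → _
        hit (_ , o) = extent (k ∸ s) (e ∸ (d ℕ.+ k)) (m∸n+n≡m s≤k) (m∸n+n≡m (≤-pred E≤))
          where
          s≤k = proj₁ (On-bounds w o)
          E≤ = proj₂ (proj₂ (On-bounds w o))
          extent : ∀ b f → b ℕ.+ s ≡ k → f ℕ.+ (d ℕ.+ k) ≡ e →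
            total point w + A s + ¼ ℚ.≤ A (suc e) ⊎ (total point w + A s ℚ.≤ A (suc e) × total z w ℚ.≤ 0ℚ)
          -- With both ends equal to those of the hook, the walk passes its corner and therefore has
          -- the same sum as the hook, for z as well.
          extent zero zero refl refl = inj₂ (ℚP.≤-reflexive (tight w o) ,
            ℚP.≤-reflexive (trans (total-through-corner z w o) (trans (sym (total-hook z k (d ℕ.+ k) (m≤n+m k d)))
              (trans (((∀ T → T ≡ - - T) ∋ solve-∀ ℚ-ring) (total z H)) (cong -_ z≡0)))))
          extent zero (suc f) p q = inj₁ (loose w zero (suc f) p q 1≤s e<n′ (s≤s z≤n) o)
          extent (suc b) f p q = inj₁ (loose w (suc b) f p q 1≤s e<n′ (s≤s z≤n) o)


-- The mass at (p , q) is the whole bound of the hook with this corner and makes it tight. A further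
-- mass μ ≤ 1 fits at (p′ , q′) when a walk through both points must start before p or end beyond q,
-- which raises its bound by a unit. These points serve as second and third certificates of
-- `no-relation`: μ = 0 where f₁ is a hook missing both points, μ = 1 where f₁ is the coordinate (p′
-- , q′).
masses : (ℕ → ℚ) → ℕ → ℕ → ℕ → ℕ → ℚ → Point
masses A p q p′ q′ μ i j = (A q - A p) * ind p q i j + μ * ind p′ q′ i j

module _ {n A} (gap : Gap n A) {p q p′ q′ μ} (pq : Valid n p q) (pq′ : Valid n p′ q′)
  (μ≥0 : 0ℚ ℚ.≤ μ) (μ≤1 : μ ℚ.≤ 1ℚ) (apart : q < q′ ⊎ p′ < p) where

  private
    y = masses A p q p′ q′ μ

    mass≥0 : 0ℚ ℚ.≤ A q - A p
    mass≥0 = 0≤- (monotone gap (proj₁ pq) (<⇒≤ (proj₁ (proj₂ pq))) (proj₂ (proj₂ pq)))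

    total-masses : ∀ {s i j} (w : Walk s i j) →
      total y w ≡ (A q - A p) * total (ind p q) w + μ * total (ind p′ q′) w
    total-masses w = total-lin (ind p q) (ind p′ q′) (A q - A p) μ w

  masses-member : Member n A y
  masses-member = (λ i j _ → 0≤* mass≥0 (ind-nonneg p q i j) ⊹ 0≤* μ≥0 (ind-nonneg p′ q′ i j)) , bound
    where
    bound : ∀ {s e} → 1 ≤ s → suc e ≤ n → (w : Walk s e (suc e)) → total y w + A s ℚ.≤ A (suc e)
    bound {s} {e} 1≤s e<n w = subst (λ T → T + A s ℚ.≤ A (suc e)) (sym (total-masses w))
        (cases (total-ind p q w) (total-ind p′ q′ w))
      where
      cases : ∀ {a b} → (a ≡ 1ℚ × On w p q) ⊎ (a ≡ 0ℚ × ¬ On w p q) → (b ≡ 1ℚ × On w p′ q′) ⊎ (b ≡ 0ℚ × ¬ On w p′ q′) →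
        (A q - A p) * a + μ * b + A s ℚ.≤ A (suc e)
      cases (inj₁ (refl , o)) (inj₁ (refl , o′)) = [
          (λ q<q′ → ≤-by (0≤- (strict gap (≤-trans (s≤s z≤n) (proj₁ (proj₂ pq))) (<-≤-trans q<q′ (proj₂ (proj₂ (On-bounds w o′)))) e<n)
                          ⊹ 0≤- μ≤1 ⊹ 0≤- (monotone gap 1≤s (proj₁ (On-bounds w o)) (<⇒≤ (<-≤-trans (proj₁ (proj₂ pq)) (proj₂ (proj₂ pq))))))
            (((∀ p q μ s e → (q - p) * 1ℚ + μ * 1ℚ + s + ((e - (q + 1ℚ)) + (1ℚ - μ) + (p - s)) ≡ e) ∋ solve-∀ ℚ-ring)
              (A p) (A q) μ (A s) (A (suc e))))
        , (λ p′<p → ≤-by (0≤- (strict gap 1≤s (≤-<-trans (proj₁ (On-bounds w o′)) p′<p) (<⇒≤ (<-≤-trans (proj₁ (proj₂ pq)) (proj₂ (proj₂ pq)))))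
                          ⊹ 0≤- μ≤1 ⊹ 0≤- (monotone gap (≤-trans (s≤s z≤n) (proj₁ (proj₂ pq))) (proj₂ (proj₂ (On-bounds w o))) e<n))
            (((∀ p q μ s e → (q - p) * 1ℚ + μ * 1ℚ + s + ((p - (s + 1ℚ)) + (1ℚ - μ) + (e - q)) ≡ e) ∋ solve-∀ ℚ-ring)
              (A p) (A q) μ (A s) (A (suc e)))) ]′ apart
      cases (inj₁ (refl , o)) (inj₂ (refl , _)) = ≤-by
        (0≤- (monotone gap 1≤s (proj₁ (On-bounds w o)) (<⇒≤ (<-≤-trans (proj₁ (proj₂ pq)) (proj₂ (proj₂ pq)))))
          ⊹ 0≤- (monotone gap (≤-trans (s≤s z≤n) (proj₁ (proj₂ pq))) (proj₂ (proj₂ (On-bounds w o))) e<n))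
        (((∀ p q μ s e → (q - p) * 1ℚ + μ * 0ℚ + s + ((p - s) + (e - q)) ≡ e) ∋ solve-∀ ℚ-ring)
          (A p) (A q) μ (A s) (A (suc e)))
      cases (inj₂ (refl , _)) (inj₁ (refl , _)) = ≤-by (0≤- (strict gap 1≤s (s≤s (walk-s≤i w)) e<n) ⊹ 0≤- μ≤1)
        (((∀ c μ s e → c * 0ℚ + μ * 1ℚ + s + ((e - (s + 1ℚ)) + (1ℚ - μ)) ≡ e) ∋ solve-∀ ℚ-ring)
          (A q - A p) μ (A s) (A (suc e)))
      cases (inj₂ (refl , _)) (inj₂ (refl , _)) = ≤-by (0≤- (monotone gap 1≤s (m≤n⇒m≤1+n (walk-s≤i w)) e<n))
        (((∀ c μ s e → c * 0ℚ + μ * 0ℚ + s + (e - s) ≡ e) ∋ solve-∀ ℚ-ring) (A q - A p) μ (A s) (A (suc e)))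

  masses-tight : ∀ {e} (w : Walk p e (suc e)) → q ≡ suc e → On w p q → total y w + A p ≡ A (suc e)
  masses-tight {e} w refl o = ℚP.≤-antisym (proj₂ masses-member (proj₁ pq) (proj₂ (proj₂ pq)) w)
    (subst (λ T → A q ℚ.≤ T + A p) (sym (trans (total-masses w) (cong (λ a → (A q - A p) * a + μ * total (ind p′ q′) w) (total-hit w o))))
      (≤-by (0≤* μ≥0 (total-ind≥0 p′ q′ w)) (((∀ p q μ b → q + μ * b ≡ (q - p) * 1ℚ + μ * b + p) ∋ solve-∀ ℚ-ring)
        (A p) (A q) μ (total (ind p′ q′) w))))

-- Crossing segments at a vertex with simplicial tangent cone.

same-total : ∀ {T T′ a b} → T + a ≡ b → T′ + a ≡ b → T ≡ T′
same-total {T} {T′} {a} {b} e e′ = trans (((∀ T a → T ≡ (T + a) - a) ∋ solve-∀ ℚ-ring) T a)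
  (trans (cong (_- a) (trans e (sym e′))) (((∀ T a → (T + a) - a ≡ T) ∋ solve-∀ ℚ-ring) T′ a))

module Crossing {n A v} (gap : Gap n A) (v∈ : Member n A v) (simplicial : Simplicial n A v) where

  tight-minimal : ∀ {s e} (1≤s : 1 ≤ s) (e<n : suc e ≤ n) (w : Walk s e (suc e)) → total v w + A s ≡ A (suc e) →
    ∀ {y} → Member n A y → ev (negTotal 1≤s e<n w) v ℚ.≤ ev (negTotal 1≤s e<n w) y
  tight-minimal {s} {e} 1≤s e<n w tight {y} y∈ = ≤-by (0≤- (proj₂ y∈ 1≤s e<n w))
    (trans (cong (λ b → - total v w + (b - (total y w + A s))) (sym tight))
      (((∀ V Y s → - V + ((V + s) - (Y + s)) ≡ - Y) ∋ solve-∀ ℚ-ring) (total v w) (total y w) (A s)))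

  zero-minimal : ∀ {i j} (valid : Valid n i j) → v i j ≡ 0ℚ →
    ∀ {y} → Member n A y → ev (coordinate i j valid) v ℚ.≤ ev (coordinate i j valid) y
  zero-minimal valid e y∈ = subst (ℚ._≤ _) (sym e) (proj₁ y∈ _ _ valid)

  -- Segments [i , j] and [k , l] with i < k < j < l, where j = suc (d + k) and l = suc f.
  -- The two hooks meet at (k , j); exchanging their ends gives d^{k,j} and a
  -- path from i to l.
  proper-crossing : ∀ {i k} d {f} → 1 ≤ i → i < k → suc (d ℕ.+ k) ≤ f → suc f ≤ n →
    (i≤ : i ≤ d ℕ.+ k) (k≤ : k ≤ f) →
    total v (hook i (d ℕ.+ k) i≤) + A i ≡ A (suc (d ℕ.+ k)) → total v (hook k f k≤) + A k ≡ A (suc f) → ⊥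
  proper-crossing {i} {k} d {f} 1≤i i<k j≤f l≤n i≤ k≤ tight-ij tight-kl =
      no-relation simplicial (negTotal 1≤k j≤n H-kj) (negTotal 1≤i l≤n W) (negTotal 1≤i j≤n H-ij) (negTotal 1≤k l≤n H-kl)
        (tight-minimal 1≤k j≤n H-kj tight-kj) (tight-minimal 1≤i l≤n W tight-W)
        (tight-minimal 1≤i j≤n H-ij tight-ij) (tight-minimal 1≤k l≤n H-kl tight-kl)
        relation
        (HookPoint.point gap d 1≤k j≤n , HookPoint.hook-inner gap d 1≤k j≤n tight-kj)
        (y₃ , y₃∈ , less y₃ y₃-off , cong -_ (same-total (masses-tight gap ij kl ℚP.≤-refl 0≤1 (inj₁ (s≤s j≤f)) H-ij refl (On-hook i j′ i≤)) tight-ij))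
        (y₄ , y₄∈ , less y₄ y₄-off , cong -_ (same-total (masses-tight gap kl ij ℚP.≤-refl 0≤1 (inj₂ i<k) H-kl refl (On-hook k f k≤)) tight-kl))
    where
    j′ j l : ℕ
    j′ = d ℕ.+ k
    j = suc j′
    l = suc f
    1≤k : 1 ≤ k
    1≤k = ≤-trans 1≤i (<⇒≤ i<k)
    j≤n : j ≤ n
    j≤n = ≤-trans (m≤n⇒m≤1+n j≤f) l≤n
    ij : Valid n i j
    ij = 1≤i , s≤s i≤ , j≤n
    kl : Valid n k l
    kl = 1≤k , s≤s k≤ , l≤n
    k<j : k < j
    k<j = s≤s (m≤n+m k d)
    H-ij = hook i j′ i≤
    H-kl = hook k f k≤
    H-kj = hook k j′ (m≤n+m k d)
    ups₁ = ≤⇒≤′ (m≤n⇒m≤1+n i≤)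
    rights₁ = ≤⇒≤′ (<⇒≤ i<k)
    ups₂ : j ≤′ l
    ups₂ = ≤⇒≤′ (m≤n⇒m≤1+n j≤f)
    rights₂ = ≤⇒≤′ k≤
    W₂ : Walk i k j
    W₂ = rights rights₁ k<j (ups ups₁ start)
    W : Walk i f l
    W = rights rights₂ ≤-refl (ups ups₂ W₂)
    total-W : ∀ u → total u W ≡ ((0ℚ + (row u i j - row u i i)) + (col u j k - col u j i) + (row u k l - row u k j)) + (col u l f - col u l k)
    total-W u = trans (total-rights u rights₂ ≤-refl (ups ups₂ W₂)) (cong (_+ (col u l f - col u l k))
      (trans (total-ups u ups₂ W₂) (cong (_+ (row u k l - row u k j))
        (trans (total-rights u rights₁ k<j (ups ups₁ start)) (cong (_+ (col u j k - col u j i)) (total-ups u ups₁ start))))))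
    exchange : ∀ u → total u H-kj + total u W ≡ total u H-ij + total u H-kl
    exchange u = trans (cong₂ _+_ (total-hook u k j′ (m≤n+m k d)) (total-W u))
      (trans (((∀ kj kk c ck r ci kl c′ → ((kj - kk) + (c - ck)) + (((0ℚ + r) + (ck - ci) + (kl - kj)) + c′)
                 ≡ (r + (c - ci)) + ((kl - kk) + c′)) ∋ solve-∀ ℚ-ring)
               (row u k j) (row u k k) (col u j j′) (col u j k) (row u i j - row u i i) (col u j i) (row u k l) (col u l f - col u l k))
        (sym (cong₂ _+_ (total-hook u i j′ i≤) (total-hook u k f k≤))))
    relation : ∀ u → - total u H-kj + - total u W ≡ - total u H-ij + - total u H-kl
    relation u = trans (sym (ℚP.neg-distrib-+ (total u H-kj) (total u W))) (trans (cong -_ (exchange u)) (ℚP.neg-distrib-+ (total u H-ij) (total u H-kl)))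
    -- The exchange preserves the sum of the two bounds as well as the sum of the two totals. The
    -- original pair is tight, so both members of the exchanged pair are tight.
    exchange-v : total v H-kj + A k + (total v W + A i) ≡ A j + A l
    exchange-v = trans (((∀ a k b i → a + k + (b + i) ≡ a + b + (k + i)) ∋ solve-∀ ℚ-ring) (total v H-kj) (A k) (total v W) (A i))
      (trans (cong (_+ (A k + A i)) (exchange v)) (trans
        (((∀ a b k i → a + b + (k + i) ≡ (a + i) + (b + k)) ∋ solve-∀ ℚ-ring) (total v H-ij) (total v H-kl) (A k) (A i))
        (cong₂ _+_ tight-ij tight-kl)))
    tight-kj : total v H-kj + A k ≡ A j
    tight-kj = ℚP.≤-antisym (proj₂ v∈ 1≤k j≤n H-kj) (≤-by (0≤- (proj₂ v∈ 1≤i l≤n W))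
      (trans (((∀ a b c → a + (b - c) ≡ (a + b) - c) ∋ solve-∀ ℚ-ring) (A j) (A l) (total v W + A i))
        (trans (cong (_- (total v W + A i)) (sym exchange-v))
          (((∀ a c → (a + c) - c ≡ a) ∋ solve-∀ ℚ-ring) (total v H-kj + A k) (total v W + A i)))))
    tight-W : total v W + A i ≡ A l
    tight-W = trans (((∀ a c → c ≡ (a + c) - a) ∋ solve-∀ ℚ-ring) (total v H-kj + A k) (total v W + A i))
      (trans (cong₂ _-_ exchange-v tight-kj) (((∀ a b → (a + b) - a ≡ b) ∋ solve-∀ ℚ-ring) (A j) (A l)))
    y₃ y₄ : Point
    y₃ = masses A i j k l 0ℚ
    y₄ = masses A k l i j 0ℚ
    y₃∈ = masses-member gap ij kl ℚP.≤-refl 0≤1 (inj₁ (s≤s j≤f))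
    y₄∈ = masses-member gap kl ij ℚP.≤-refl 0≤1 (inj₂ i<k)
    -- The hook from k to j starts in row k > i and ends in column j < l, so it misses both corners
    -- and has sum zero at `y₃` and `y₄`.
    off-ij : total (ind i j) H-kj ≡ 0ℚ
    off-ij = total-miss H-kj (λ o → <⇒≱ i<k (proj₁ (On-bounds H-kj o)))
    off-kl : total (ind k l) H-kj ≡ 0ℚ
    off-kl = total-miss H-kj (λ o → <⇒≱ (s≤s j≤f) (proj₂ (proj₂ (On-bounds H-kj o))))
    y₃-off : total y₃ H-kj ≡ 0ℚ
    y₃-off = trans (total-lin (ind i j) (ind k l) (A j - A i) 0ℚ H-kj) (trans (cong₂ (λ a b → (A j - A i) * a + 0ℚ * b) off-ij off-kl)
      (((∀ c → c * 0ℚ + 0ℚ * 0ℚ ≡ 0ℚ) ∋ solve-∀ ℚ-ring) (A j - A i)))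
    y₄-off : total y₄ H-kj ≡ 0ℚ
    y₄-off = trans (total-lin (ind k l) (ind i j) (A l - A k) 0ℚ H-kj) (trans (cong₂ (λ a b → (A l - A k) * a + 0ℚ * b) off-kl off-ij)
      (((∀ c → c * 0ℚ + 0ℚ * 0ℚ ≡ 0ℚ) ∋ solve-∀ ℚ-ring) (A l - A k)))
    less : ∀ y → total y H-kj ≡ 0ℚ → - total v H-kj ℚ.< - total y H-kj
    less y e = <-by (0≤- (strict gap 1≤k k<j j≤n) ⊹< 0<1)
      (trans (cong (λ b → - total v H-kj + ((b - (A k + 1ℚ)) + 1ℚ)) (sym tight-kj))
        (trans (((∀ V a → - V + (((V + a) - (a + 1ℚ)) + 1ℚ) ≡ - 0ℚ) ∋ solve-∀ ℚ-ring) (total v H-kj) (A k)) (cong -_ (sym e))))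

  -- Segments [i , k] and [k , l] with k = suc j′ and l = suc f: the two hooks
  -- and the point (j′ , suc k) make up a path from i to l.
  touching-crossing : ∀ {i j′ f} → 1 ≤ i → (i≤ : i ≤ j′) (k≤ : suc j′ ≤ f) → suc f ≤ n →
    total v (hook i j′ i≤) + A i ≡ A (suc j′) → total v (hook (suc j′) f k≤) + A (suc j′) ≡ A (suc f) → ⊥
  touching-crossing {i} {j′} {f} 1≤i i≤ k≤ l≤n tight-ik tight-kl =
      no-relation simplicial (coordinate j′ (suc k) pt) (negTotal 1≤i l≤n W) (negTotal 1≤i k≤n H-ik) (negTotal (s≤s z≤n) l≤n H-kl)
        (zero-minimal pt v≡0) (tight-minimal 1≤i l≤n W tight-W)
        (tight-minimal 1≤i k≤n H-ik tight-ik) (tight-minimal (s≤s z≤n) l≤n H-kl tight-kl)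
        relation
        (puncture j′ (suc k) , puncture-inner {v = v} gap pt v≡0)
        (masses A i k j′ (suc k) 1ℚ , masses-member gap ik pt 0≤1 ℚP.≤-refl (inj₁ ≤-refl)
          , positive (A k - A i) (ind-off {i} {k} {j′} {suc k} (λ (_ , h) → <-irrefl (sym h) ≤-refl))
          , cong -_ (same-total (masses-tight gap ik pt 0≤1 ℚP.≤-refl (inj₁ ≤-refl) H-ik refl (On-hook i j′ i≤)) tight-ik))
        (masses A k l j′ (suc k) 1ℚ , masses-member gap kl pt 0≤1 ℚP.≤-refl (inj₂ ≤-refl)
          , positive (A l - A k) (ind-off {k} {l} {j′} {suc k} (λ (h , _) → <-irrefl h ≤-refl))
          , cong -_ (same-total (masses-tight gap kl pt 0≤1 ℚP.≤-refl (inj₂ ≤-refl) H-kl refl (On-hook k f k≤)) tight-kl))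
    where
    k l : ℕ
    k = suc j′
    l = suc f
    k≤n : k ≤ n
    k≤n = ≤-trans k≤ (<⇒≤ l≤n)
    ik : Valid n i k
    ik = 1≤i , s≤s i≤ , k≤n
    kl : Valid n k l
    kl = s≤s z≤n , s≤s k≤ , l≤n
    pt : Valid n j′ (suc k)
    pt = ≤-trans 1≤i i≤ , m≤n⇒m≤1+n ≤-refl , ≤-trans (s≤s k≤) l≤n
    H-ik = hook i j′ i≤
    H-kl = hook k f k≤
    ups₂ : suc k ≤′ l
    ups₂ = ≤⇒≤′ (s≤s k≤)
    rights₂ = ≤⇒≤′ k≤
    W₂ : Walk i k (suc k)
    W₂ = right (up H-ik) ≤-refl
    W : Walk i f l
    W = rights rights₂ ≤-refl (ups ups₂ W₂)
    exchange : ∀ u → total u W ≡ total u H-ik + total u H-kl + u j′ (suc k)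
    exchange u = trans (total-rights u rights₂ ≤-refl (ups ups₂ W₂)) (trans
      (cong (_+ (col u l f - col u l k)) (total-ups u ups₂ W₂))
      (trans (((∀ h x y r r′ c → h + x + y + (r′ - (r + y)) + c ≡ h + ((r′ - r) + c) + x) ∋ solve-∀ ℚ-ring)
          (total u H-ik) (u j′ (suc k)) (u k (suc k)) (row u k k) (row u k l) (col u l f - col u l k))
        (cong (λ T → total u H-ik + T + u j′ (suc k)) (sym (total-hook u k f k≤)))))
    relation : ∀ u → u j′ (suc k) + - total u W ≡ - total u H-ik + - total u H-kl
    relation u = trans (cong (λ T → u j′ (suc k) + - T) (exchange u))
      (((∀ a b x → x + - (a + b + x) ≡ - a + - b) ∋ solve-∀ ℚ-ring) (total u H-ik) (total u H-kl) (u j′ (suc k)))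
    exchange-v : total v W + A i ≡ A l + v j′ (suc k)
    exchange-v = trans (cong (_+ A i) (exchange v)) (trans
      (((∀ a b x i k → a + b + x + i ≡ ((a + i) - k) + (b + k) + x) ∋ solve-∀ ℚ-ring) (total v H-ik) (total v H-kl) (v j′ (suc k)) (A i) (A k))
      (trans (cong₂ (λ p q → (p - A k) + q + v j′ (suc k)) tight-ik tight-kl)
        (((∀ k l x → (k - k) + l + x ≡ l + x) ∋ solve-∀ ℚ-ring) (A k) (A l) (v j′ (suc k)))))
    -- The two tight hooks already exhaust the bound of W, which leaves nothing for the additional
    -- point.
    v≡0 : v j′ (suc k) ≡ 0ℚ
    v≡0 = ℚP.≤-antisym (≤-by (0≤- (proj₂ v∈ 1≤i l≤n W)) (trans (cong (λ T → v j′ (suc k) + (A l - T)) exchange-v)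
        (((∀ l x → x + (l - (l + x)) ≡ 0ℚ) ∋ solve-∀ ℚ-ring) (A l) (v j′ (suc k)))))
      (proj₁ v∈ j′ (suc k) pt)
    tight-W : total v W + A i ≡ A l
    tight-W = trans exchange-v (trans (cong (A l +_) v≡0) (ℚP.+-identityʳ (A l)))
    positive : ∀ c {a} → a ≡ 0ℚ → v j′ (suc k) ℚ.< c * a + 1ℚ * ind j′ (suc k) j′ (suc k)
    positive c refl = subst₂ ℚ._<_ (sym v≡0) (sym (trans (cong (λ b → c * 0ℚ + 1ℚ * b) (ind-at {j′} {suc k} {j′} {suc k} refl refl))
      (((∀ c → c * 0ℚ + 1ℚ * 1ℚ ≡ 1ℚ) ∋ solve-∀ ℚ-ring) c))) 0<1

  crossing : ∀ {i k j′ f} → 1 ≤ i → i < k → k ≤ suc j′ → suc j′ ≤ f → suc f ≤ n → (i≤ : i ≤ j′) (k≤ : k ≤ f) →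
    total v (hook i j′ i≤) + A i ≡ A (suc j′) → total v (hook k f k≤) + A k ≡ A (suc f) → ⊥
  crossing {i} {k} {j′} {f} 1≤i i<k k≤j j≤f l≤n i≤ k≤ tight-ij tight-kl =
    [ (λ k<j → proper (m∸n+n≡m (≤-pred k<j)) i≤ j≤f tight-ij)
    , (λ { refl → touching-crossing 1≤i i≤ k≤ l≤n tight-ij tight-kl }) ]′ (m≤n⇒m<n∨m≡n k≤j)
    where
    proper : ∀ {d j′} → d ℕ.+ k ≡ j′ → (i≤ : i ≤ j′) → suc j′ ≤ f → total v (hook i j′ i≤) + A i ≡ A (suc j′) → ⊥
    proper {d} refl i≤ j≤f tight-ij = proper-crossing d 1≤i i<k j≤f l≤n i≤ k≤ tight-ij tight-kl


data Tail (e : ℕ) : ℕ → ℕ → Set where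
  end   : Tail e e (suc e)
  right : ∀ {i j} → suc i < j → Tail e (suc i) j → Tail e i j
  up    : ∀ {i j} → Tail e i (suc j) → Tail e i j

-- The starting point (i , j) is left out, being counted by the walk to which the tail is appended.
tailSum : ∀ {e i j} → Point → Tail e i j → ℚ
tailSum x end                 = 0ℚ
tailSum x (right {i} {j} _ t) = x (suc i) j + tailSum x t
tailSum x (up {i} {j} t)      = x i (suc j) + tailSum x t

append : ∀ {s i j e} → Walk s i j → Tail e i j → Walk s e (suc e)
append w end         = w
append w (right h t) = append (right w h) t
append w (up t)      = append (up w) t

total-append : ∀ {s i j e} x (w : Walk s i j) (t : Tail e i j) → total x (append w t) ≡ total x w + tailSum x t
total-append x w end = sym (ℚP.+-identityʳ (total x w))
total-append x w (right {i} {j} h t) = trans (total-append x (right w h) t) (ℚP.+-assoc (total x w) (x (suc i) j) (tailSum x t))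
total-append x w (up {i} {j} t) = trans (total-append x (up w) t) (ℚP.+-assoc (total x w) (x i (suc j)) (tailSum x t))

tail-j≤ : ∀ {e i j} → Tail e i j → j ≤ suc e
tail-j≤ end         = ≤-refl
tail-j≤ (right _ t) = tail-j≤ t
tail-j≤ (up t)      = <⇒≤ (tail-j≤ t)

On-append : ∀ {s i j e p q} (w : Walk s i j) (t : Tail e i j) → On w p q → On (append w t) p q
On-append w end         o = o
On-append w (right h t) o = On-append (right w h) t (inj₂ o)
On-append w (up t)      o = On-append (up w) t (inj₂ o)

-- The last point with first index at most g qualifies: it is final, or the next step goes to row g
-- + 1 and remains off the diagonal. Thus every a_g in the bound of a walk can be charged to a point
-- of that walk.
covering : ∀ {s i j} (w : Walk s i j) g → s ≤ g → g < j → ∃ λ p → ∃ λ q → On w p q × p ≤ g × g < q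
covering start g s≤g g<s = ⊥-elim (<⇒≱ g<s s≤g)
covering (right {i} {j} w _) g s≤g g<j with suc i ℕ.≤? g
... | yes h = suc i , j , inj₁ (refl , refl) , h , g<j
... | no _  = let p , q , o , c = covering w g s≤g g<j in p , q , inj₂ o , c
covering (up {i} {j} w) g s≤g g<j with i ℕ.≤? g
... | yes h = i , suc j , inj₁ (refl , refl) , h , g<j
... | no ¬h = let p , q , o , c = covering w g s≤g (<-≤-trans (≰⇒> ¬h) (walk-i≤j w)) in p , q , inj₂ o , c

-- A weight that a walk meets with total at most one: its support covers g and
-- lies on one antidiagonal i + j = h.
record Antichain (g : ℕ) (χ : Point) : Set where
  field
    nonneg  : ∀ i j → 0ℚ ℚ.≤ χ i j
    ≤1      : ∀ i j → χ i j ℚ.≤ 1ℚ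
    h       : ℕ
    support : ∀ i j → χ i j ≡ 0ℚ ⊎ (i ≤ g × g < j × i ℕ.+ j ≡ h)

  total≥0 : ∀ {s i j} (w : Walk s i j) → 0ℚ ℚ.≤ total χ w
  total≥0 start               = ℚP.≤-refl
  total≥0 (right {i} {j} w _) = total≥0 w ⊹ nonneg (suc i) j
  total≥0 (up {i} {j} w)      = total≥0 w ⊹ nonneg i (suc j)

  private
    add-zero : ∀ {T x} → T ≡ 0ℚ → x ≡ 0ℚ → T + x ≡ 0ℚ
    add-zero refl refl = ℚP.+-identityˡ 0ℚ

    drop-zero : ∀ {T x} → T ℚ.≤ 1ℚ → x ≡ 0ℚ → T + x ℚ.≤ 1ℚ
    drop-zero {T} T≤1 refl = subst (ℚ._≤ 1ℚ) (sym (ℚP.+-identityʳ T)) T≤1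

    only-last : ∀ {T x} → T ≡ 0ℚ → x ℚ.≤ 1ℚ → T + x ℚ.≤ 1ℚ
    only-last {x = x} refl x≤1 = subst (ℚ._≤ 1ℚ) (sym (ℚP.+-identityˡ x)) x≤1

  below : ∀ {s i j} (w : Walk s i j) → i ℕ.+ j < h → total χ w ≡ 0ℚ
  below start lt = refl
  below (right {i} {j} w _) lt = add-zero (below w (<⇒≤ lt))
    ([ (λ e → e) , (λ (_ , _ , e) → ⊥-elim (<-irrefl e lt)) ]′ (support (suc i) j))
  below (up {i} {j} w) lt = add-zero (below w (<-trans (≤-reflexive (sym (+-suc i j))) lt))
    ([ (λ e → e) , (λ (_ , _ , e) → ⊥-elim (<-irrefl e lt)) ]′ (support i (suc j)))

  -- Since i + j grows by one per step, a walk meets the antidiagonal in at most one point, and it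
  -- has collected nothing before.
  total≤1 : ∀ {s i j} (w : Walk s i j) → total χ w ℚ.≤ 1ℚ
  total≤1 start = 0≤1
  total≤1 (right {i} {j} w _) = [ drop-zero (total≤1 w) ,
    (λ (_ , _ , e) → only-last (below w (≤-reflexive e)) (≤1 (suc i) j)) ]′ (support (suc i) j)
  total≤1 (up {i} {j} w) = [ drop-zero (total≤1 w) ,
    (λ (_ , _ , e) → only-last (below w (≤-reflexive (trans (sym (+-suc i j)) e))) (≤1 i (suc j))) ]′ (support i (suc j))

  outside : ∀ {s i j} (w : Walk s i j) → g < s ⊎ j ≤ g → total χ w ≡ 0ℚ
  outside start _ = refl
  outside (right {i} {j} w _) o = add-zero (outside w o) ([ (λ e → e) , (λ (i≤g , g<j , _) →
    [ (λ g<s → ⊥-elim (<⇒≱ g<s (≤-trans (m≤n⇒m≤1+n (walk-s≤i w)) i≤g))) , (λ j≤g → ⊥-elim (<⇒≱ g<j j≤g)) ]′ o) ]′ (support (suc i) j))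
  outside (up {i} {j} w) o = add-zero (outside w ([ inj₁ , (λ h → inj₂ (<⇒≤ h)) ]′ o)) ([ (λ e → e) , (λ (i≤g , g<j , _) →
    [ (λ g<s → ⊥-elim (<⇒≱ g<s (≤-trans (walk-s≤i w) i≤g))) , (λ j≤g → ⊥-elim (<⇒≱ g<j j≤g)) ]′ o) ]′ (support i (suc j)))

open Antichain using (total≥0; total≤1; outside)

-- Σ_{1 ≤ g ≤ m} a_g χ_g where a_g = A (g + 1) - A g
spread : (ℕ → ℚ) → (ℕ → Point) → ℕ → Point
spread A χ zero    i j = 0ℚ
spread A χ (suc m) i j = spread A χ m i j + (A (suc (suc m)) - A (suc m)) * χ (suc m) i j

-- A walk from s to e meets `χ g` only for s ≤ g ≤ e, and with total at most 1. Its sum is thus at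
-- most a_s + ... + a_e, its bound, with equality when it meets each of these `χ g` fully.
module Spread {n A} (gap : Gap n A) (χ : ℕ → Point) (antichain : ∀ g → Antichain g (χ g)) where

  increment≥0 : ∀ m → suc m < n → 0ℚ ℚ.≤ A (suc (suc m)) - A (suc m)
  increment≥0 m m<n = 0≤- (monotone gap (s≤s z≤n) (n≤1+n (suc m)) m<n)

  spread≥0 : ∀ m → suc m ≤ n → ∀ i j → 0ℚ ℚ.≤ spread A χ m i j
  spread≥0 zero    _ i j = ℚP.≤-refl
  spread≥0 (suc m) h i j = spread≥0 m (<⇒≤ h) i j ⊹ 0≤* (increment≥0 m h) (Antichain.nonneg (antichain (suc m)) i j)

  part≤spread : ∀ m → suc m ≤ n → ∀ g → 1 ≤ g → g ≤ m → ∀ i j → (A (suc g) - A g) * χ g i j ℚ.≤ spread A χ m i j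
  part≤spread zero h g 1≤g g≤m i j = ⊥-elim (<⇒≱ 1≤g g≤m)
  part≤spread (suc m) h g 1≤g g≤m i j = [
      (λ g<  → ≤-by (0≤- (part≤spread m (<⇒≤ h) g 1≤g (≤-pred g<) i j) ⊹ 0≤* (increment≥0 m h) (Antichain.nonneg (antichain (suc m)) i j))
        (((∀ c X Y → c + ((X - c) + Y) ≡ X + Y) ∋ solve-∀ ℚ-ring) ((A (suc g) - A g) * χ g i j) (spread A χ m i j) ((A (suc (suc m)) - A (suc m)) * χ (suc m) i j)))
    , (λ { refl → ≤-by (spread≥0 m (<⇒≤ h) i j) (ℚP.+-comm ((A (suc g) - A g) * χ g i j) (spread A χ m i j)) }) ]′ (m≤n⇒m<n∨m≡n g≤m)

  total-spread : ∀ {s i j} m (w : Walk s i j) →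
    total (spread A χ (suc m)) w ≡ total (spread A χ m) w + (A (suc (suc m)) - A (suc m)) * total (χ (suc m)) w
  total-spread m w = total-shift (spread A χ m) (χ (suc m)) (A (suc (suc m)) - A (suc m)) w

  total-spread-zero : ∀ {s i j} (w : Walk s i j) → total (spread A χ zero) w ≡ 0ℚ
  total-spread-zero start       = refl
  total-spread-zero (right w _) = trans (cong (_+ 0ℚ) (total-spread-zero w)) (ℚP.+-identityʳ 0ℚ)
  total-spread-zero (up w)      = trans (cong (_+ 0ℚ) (total-spread-zero w)) (ℚP.+-identityʳ 0ℚ)

  private
    min-step : ∀ m k → k ≤ suc m → suc (suc m) ℕ.⊓ k ≡ suc m ℕ.⊓ k
    min-step m k h = trans (m≥n⇒m⊓n≡n (m≤n⇒m≤1+n h)) (sym (m≥n⇒m⊓n≡n h))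

  module _ {s e} (w : Walk s e (suc e)) (1≤s : 1 ≤ s) where
    private
      -- The sum of a_g over g ≤ m with s ≤ g ≤ e, telescoped: both ends are cut off at m + 1.
      clip : ℕ → ℚ
      clip m = A (suc m ℕ.⊓ suc e) - A (suc m ℕ.⊓ s)

      clip-early : ∀ m → suc m < s → clip (suc m) ≡ 0ℚ
      clip-early m h = trans (cong₂ (λ p q → A p - A q) (m≤n⇒m⊓n≡m (≤-trans h (m≤n⇒m≤1+n (walk-s≤i w)))) (m≤n⇒m⊓n≡m h))
        (ℚP.+-inverseʳ (A (suc (suc m))))

      clip-early′ : ∀ m → suc m ≤ s → clip m ≡ 0ℚ
      clip-early′ m h = trans (cong₂ (λ p q → A p - A q) (m≤n⇒m⊓n≡m (≤-trans h (m≤n⇒m≤1+n (walk-s≤i w)))) (m≤n⇒m⊓n≡m h))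
        (ℚP.+-inverseʳ (A (suc m)))

      clip-inside : ∀ m → s ≤ suc m → suc m ≤ e → clip (suc m) ≡ clip m + (A (suc (suc m)) - A (suc m))
      clip-inside m s≤ ≤e = trans (cong₂ (λ p q → A p - A q) (m≤n⇒m⊓n≡m (s≤s ≤e)) (min-step m s s≤))
        (trans (((∀ p q r → p - q ≡ (r - q) + (p - r)) ∋ solve-∀ ℚ-ring) (A (suc (suc m))) (A (suc m ℕ.⊓ s)) (A (suc m)))
          (cong (λ r → (A r - A (suc m ℕ.⊓ s)) + (A (suc (suc m)) - A (suc m))) (sym (m≤n⇒m⊓n≡m (m≤n⇒m≤1+n ≤e)))))

      clip-late : ∀ m → suc e ≤ suc m → clip (suc m) ≡ clip m
      clip-late m h = cong₂ (λ p q → A p - A q) (min-step m (suc e) h) (min-step m s (≤-trans (m≤n⇒m≤1+n (walk-s≤i w)) h))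

      zero-part : ∀ m → suc m < s ⊎ suc e ≤ suc m → ∀ c → c * total (χ (suc m)) w ≡ 0ℚ
      zero-part m o c = trans (cong (c *_) (outside (antichain (suc m)) w o)) (ℚP.*-zeroʳ c)

      where-is : ∀ g → g < s ⊎ (s ≤ g × g ≤ e) ⊎ suc e ≤ g
      where-is g with g ℕ.<? s | g ℕ.≤? e
      ... | yes p | _     = inj₁ p
      ... | no ¬p | yes q = inj₂ (inj₁ (≮⇒≥ ¬p , q))
      ... | no ¬p | no ¬q = inj₂ (inj₂ (≰⇒> ¬q))

      upper : ∀ m → suc m ≤ n → total (spread A χ m) w ℚ.≤ clip m
      upper zero h = ℚP.≤-reflexive (trans (total-spread-zero w) (sym (clip-early′ zero 1≤s)))
      upper (suc m) h = subst (ℚ._≤ clip (suc m)) (sym (total-spread m w)) ([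
          (λ g<s → let c≡ = clip-early m g<s in ≤-by (0≤- (upper m (<⇒≤ h)))
             (trans (cong₂ (λ X c → total (spread A χ m) w + X + (c - total (spread A χ m) w)) (zero-part m (inj₁ g<s) (A (suc (suc m)) - A (suc m))) (clip-early′ m (<⇒≤ g<s)))
               (trans (((∀ T → T + 0ℚ + (0ℚ - T) ≡ 0ℚ) ∋ solve-∀ ℚ-ring) (total (spread A χ m) w)) (sym c≡))))
        , [ (λ (s≤ , ≤e) → ≤-by (0≤- (upper m (<⇒≤ h)) ⊹ 0≤* (increment≥0 m h) (0≤- (total≤1 (antichain (suc m)) w)))
             (trans (((∀ T a X c → T + a * X + ((c - T) + a * (1ℚ - X)) ≡ c + a) ∋ solve-∀ ℚ-ring) (total (spread A χ m) w) (A (suc (suc m)) - A (suc m)) (total (χ (suc m)) w) (clip m))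
               (sym (clip-inside m s≤ ≤e))))
          , (λ late → ≤-by (0≤- (upper m (<⇒≤ h)))
             (trans (cong (λ X → total (spread A χ m) w + X + (clip m - total (spread A χ m) w)) (zero-part m (inj₂ late) (A (suc (suc m)) - A (suc m))))
               (trans (((∀ T c → T + 0ℚ + (c - T) ≡ c) ∋ solve-∀ ℚ-ring) (total (spread A χ m) w) (clip m)) (sym (clip-late m late))))) ]′ ]′
        (where-is (suc m)))

      lower : (∀ g → s ≤ g → g ≤ e → 1ℚ ℚ.≤ total (χ g) w) → ∀ m → suc m ≤ n → clip m ℚ.≤ total (spread A χ m) w
      lower hits zero h = ℚP.≤-reflexive (sym (trans (total-spread-zero w) (sym (clip-early′ zero 1≤s))))
      lower hits (suc m) h = subst (clip (suc m) ℚ.≤_) (sym (total-spread m w)) ([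
          (λ g<s → ℚP.≤-trans (ℚP.≤-reflexive (clip-early m g<s)) (ℚP.≤-trans (ℚP.≤-reflexive (sym (clip-early′ m (<⇒≤ g<s))))
             (ℚP.≤-trans (lower hits m (<⇒≤ h)) (≤-by (0≤* (increment≥0 m h) (total≥0 (antichain (suc m)) w)) refl))))
        , [ (λ (s≤ , ≤e) → ℚP.≤-trans (ℚP.≤-reflexive (clip-inside m s≤ ≤e))
             (≤-by (0≤- (lower hits m (<⇒≤ h)) ⊹ 0≤* (increment≥0 m h) (0≤- (hits (suc m) s≤ ≤e)))
               (((∀ T a X c → c + a + ((T - c) + a * (X - 1ℚ)) ≡ T + a * X) ∋ solve-∀ ℚ-ring) (total (spread A χ m) w) (A (suc (suc m)) - A (suc m)) (total (χ (suc m)) w) (clip m))))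
          , (λ late → ℚP.≤-trans (ℚP.≤-reflexive (clip-late m late))
             (ℚP.≤-trans (lower hits m (<⇒≤ h)) (≤-by (0≤* (increment≥0 m h) (total≥0 (antichain (suc m)) w)) refl))) ]′ ]′
        (where-is (suc m)))

      clip-full : ∀ m → e ≤ m → clip m + A s ≡ A (suc e)
      clip-full m h = trans (cong₂ (λ p q → A p - A q + A s) (m≥n⇒m⊓n≡n (s≤s h)) (m≥n⇒m⊓n≡n (≤-trans (walk-s≤i w) (m≤n⇒m≤1+n h))))
        (((∀ p q → p - q + q ≡ p) ∋ solve-∀ ℚ-ring) (A (suc e)) (A s))

    spread-upper : ∀ m → suc m ≤ n → e ≤ m → total (spread A χ m) w + A s ℚ.≤ A (suc e)
    spread-upper m h e≤m = ℚP.≤-trans (ℚP.+-monoˡ-≤ (A s) (upper m h)) (ℚP.≤-reflexive (clip-full m e≤m))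

    spread-lower : ∀ m → suc m ≤ n → e ≤ m → (∀ g → s ≤ g → g ≤ e → 1ℚ ℚ.≤ total (χ g) w) → A (suc e) ℚ.≤ total (spread A χ m) w + A s
    spread-lower m h e≤m hits = ℚP.≤-trans (ℚP.≤-reflexive (sym (clip-full m e≤m))) (ℚP.+-monoˡ-≤ (A s) (lower hits m h))

  spread-member : ∀ m → suc m ≤ n → n ≤ suc m → Member n A (spread A χ m)
  spread-member m h h′ = (λ i j _ → spread≥0 m h i j) ,
    λ 1≤s e<n w → spread-upper w 1≤s m h (≤-pred (≤-trans e<n h′))


ind≤1 : ∀ p q i j → ind p q i j ℚ.≤ 1ℚ
ind≤1 p q i j = [ (λ (e , _) → ℚP.≤-reflexive e) , (λ (e , _) → ℚP.≤-trans (ℚP.≤-reflexive e) 0≤1) ]′ (ind-cases p q i j)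

ind-antichain : ∀ {g p q} → p ≤ g → g < q → Antichain g (ind p q)
ind-antichain {g} {p} {q} p≤g g<q = record
  { nonneg = ind-nonneg p q ; ≤1 = ind≤1 p q ; h = p ℕ.+ q
  ; support = λ i j → [ (λ { (_ , refl , refl) → inj₂ (p≤g , g<q , refl) }) , (λ (e , _) → inj₁ e) ]′ (ind-cases p q i j) }

zero-antichain : ∀ {g} → Antichain g (λ _ _ → 0ℚ)
zero-antichain = record
  { nonneg = λ _ _ → ℚP.≤-refl ; ≤1 = λ _ _ → 0≤1 ; h = 0 ; support = λ _ _ → inj₁ refl }

-- A corner of a walk and its flip share an antidiagonal, so both may carry the same a_g in full.
-- The factors 1ℚ put the sum in the form of `total-lin`.
pair : ℕ → ℕ → Point
pair p q i j = 1ℚ * ind p (suc q) i j + 1ℚ * ind (suc p) q i j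

pair-antichain : ∀ {g p q} → p ≤ g → g < suc q → suc p ≤ g → g < q → Antichain g (pair p q)
pair-antichain {g} {p} {q} a b c d = record
  { nonneg = λ i j → 0≤* 0≤1 (ind-nonneg p (suc q) i j) ⊹ 0≤* 0≤1 (ind-nonneg (suc p) q i j)
  ; ≤1 = λ i j → [ proj₁ , (λ (e , _ ) → e) ]′ (cases i j)
  ; h = p ℕ.+ suc q
  ; support = λ i j → [ (λ (_ , e) → inj₁ e) , (λ (_ , f) → inj₂ f) ]′ (cases i j) }
  where
  one : ∀ {x y} → x ≡ 1ℚ → y ≡ 0ℚ → 1ℚ * x + 1ℚ * y ℚ.≤ 1ℚ
  one refl refl = ℚP.≤-refl
  cases : ∀ i j → (pair p q i j ℚ.≤ 1ℚ × pair p q i j ≡ 0ℚ) ⊎ (pair p q i j ℚ.≤ 1ℚ × i ≤ g × g < j × i ℕ.+ j ≡ p ℕ.+ suc q)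
  cases i j with ind-cases p (suc q) i j | ind-cases (suc p) q i j
  ... | inj₁ (e , refl , refl) | inj₂ (f , _) = inj₂ (ℚP.≤-reflexive (cong₂ (λ x y → 1ℚ * x + 1ℚ * y) e f) , a , b , refl)
  ... | inj₂ (e , _) | inj₁ (f , refl , refl) = inj₂ (ℚP.≤-reflexive (cong₂ (λ x y → 1ℚ * x + 1ℚ * y) e f) , c , d , sym (+-suc p q))
  ... | inj₂ (e , _) | inj₂ (f , _) = inj₁ (ℚP.≤-trans (ℚP.≤-reflexive (cong₂ (λ x y → 1ℚ * x + 1ℚ * y) e f)) 0≤1 , cong₂ (λ x y → 1ℚ * x + 1ℚ * y) e f)
  ... | inj₁ (_ , refl , _) | inj₁ (_ , h , _) = ⊥-elim (<-irrefl h ≤-refl)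

-- Corners of tight walks at zero coordinates.

module Corner {n A v} (gap : Gap n A) (v∈ : Member n A v) (simplicial : Simplicial n A v) where
  open Crossing gap v∈ simplicial using (tight-minimal; zero-minimal)

  -- A tight walk cannot turn right-then-up at a zero (suc i , l) of v, since
  -- turning up-then-right instead would give a second tight walk, and the four
  -- active inequalities involved would be dependent.
  no-corner : ∀ {s i l e} (h : Walk s i l) (c<l : suc i < l) (t : Tail e (suc i) (suc l)) → 1 ≤ s → suc e ≤ n →
    v (suc i) l ≡ 0ℚ → total v (append (up (right h c<l)) t) + A s ≡ A (suc e) → ⊥
  no-corner {s} {i} {l} {e} h c<l t 1≤s e<n v-cl tight₁ =
      no-relation simplicial (coordinate c l cl) (negTotal 1≤s e<n W₁) (negTotal 1≤s e<n W₂) (coordinate i (suc l) il)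
        (zero-minimal cl v-cl) (tight-minimal 1≤s e<n W₁ tight₁) (tight-minimal 1≤s e<n W₂ tight₂) (zero-minimal il v-il)
        relation
        (puncture c l , puncture-inner {v = v} gap cl v-cl)
        (y , y∈ , ℚP.≤-<-trans (ℚP.≤-reflexive v-cl) y-cl>0 , cong -_ (same-total y-tight tight₂))
        (puncture i (suc l) , proj₁ (puncture-inner {v = v} gap il v-il)
          , ℚP.≤-<-trans (ℚP.≤-reflexive v-cl) (ℚP.<-≤-trans 0<¼ (ℚP.≤-reflexive (sym (puncture-off {i} {suc l} {c} {l} (λ (x , _) → <-irrefl (sym x) ≤-refl)))))
          , trans (puncture-at i (suc l)) (sym v-il))
    where
    c : ℕ
    c = suc i
    l≤e : l ≤ e
    l≤e = ≤-pred (tail-j≤ t)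
    cl : Valid n c l
    cl = s≤s z≤n , c<l , ≤-trans l≤e (<⇒≤ e<n)
    il : Valid n i (suc l)
    il = ≤-trans 1≤s (walk-s≤i h) , s≤s (walk-i≤j h) , ≤-trans (s≤s l≤e) e<n
    W₁ W₂ : Walk s e (suc e)
    W₁ = append (up (right h c<l)) t
    W₂ = append (right (up h) (m≤n⇒m≤1+n c<l)) t
    flip : ∀ u → total u W₁ + u i (suc l) ≡ total u W₂ + u c l
    flip u = trans (cong (_+ u i (suc l)) (total-append u (up (right h c<l)) t))
      (trans (((∀ h a b t d → h + a + b + t + d ≡ h + d + b + t + a) ∋ solve-∀ ℚ-ring) (total u h) (u c l) (u c (suc l)) (tailSum u t) (u i (suc l)))
        (cong (_+ u c l) (sym (total-append u (right (up h) (m≤n⇒m≤1+n c<l)) t))))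
    relation : ∀ u → u c l + - total u W₁ ≡ - total u W₂ + u i (suc l)
    relation u = trans (((∀ T a d → a + - T ≡ a + - (T + d) + d) ∋ solve-∀ ℚ-ring) (total u W₁) (u c l) (u i (suc l)))
      (trans (cong (λ X → u c l + - X + u i (suc l)) (flip u))
        (((∀ T a d → a + - (T + a) + d ≡ - T + d) ∋ solve-∀ ℚ-ring) (total u W₂) (u c l) (u i (suc l))))
    -- As v vanishes at (c , l), the flipped walk exceeds the tight one by v at (i , suc l). Both
    -- have the same bound, so that value is zero and the flipped walk is tight too.
    flip-v : total v W₂ ≡ total v W₁ + v i (suc l)
    flip-v = trans (sym (ℚP.+-identityʳ (total v W₂))) (trans (cong (total v W₂ +_) (sym v-cl)) (sym (flip v)))
    v-il : v i (suc l) ≡ 0ℚ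
    v-il = ℚP.≤-antisym (≤-by (0≤- (proj₂ v∈ 1≤s e<n W₂))
        (trans (cong₂ (λ b T → v i (suc l) + (b - (T + A s))) (sym tight₁) flip-v)
          (((∀ T s d → d + ((T + s) - (T + d + s)) ≡ 0ℚ) ∋ solve-∀ ℚ-ring) (total v W₁) (A s) (v i (suc l)))))
      (proj₁ v∈ i (suc l) il)
    tight₂ : total v W₂ + A s ≡ A (suc e)
    tight₂ = trans (cong (_+ A s) (trans flip-v (trans (cong (total v W₁ +_) v-il) (ℚP.+-identityʳ (total v W₁))))) tight₁

    -- The certificate for W₂: each a_g goes to a point of W₂ with p ≤ g < q, which makes W₂ tight.
    -- For g = c that point is (i , suc l), and a_c is repeated at (c , l), off W₂ but on the same
    -- antidiagonal; so f₁, the coordinate (c , l), is positive there.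
    select : ∀ g → Dec (g ≡ c) → Dec (s ≤ g) → Dec (g ≤ e) → Point
    select g (yes _) _        _        = pair i l
    select g (no _)  (yes s≤) (yes ≤e) = let p , q , _ = covering W₂ g s≤ (s≤s ≤e) in ind p q
    select g (no _)  (yes _)  (no _)   = λ _ _ → 0ℚ
    select g (no _)  (no _)   _        = λ _ _ → 0ℚ
    χ : ℕ → Point
    χ g = select g (g ℕ.≟ c) (s ℕ.≤? g) (g ℕ.≤? e)
    select-antichain : ∀ g a b d → Antichain g (select g a b d)
    select-antichain g (yes refl) _ _ = pair-antichain (n≤1+n i) (m≤n⇒m≤1+n c<l) ≤-refl c<l
    select-antichain g (no _) (yes s≤) (yes ≤e) = let _ , _ , _ , p≤g , g<q = covering W₂ g s≤ (s≤s ≤e) in ind-antichain p≤g g<q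
    select-antichain g (no _) (yes _) (no _) = zero-antichain
    select-antichain g (no _) (no _) _ = zero-antichain
    select-hits : ∀ g → s ≤ g → g ≤ e → ∀ a b d → 1ℚ ℚ.≤ total (select g a b d) W₂
    select-hits g s≤ ≤e (yes refl) _ _ = ≤-by (total-ind≥0 c l W₂)
      (sym (trans (total-lin (ind i (suc l)) (ind c l) 1ℚ 1ℚ W₂)
        (trans (cong (λ x → 1ℚ * x + 1ℚ * total (ind c l) W₂) (total-hit W₂ (On-append (right (up h) (m≤n⇒m≤1+n c<l)) t (inj₂ (inj₁ (refl , refl))))))
          (((∀ y → 1ℚ * 1ℚ + 1ℚ * y ≡ 1ℚ + y) ∋ solve-∀ ℚ-ring) (total (ind c l) W₂)))))
    select-hits g _ _ (no _) (yes s≤) (yes ≤e) = let _ , _ , o , _ = covering W₂ g s≤ (s≤s ≤e) in ℚP.≤-reflexive (sym (total-hit W₂ o))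
    select-hits g s≤ ≤e (no _) (yes _) (no ¬h) = ⊥-elim (¬h ≤e)
    select-hits g s≤ ≤e (no _) (no ¬h) _ = ⊥-elim (¬h s≤)
    select-at : ∀ a b d → select c a b d c l ≡ 1ℚ
    select-at (yes _) _ _ = cong₂ (λ x y → 1ℚ * x + 1ℚ * y) (ind-off {i} {suc l} {c} {l} (λ (x , _) → <-irrefl (sym x) ≤-refl)) (ind-at {c} {l} refl refl)
    select-at (no ¬h) _ _ = ⊥-elim (¬h refl)

    open Spread gap χ (λ g → select-antichain g (g ℕ.≟ c) (s ℕ.≤? g) (g ℕ.≤? e))
    m : ℕ
    m = ℕ.pred n
    suc-m : suc m ≡ n
    suc-m = suc-pred n ⦃ ℕ.>-nonZero (≤-trans (s≤s z≤n) e<n) ⦄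
    e≤m : e ≤ m
    e≤m = ≤-pred (≤-trans e<n (≤-reflexive (sym suc-m)))
    y : Point
    y = spread A χ m
    y∈ : Member n A y
    y∈ = spread-member m (≤-reflexive suc-m) (≤-reflexive (sym suc-m))
    y-tight : total y W₂ + A s ≡ A (suc e)
    y-tight = ℚP.≤-antisym (spread-upper W₂ 1≤s m (≤-reflexive suc-m) e≤m)
      (spread-lower W₂ 1≤s m (≤-reflexive suc-m) e≤m (λ g s≤ ≤e → select-hits g s≤ ≤e (g ℕ.≟ c) (s ℕ.≤? g) (g ℕ.≤? e)))
    c≤m : c ≤ m
    c≤m = ≤-trans (<⇒≤ c<l) (≤-trans l≤e e≤m)
    y-cl>0 : 0ℚ ℚ.< y c l
    y-cl>0 = ℚP.<-≤-trans (ℚP.<-≤-trans 0<1 (≤-by (0≤- (gap-at gap c (s≤s z≤n) (≤-trans (s≤s c≤m) (≤-reflexive suc-m))))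
        (trans (((∀ a b → 1ℚ + (b - (a + 1ℚ)) ≡ (b - a) * 1ℚ) ∋ solve-∀ ℚ-ring) (A c) (A (suc c)))
          (cong ((A (suc c) - A c) *_) (sym (select-at (c ℕ.≟ c) (s ℕ.≤? c) (c ℕ.≤? e)))))))
      (part≤spread m (≤-reflexive suc-m) c (s≤s z≤n) c≤m c l)

-- φ i j is the maximum of A s + total x w over all walks w from s to (i , j).
module _ (A : ℕ → ℚ) (x : Point) where
  abstract
    φ : ℕ → ℕ → ℚ
    -- No walk visits row 0. The value A 1 never exceeds φ 1 j, so it does not affect the maximum,
    -- and it keeps φ monotone from row 0 to row 1.
    φ zero    j       = A 1
    φ (suc i) zero    = A (suc i)
    φ (suc i) (suc j) with suc i ℕ.<? suc j
    ... | yes _ = x (suc i) (suc j) + (φ (suc i) j ℚ.⊔ φ i (suc j))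
    ... | no  _ = A (suc i)

    φ-zero : ∀ j → φ 0 j ≡ A 1
    φ-zero j = refl

    φ-diagonal : ∀ i → 1 ≤ i → φ i i ≡ A i
    φ-diagonal (suc i) _ with suc i ℕ.<? suc i
    ... | yes h = ⊥-elim (<-irrefl refl h)
    ... | no  _ = refl

    φ-step : ∀ i j → suc i < suc j → φ (suc i) (suc j) ≡ x (suc i) (suc j) + (φ (suc i) j ℚ.⊔ φ i (suc j))
    φ-step i j h with suc i ℕ.<? suc j
    ... | yes _ = refl
    ... | no ¬h = ⊥-elim (¬h h)

-- Monotonicity of the walk maximum.

module Potential {n A x} (gap : Gap n A) (x∈ : Member n A x) where

  private
    Φ = φ A x

  from-left : ∀ i j → suc i < suc j → Φ (suc i) j + x (suc i) (suc j) ℚ.≤ Φ (suc i) (suc j)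
  from-left i j h = ℚP.≤-trans (≤-by (0≤- (ℚP.p≤p⊔q (Φ (suc i) j) (Φ i (suc j))))
      (((∀ p x m → p + x + (m - p) ≡ x + m) ∋ solve-∀ ℚ-ring) (Φ (suc i) j) (x (suc i) (suc j)) (Φ (suc i) j ℚ.⊔ Φ i (suc j))))
    (ℚP.≤-reflexive (sym (φ-step A x i j h)))

  from-below : ∀ i j → suc i < suc j → Φ i (suc j) + x (suc i) (suc j) ℚ.≤ Φ (suc i) (suc j)
  from-below i j h = ℚP.≤-trans (≤-by (0≤- (ℚP.p≤q⊔p (Φ (suc i) j) (Φ i (suc j))))
      (((∀ p x m → p + x + (m - p) ≡ x + m) ∋ solve-∀ ℚ-ring) (Φ i (suc j)) (x (suc i) (suc j)) (Φ (suc i) j ℚ.⊔ Φ i (suc j))))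
    (ℚP.≤-reflexive (sym (φ-step A x i j h)))

  step-left : ∀ i j → suc i < suc j → Φ i (suc j) ℚ.≤ Φ (suc i) j → Φ (suc i) (suc j) ≡ Φ (suc i) j + x (suc i) (suc j)
  step-left i j h le = trans (φ-step A x i j h) (trans (cong (x (suc i) (suc j) +_) (ℚP.p≥q⇒p⊔q≡p le)) (ℚP.+-comm (x (suc i) (suc j)) (Φ (suc i) j)))

  step-below : ∀ i j → suc i < suc j → Φ (suc i) j ℚ.≤ Φ i (suc j) → Φ (suc i) (suc j) ≡ Φ i (suc j) + x (suc i) (suc j)
  step-below i j h le = trans (φ-step A x i j h) (trans (cong (x (suc i) (suc j) +_) (ℚP.p≤q⇒p⊔q≡q le)) (ℚP.+-comm (x (suc i) (suc j)) (Φ i (suc j))))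

  private
    weaken : ∀ {p q r} → p + q ℚ.≤ r → 0ℚ ℚ.≤ q → p ℚ.≤ r
    weaken {p} {q} {r} h q≥0 = ≤-by (0≤- h ⊹ q≥0) (((∀ p q r → p + ((r - (p + q)) + q) ≡ r) ∋ solve-∀ ℚ-ring) p q r)

  mono-j : ∀ {i j} → 1 ≤ i → i ≤ j → suc j ≤ n → Φ i j ℚ.≤ Φ i (suc j)
  mono-j {suc i} {j} 1≤i i≤j j<n = weaken (from-left i j (s≤s i≤j)) (proj₁ x∈ (suc i) (suc j) (1≤i , s≤s i≤j , j<n))

  A≤φ : ∀ {i j} → 1 ≤ i → i ≤ j → j ≤ n → A i ℚ.≤ Φ i j
  A≤φ {i} {zero} 1≤i i≤0 _ = ⊥-elim (<⇒≱ 1≤i i≤0)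
  A≤φ {i} {suc j} 1≤i i≤j j≤n = [ (λ i< → ℚP.≤-trans (A≤φ 1≤i (≤-pred i<) (<⇒≤ j≤n)) (mono-j 1≤i (≤-pred i<) j≤n))
    , (λ { refl → ℚP.≤-reflexive (sym (φ-diagonal A x i 1≤i)) }) ]′ (m≤n⇒m<n∨m≡n i≤j)

  attained : ∀ i j → 1 ≤ i → i ≤ j → j ≤ n → Σ[ s ∈ ℕ ] (1 ≤ s × Σ[ w ∈ Walk s i j ] total x w + A s ≡ Φ i j)
  attained (suc i) (suc j) 1≤i i≤j j≤n = [ below , (λ { refl → suc i , 1≤i , start ,
      trans (ℚP.+-identityˡ (A (suc i))) (sym (φ-diagonal A x (suc i) 1≤i)) }) ]′ (m≤n⇒m<n∨m≡n i≤j)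
    where
    extend : ∀ T b a {f g} → T + a ≡ f → f + b ≡ g → T + b + a ≡ g
    extend T b a refl refl = ((∀ T b a → T + b + a ≡ T + a + b) ∋ solve-∀ ℚ-ring) T b a
    left : suc i < suc j → Φ i (suc j) ℚ.≤ Φ (suc i) j → Σ[ s ∈ ℕ ] (1 ≤ s × Σ[ w ∈ Walk s (suc i) (suc j) ] total x w + A s ≡ Φ (suc i) (suc j))
    left h le = let s , 1≤s , w , e = attained (suc i) j 1≤i (≤-pred h) (<⇒≤ j≤n)
                in s , 1≤s , up w , extend (total x w) (x (suc i) (suc j)) (A s) e (sym (step-left i j h le))
    below : suc i < suc j → Σ[ s ∈ ℕ ] (1 ≤ s × Σ[ w ∈ Walk s (suc i) (suc j) ] total x w + A s ≡ Φ (suc i) (suc j))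
    below h = [ left h , up-case i refl ]′ (ℚP.≤-total (Φ i (suc j)) (Φ (suc i) j))
      where
      up-case : ∀ k → k ≡ i → Φ (suc i) j ℚ.≤ Φ i (suc j) → Σ[ s ∈ ℕ ] (1 ≤ s × Σ[ w ∈ Walk s (suc i) (suc j) ] total x w + A s ≡ Φ (suc i) (suc j))
      up-case zero refl _ = left h (ℚP.≤-trans (ℚP.≤-reflexive (φ-zero A x (suc j))) (A≤φ 1≤i (≤-pred h) (<⇒≤ j≤n)))
      up-case (suc k) refl le = let s , 1≤s , w , e = attained i (suc j) (s≤s z≤n) (<⇒≤ i≤j) j≤n
                               in s , 1≤s , right w h , extend (total x w) (x (suc i) (suc j)) (A s) e (sym (step-below i j h le))

  φ-end : ∀ {e} → 1 ≤ e → suc e ≤ n → Φ e (suc e) ℚ.≤ A (suc e)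
  φ-end {e} 1≤e e<n = let s , 1≤s , w , eq = attained e (suc e) 1≤e (n≤1+n e) e<n
    in ℚP.≤-trans (ℚP.≤-reflexive (sym eq)) (proj₂ x∈ 1≤s e<n w)

  -- Off the diagonal this is x ≥ 0. Onto the diagonal it is the path inequality itself: a walk that
  -- ends at (e , suc e) has value at most A (suc e), the value of φ at (suc e , suc e).
  mono-i : ∀ {i j} → suc i ≤ j → j ≤ n → Φ i j ℚ.≤ Φ (suc i) j
  mono-i {i} {suc j} i<j j≤n = [ (λ h → weaken (from-below i j h) (proj₁ x∈ (suc i) (suc j) (s≤s z≤n , h , j≤n)))
    , (λ { refl → on-diagonal i j≤n }) ]′ (m≤n⇒m<n∨m≡n i<j)
    where
    on-diagonal : ∀ i → suc i ≤ n → Φ i (suc i) ℚ.≤ Φ (suc i) (suc i)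
    on-diagonal zero h = ℚP.≤-reflexive (trans (φ-zero A x 1) (sym (φ-diagonal A x 1 (s≤s z≤n))))
    on-diagonal (suc i) h = ℚP.≤-trans (φ-end (s≤s z≤n) h) (ℚP.≤-reflexive (sym (φ-diagonal A x (suc (suc i)) (s≤s z≤n))))

  mono : ∀ {i i′ j j′} → 1 ≤ i → i ≤ j → i ≤ i′ → j ≤ j′ → i′ ≤ j′ → j′ ≤ n → Φ i j ℚ.≤ Φ i′ j′
  mono {i} {i′} {j} {j′} 1≤i i≤j i≤i′ j≤j′ i′≤j′ j′≤n = ℚP.≤-trans (along-j (≤⇒≤′ j≤j′) j′≤n) (along-i (≤⇒≤′ i≤i′) i′≤j′)
    where
    along-j : ∀ {j′} → j ≤′ j′ → j′ ≤ n → Φ i j ℚ.≤ Φ i j′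
    along-j ≤′-refl _ = ℚP.≤-refl
    along-j (≤′-step h) j≤n = ℚP.≤-trans (along-j h (<⇒≤ j≤n)) (mono-j 1≤i (≤-trans i≤j (≤′⇒≤ h)) j≤n)
    along-i : ∀ {i′} → i ≤′ i′ → i′ ≤ j′ → Φ i j′ ℚ.≤ Φ i′ j′
    along-i ≤′-refl _ = ℚP.≤-refl
    along-i (≤′-step h) i≤j = ℚP.≤-trans (along-i h (<⇒≤ i≤j)) (mono-i i≤j j′≤n)

  walk≤φ : ∀ {s i j} → 1 ≤ s → j ≤ n → (w : Walk s i j) → total x w + A s ℚ.≤ Φ i j
  walk≤φ {s} 1≤s j≤n start = ℚP.≤-reflexive (trans (ℚP.+-identityˡ (A s)) (sym (φ-diagonal A x s 1≤s)))
  walk≤φ {s} 1≤s j≤n (right {i} {suc j} w h) = ℚP.≤-trans (≤-by (0≤- (walk≤φ 1≤s j≤n w))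
      (((∀ T b a f → T + b + a + (f - (T + a)) ≡ f + b) ∋ solve-∀ ℚ-ring) (total x w) (x (suc i) (suc j)) (A s) (Φ i (suc j)))) (from-below i j h)
  walk≤φ {s} 1≤s j≤n (up {zero} w) = ⊥-elim (<⇒≱ 1≤s (walk-s≤i w))
  walk≤φ {s} 1≤s j≤n (up {suc i} {j} w) = ℚP.≤-trans (≤-by (0≤- (walk≤φ 1≤s (<⇒≤ j≤n) w))
      (((∀ T b a f → T + b + a + (f - (T + a)) ≡ f + b) ∋ solve-∀ ℚ-ring) (total x w) (x (suc i) (suc j)) (A s) (Φ (suc i) j))) (from-left i j (s≤s (walk-i≤j w)))

-- Level sets of the walk maximum at a vertex.

min>0 : ∀ {p q} → 0ℚ ℚ.< p → 0ℚ ℚ.< q → 0ℚ ℚ.< p ℚ.⊓ q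
min>0 {p} {q} p>0 q>0 = [ (λ h → ℚP.<-≤-trans p>0 (ℚP.≤-reflexive (sym (ℚP.p≤q⇒p⊓q≡p h))))
  , (λ h → ℚP.<-≤-trans q>0 (ℚP.≤-reflexive (sym (ℚP.p≥q⇒p⊓q≡q h)))) ]′ (ℚP.≤-total p q)

smallest : ∀ n (h : Point) → Σ[ δ ∈ ℚ ] (0ℚ ℚ.< δ × (∀ i j → i ≤ n → j ≤ n → 0ℚ ℚ.< h i j → δ ℚ.≤ h i j))
smallest n h = uniform₂ (0ℚ ℚ.<_) (λ i j δ → 0ℚ ℚ.< h i j → δ ℚ.≤ h i j)
    (λ {p} {q} p>0 q>0 → p ℚ.⊓ q , min>0 p>0 q>0 ,
      (λ _ _ f pos → ℚP.≤-trans (ℚP.p⊓q≤p p q) (f pos)) , (λ _ _ f pos → ℚP.≤-trans (ℚP.p⊓q≤q p q) (f pos)))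
    each n
  where
  each : ∀ i j → Σ[ δ ∈ ℚ ] (0ℚ ℚ.< δ × (0ℚ ℚ.< h i j → δ ℚ.≤ h i j))
  each i j with 0ℚ ℚP.<? h i j
  ... | yes pos = h i j , pos , λ _ → ℚP.≤-refl
  ... | no ¬pos = 1ℚ , 0<1 , λ pos → ⊥-elim (¬pos pos)

flag : {P : Set} → Dec P → ℚ
flag (yes _) = 1ℚ
flag (no _)  = 0ℚ

flag-yes : ∀ {P : Set} (d : Dec P) → P → flag d ≡ 1ℚ
flag-yes (yes _) _ = refl
flag-yes (no ¬p) p = ⊥-elim (¬p p)

flag-no : ∀ {P : Set} (d : Dec P) → ¬ P → flag d ≡ 0ℚ
flag-no (yes p) ¬p = ⊥-elim (¬p p)
flag-no (no _)  _  = refl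

flag-cong : ∀ {P Q : Set} (d : Dec P) (e : Dec Q) → (P → Q) → (Q → P) → flag d ≡ flag e
flag-cong (yes p) e f g = sym (flag-yes e (f p))
flag-cong (no ¬p) e f g = sym (flag-no e (λ q → ¬p (g q)))

choose : {P : Set} → Dec P → ℚ → ℚ → ℚ
choose (yes _) a b = a
choose (no _)  a b = b

choose-yes : ∀ {P : Set} (d : Dec P) {a b} → P → choose d a b ≡ a
choose-yes (yes _) p = refl
choose-yes (no ¬p) p = ⊥-elim (¬p p)

choose-no : ∀ {P : Set} (d : Dec P) {a b} → (P → a ≡ b) → choose d a b ≡ b
choose-no (yes p) f = f p
choose-no (no _)  f = refl

-- Suppose φ (C - 1) R = V exceeds φ C (R - 1) at a point (C , R) with x > 0.
-- Then the points of level V split into those with i < C, R ≤ j and those with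
-- C < i, j < R.  The first part contains no diagonal point and is not comparable
-- to the second, so its level can be moved up and down; hence x is no vertex.
module LevelShift {n A x} (gap : Gap n A) (vertex : Vertex n A x) {c m} (valid : Valid n (suc c) (suc m))
  (x>0 : 0ℚ ℚ.< x (suc c) (suc m)) (bad : φ A x (suc c) m ℚ.< φ A x c (suc m)) where

  private
    x∈ = proj₁ vertex
  open Potential gap x∈

  private
    Φ = φ A x
    C = suc c
    R = suc m
    V = Φ c R
    C<R = proj₁ (proj₂ valid)
    R≤n = proj₂ (proj₂ valid)
    C≤m : C ≤ m
    C≤m = ≤-pred C<R
    m≤n = <⇒≤ R≤n

    -- The artificial row 0 has the value A 1 and so does not meet the level V.
    A1<V : A 1 ℚ.< V
    A1<V = ℚP.≤-<-trans (ℚP.≤-trans (monotone gap ≤-refl (s≤s z≤n) (≤-trans C≤m m≤n)) (A≤φ (s≤s z≤n) C≤m m≤n)) bad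

    level⇒1≤ : ∀ {i j} → Φ i j ≡ V → 1 ≤ i
    level⇒1≤ {zero} {j} e = ⊥-elim (ℚP.<-irrefl (trans (sym (φ-zero A x j)) e) A1<V)
    level⇒1≤ {suc i} e = s≤s z≤n

    V<φ-CR : V ℚ.< Φ C R
    V<φ-CR = ℚP.<-≤-trans (<-by x>0 refl) (from-below c m C<R)

    -- By monotonicity and φ C m < V < φ C R, no point of level V lies weakly below (C , m) or
    -- weakly above (C , R) in the product order.
    split : ∀ {i j} → i ≤ j → j ≤ n → Φ i j ≡ V → (i < C × R ≤ j) ⊎ (C < i × j < R)
    split {i} {j} i≤j j≤n e with i ℕ.<? C | j ℕ.<? R
    ... | yes i<C | no j≮R = inj₁ (i<C , ≮⇒≥ j≮R)
    ... | yes i<C | yes j<R = ⊥-elim (ℚP.<-irrefl e (ℚP.≤-<-trans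
                                (mono (level⇒1≤ e) i≤j (<⇒≤ i<C) (≤-pred j<R) C≤m m≤n) bad))
    ... | no i≮C | no j≮R = ⊥-elim (ℚP.<-irrefl (sym e) (ℚP.<-≤-trans V<φ-CR
                                (mono (s≤s z≤n) (<⇒≤ C<R) (≮⇒≥ i≮C) (≮⇒≥ j≮R) i≤j j≤n)))
    ... | no i≮C | yes j<R = [ (λ C<i → inj₂ (C<i , j<R)) , (λ { refl → ⊥-elim (ℚP.<-irrefl e (ℚP.≤-<-trans
                                (mono (s≤s z≤n) i≤j ≤-refl (≤-pred j<R) C≤m m≤n) bad)) }) ]′ (m≤n⇒m<n∨m≡n (≮⇒≥ i≮C))

    In : ℕ → ℕ → Set
    In i j = Φ i j ≡ V × i < C × R ≤ j

    in? : ∀ i j → Dec (In i j)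
    in? i j with Φ i j ℚ.≟ V | i ℕ.<? C | R ℕ.≤? j
    ... | yes e | yes f | yes g = yes (e , f , g)
    ... | no ¬e | _     | _     = no (λ (e , _) → ¬e e)
    ... | yes _ | no ¬f | _     = no (λ (_ , f , _) → ¬f f)
    ... | yes _ | yes _ | no ¬g = no (λ (_ , _ , g) → ¬g g)

    g : ℕ → ℕ → ℚ
    g i j = flag (in? i j)

    g-diagonal : ∀ s → g s s ≡ 0ℚ
    g-diagonal s = flag-no (in? s s) (λ (_ , s<C , R≤s) → <-irrefl refl (<-trans s<C (<-≤-trans C<R R≤s)))

    g-end : ∀ e → g e (suc e) ≡ 0ℚ
    g-end e = flag-no (in? e (suc e)) (λ (_ , e<C , R≤e) → <-irrefl refl (<-≤-trans C<R (≤-trans R≤e e<C)))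

    -- Two predecessors of one point are too close to lie in different parts of the level set. So at
    -- a tie it does not matter which of them `previous` selects.
    g-tie : ∀ {i j} → suc i < suc j → suc j ≤ n → Φ i (suc j) ≡ Φ (suc i) j → g i (suc j) ≡ g (suc i) j
    g-tie {i} {j} h j≤n e = flag-cong (in? i (suc j)) (in? (suc i) j)
      (λ (v , i<C , R≤) → let v′ = trans (sym e) v in
        [ (λ (a , b) → v′ , a , b) , (λ (C<i , _) → ⊥-elim (<-irrefl refl (<-≤-trans C<i i<C))) ]′
        (split (≤-pred h) (<⇒≤ j≤n) v′))
      (λ (v , i<C , R≤) → trans e v , <⇒≤ i<C , m≤n⇒m≤1+n R≤)

    g-below : ∀ {i j} → suc i < suc j → suc j ≤ n → Φ (suc i) (suc j) ≡ Φ i (suc j) → g (suc i) (suc j) ≡ g i (suc j)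
    g-below {i} {j} h j≤n e = flag-cong (in? (suc i) (suc j)) (in? i (suc j))
      (λ (v , i<C , R≤) → trans (sym e) v , <⇒≤ i<C , R≤)
      (λ (v , i<C , R≤) → let v′ = trans e v in
        [ (λ (a , b) → v′ , a , b) , (λ (_ , j<R) → ⊥-elim (<⇒≱ j<R R≤)) ]′ (split (<⇒≤ h) j≤n v′))

    g-left : ∀ {i j} → suc i < suc j → suc j ≤ n → Φ (suc i) (suc j) ≡ Φ (suc i) j → g (suc i) (suc j) ≡ g (suc i) j
    g-left {i} {j} h j≤n e = flag-cong (in? (suc i) (suc j)) (in? (suc i) j)
      (λ (v , i<C , R≤) → let v′ = trans (sym e) v in
        [ (λ (a , b) → v′ , a , b) , (λ (C<i , _) → ⊥-elim (<-asym C<i i<C)) ]′ (split (≤-pred h) (<⇒≤ j≤n) v′))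
      (λ (v , i<C , R≤) → trans e v , i<C , m≤n⇒m≤1+n R≤)

    previous : ℕ → ℕ → ℚ
    previous i j = choose (Φ (suc i) j ℚP.≤? Φ i (suc j)) (g i (suc j)) (g (suc i) j)

    previous-below : ∀ {i j} → Φ (suc i) j ℚ.≤ Φ i (suc j) → previous i j ≡ g i (suc j)
    previous-below {i} {j} le = choose-yes (Φ (suc i) j ℚP.≤? Φ i (suc j)) le

    previous-left : ∀ {i j} → suc i < suc j → suc j ≤ n → Φ i (suc j) ℚ.≤ Φ (suc i) j → previous i j ≡ g (suc i) j
    previous-left {i} {j} h j≤n le = choose-no (Φ (suc i) j ℚP.≤? Φ i (suc j)) (λ le′ → g-tie h j≤n (ℚP.≤-antisym le le′))

    -- The change of x that raises φ by g: the increment of g from a maximal predecessor. Along a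
    -- walk using only maximal predecessors it telescopes, and g vanishes at both ends of a path.
    u : Point
    u zero    j       = 0ℚ
    u (suc i) zero    = 0ℚ
    u (suc i) (suc j) = g (suc i) (suc j) - previous i j

    D D′ : Point
    D i j = Φ i (ℕ.pred j) - Φ (ℕ.pred i) j
    D′ i j = Φ (ℕ.pred i) j - Φ i (ℕ.pred j)

    δ₁ = smallest n x
    δ₂ = smallest n D
    δ₃ = smallest n D′
    δ : ℚ
    δ = proj₁ δ₁ ℚ.⊓ (proj₁ δ₂ ℚ.⊓ proj₁ δ₃)

    δ>0 : 0ℚ ℚ.< δ
    δ>0 = min>0 (proj₁ (proj₂ δ₁)) (min>0 (proj₁ (proj₂ δ₂)) (proj₁ (proj₂ δ₃)))

    δ≤x : ∀ {i j} → i ≤ n → j ≤ n → 0ℚ ℚ.< x i j → δ ℚ.≤ x i j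
    δ≤x i≤ j≤ p = ℚP.≤-trans (ℚP.p⊓q≤p (proj₁ δ₁) (proj₁ δ₂ ℚ.⊓ proj₁ δ₃)) (proj₂ (proj₂ δ₁) _ _ i≤ j≤ p)

    δ≤D : ∀ {i j} → i ≤ n → j ≤ n → 0ℚ ℚ.< D i j → δ ℚ.≤ D i j
    δ≤D i≤ j≤ p = ℚP.≤-trans (ℚP.p⊓q≤q (proj₁ δ₁) (proj₁ δ₂ ℚ.⊓ proj₁ δ₃))
      (ℚP.≤-trans (ℚP.p⊓q≤p (proj₁ δ₂) (proj₁ δ₃)) (proj₂ (proj₂ δ₂) _ _ i≤ j≤ p))

    δ≤D′ : ∀ {i j} → i ≤ n → j ≤ n → 0ℚ ℚ.< D′ i j → δ ℚ.≤ D′ i j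
    δ≤D′ i≤ j≤ p = ℚP.≤-trans (ℚP.p⊓q≤q (proj₁ δ₁) (proj₁ δ₂ ℚ.⊓ proj₁ δ₃))
      (ℚP.≤-trans (ℚP.p⊓q≤q (proj₁ δ₂) (proj₁ δ₃)) (proj₂ (proj₂ δ₃) _ _ i≤ j≤ p))

    ≤⊎> : ∀ p q → p ℚ.≤ q ⊎ q ℚ.< p
    ≤⊎> p q with p ℚP.≤? q
    ... | yes h = inj₁ h
    ... | no ¬h = inj₂ (ℚP.≰⇒> ¬h)

    -- A step from a predecessor that does not attain the maximum costs at least δ for good; without
    -- such a step u telescopes to g.
    Claim : ∀ {s i j} → Walk s i j → Set
    Claim {s} {i} {j} w = total x w + A s + δ ℚ.≤ Φ i j ⊎ total u w ≡ g i j

    gains : ∀ T X a {f f′} → T + a + δ ℚ.≤ f → f + X ℚ.≤ f′ → T + X + a + δ ℚ.≤ f′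
    gains T X a {f} h k = ℚP.≤-trans (≤-by (0≤- h) (((∀ T X a d f → T + X + a + d + (f - (T + a + d)) ≡ f + X) ∋ solve-∀ ℚ-ring) T X a δ f)) k

    slack-new : ∀ T X a q {p f′} → T + a ℚ.≤ p → δ ℚ.≤ q - p → q + X ℚ.≤ f′ → T + X + a + δ ℚ.≤ f′
    slack-new T X a q {p} h k l = ℚP.≤-trans (≤-by (0≤- h ⊹ 0≤- k)
      (((∀ T X a d p q → T + X + a + d + ((p - (T + a)) + ((q - p) - d)) ≡ q + X) ∋ solve-∀ ℚ-ring) T X a δ p q)) l

    telescopes : ∀ {T p r q} → T ≡ p → q ≡ p → T + (r - q) ≡ r
    telescopes {T} {r = r} refl refl = ((∀ T r → T + (r - T) ≡ r) ∋ solve-∀ ℚ-ring) T r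

    claim : ∀ {s i j} → 1 ≤ s → j ≤ n → (w : Walk s i j) → Claim w
    claim {s} 1≤s j≤n start = inj₂ (sym (g-diagonal s))
    claim {s} 1≤s j≤n (right {i} {suc j} w h) =
      [ (λ le → [ (λ sl → inj₁ (gains (total x w) (x (suc i) (suc j)) (A s) sl (from-below i j h)))
                , (λ t → inj₂ (telescopes t (previous-below {i} {j} le))) ]′ (claim 1≤s j≤n w))
      , (λ lt → inj₁ (slack-new (total x w) (x (suc i) (suc j)) (A s) (Φ (suc i) j) (walk≤φ 1≤s j≤n w)
          (δ≤D {suc i} {suc j} (<⇒≤ (<-≤-trans h j≤n)) j≤n (0<- lt)) (from-left i j h))) ]′
      (≤⊎> (Φ (suc i) j) (Φ i (suc j)))
    claim {s} 1≤s j≤n (up {zero} w) = ⊥-elim (<⇒≱ 1≤s (walk-s≤i w))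
    claim {s} 1≤s j≤n (up {suc i} {j} w) =
      [ (λ le → [ (λ sl → inj₁ (gains (total x w) (x (suc i) (suc j)) (A s) sl (from-left i j h)))
                , (λ t → inj₂ (telescopes t (previous-left h j≤n le))) ]′ (claim 1≤s (<⇒≤ j≤n) w))
      , (λ lt → inj₁ (slack-new (total x w) (x (suc i) (suc j)) (A s) (Φ i (suc j)) (walk≤φ 1≤s (<⇒≤ j≤n) w)
          (δ≤D′ {suc i} {suc j} (<⇒≤ (<-≤-trans h j≤n)) j≤n (0<- lt)) (from-below i j h))) ]′
      (≤⊎> (Φ i (suc j)) (Φ (suc i) j))
      where
      h : suc i < suc j
      h = s≤s (walk-i≤j w)

    vanishing : ∀ i j → Valid n i j → δ ℚ.≤ x i j ⊎ u i j ≡ 0ℚ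
    vanishing (suc i) (suc j) (1≤i , h , j≤n) =
      [ (λ x≡0 → inj₂ ([ (λ le → cancel (trans (g-below h j≤n (trans (step-below i j h le) (drop (Φ i (suc j)) x≡0))) (sym (previous-below {i} {j} le))))
                       , (λ lt → cancel (trans (g-left h j≤n (trans (step-left i j h (ℚP.<⇒≤ lt)) (drop (Φ (suc i) j) x≡0))) (sym (previous-left h j≤n (ℚP.<⇒≤ lt))))) ]′
                       (≤⊎> (Φ (suc i) j) (Φ i (suc j)))))
      , (λ x>0 → inj₁ (δ≤x (<⇒≤ (<-≤-trans h j≤n)) j≤n x>0)) ]′ (zero⊎positive (proj₁ x∈ (suc i) (suc j) (1≤i , h , j≤n)))
      where
      drop : ∀ p {q} → q ≡ 0ℚ → p + q ≡ p
      drop p refl = ℚP.+-identityʳ p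
      cancel : ∀ {p q} → p ≡ q → p - q ≡ 0ℚ
      cancel {p} refl = ℚP.+-inverseʳ p

    u≈0 : u ≈[ n ] (λ _ _ → 0ℚ)
    u≈0 = rigid {A = A} {v = x} vertex u δ>0 vanishing λ {s} {e} 1≤s e<n w →
      [ (λ sl → inj₁ (ℚP.≤-trans sl (φ-end (≤-trans 1≤s (walk-s≤i w)) e<n))) , (λ t → inj₂ (trans t (g-end e))) ]′ (claim 1≤s e<n w)

  impossible : ⊥
  -- The point (C , R) lies outside the moved part and its maximal predecessor (c , R) inside, so u
  -- is -1 there.
  impossible = -1≢0 (trans (sym (cong₂ _-_ (flag-no (in? C R) (λ (_ , C<C , _) → <-irrefl refl C<C))
      (trans (previous-below {c} {m} (ℚP.<⇒≤ bad)) (flag-yes (in? c R) (refl , ≤-refl , ≤-refl))))) (u≈0 C R valid))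
    where
    -1≢0 : 0ℚ - 1ℚ ≡ 0ℚ → ⊥
    -1≢0 ()

left-dominates : ∀ {n A x} → Gap n A → Vertex n A x → ∀ {c m} → Valid n (suc c) (suc m) → 0ℚ ℚ.< x (suc c) (suc m) →
  φ A x c (suc m) ℚ.≤ φ A x (suc c) m
left-dominates {A = A} {x} gap vertex {c} {m} valid x>0 with φ A x c (suc m) ℚP.≤? φ A x (suc c) m
... | yes h = h
... | no ¬h = ⊥-elim (LevelShift.impossible gap vertex valid x>0 (ℚP.≰⇒> ¬h))

-- The reflection (i , j) ↦ (n + 1 - j , n + 1 - i) reverses walks and maps P to
-- the polytope of the potential k ↦ - A (n + 1 - k).
mirror : ℕ → Point → Point
mirror n x i j = x (suc n ∸ j) (suc n ∸ i)

mirrorA : ℕ → (ℕ → ℚ) → ℕ → ℚ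
mirrorA n A k = - A (suc n ∸ k)

complement : ∀ {a b N} → a ℕ.+ b ≡ N → N ∸ b ≡ a
complement {a} {b} refl = m+n∸n≡m a b

mirror-at : ∀ {n i j i′ j′} x → i ℕ.+ i′ ≡ suc n → j ℕ.+ j′ ≡ suc n → mirror n x j′ i′ ≡ x i j
mirror-at x e f = cong₂ x (complement e) (complement f)

mirrorA-at : ∀ {n k k′} A → k ℕ.+ k′ ≡ suc n → mirrorA n A k′ ≡ - A k
mirrorA-at A e = cong (λ k → - A k) (complement e)

total-closed : ∀ {s i j} x (w : Walk s i j) → s ≡ i → s ≡ j → total x w ≡ 0ℚ
total-closed x start _ _ = refl
total-closed x (right w _) e _ = ⊥-elim (<-irrefl e (s≤s (walk-s≤i w)))
total-closed x (up w) refl e = ⊥-elim (<-irrefl e (s≤s (walk-i≤j w)))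

-- The reflected walk is read from its end, with `right` and `up` interchanged. The summand x i j is
-- the starting point that a tail omits. Equations such as i + i′ ≡ suc n avoid truncated
-- subtraction in the induction.
toTail : ∀ {n t i j i′ j′} x (g : Walk t j′ i′) → j′ < i′ → i ℕ.+ i′ ≡ suc n → j ℕ.+ j′ ≡ suc n →
  Σ[ e ∈ ℕ ] (suc e ℕ.+ t ≡ suc n × Σ[ τ ∈ Tail e i j ] tailSum x τ + x i j ≡ total (mirror n x) g)
toTail x start h _ _ = ⊥-elim (<-irrefl refl h)
toTail {n} {t} {i} {j} {i′} x (right {j₀} g _) h p q =
  let e , r , τ , eq = toTail x g (<⇒≤ h) p (trans (sym (+-suc j j₀)) q)
  in e , r , up τ , trans (cong (_+ x i j) (ℚP.+-comm (x i (suc j)) (tailSum x τ))) (cong₂ _+_ eq (sym (mirror-at x p q)))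
toTail {n} {t} {i} {j} {_} {j′} x (up {j = i₀} g) h p q = [ continue , (λ (a , b) → finish a b) ]′ (off-diagonal g)
  where
  p′ : suc i ℕ.+ i₀ ≡ suc n
  p′ = trans (sym (+-suc i i₀)) p
  continue : j′ < i₀ → _
  continue j′<i₀ =
    let suci<j = +-cancelʳ-< j′ (suc i) j (<-≤-trans (+-monoʳ-< (suc i) j′<i₀) (≤-reflexive (trans p′ (sym q))))
        e , r , τ , eq = toTail x g j′<i₀ p′ q
    in e , r , right suci<j τ , trans (cong (_+ x i j) (ℚP.+-comm (x (suc i) j) (tailSum x τ))) (cong₂ _+_ eq (sym (mirror-at x p q)))
  finish : t ≡ j′ → t ≡ i₀ → Σ[ e ∈ ℕ ] (suc e ℕ.+ t ≡ suc n × Σ[ τ ∈ Tail e i j ] tailSum x τ + x i j ≡ total (mirror n x) (up g))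
  finish a b = i , trans (cong (suc i ℕ.+_) b) p′ , subst (Tail i i) (sym j≡) end ,
      trans (cong (_+ x i j) (end-sum j≡)) (cong₂ _+_ (sym (total-closed (mirror n x) g a b)) (sym (mirror-at x p q)))
    where
    j≡ : j ≡ suc i
    j≡ = +-cancelʳ-≡ j′ j (suc i) (trans q (trans (sym p′) (cong (suc i ℕ.+_) (trans (sym b) a))))
    end-sum : ∀ {j} (e : j ≡ suc i) → tailSum x (subst (Tail i i) (sym e) end) ≡ 0ℚ
    end-sum refl = refl

mirror-valid : ∀ {n i j} → Valid n i j → Valid n (suc n ∸ j) (suc n ∸ i)
mirror-valid {n} {suc i} {j} (_ , i<j , j≤n) =
  m<n⇒0<n∸m (s≤s j≤n) , ∸-monoʳ-< i<j (m≤n⇒m≤1+n j≤n) , m∸n≤m n i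

mirror-mirror : ∀ {n} x → mirror n (mirror n x) ≈[ n ] x
mirror-mirror x i j (_ , i<j , j≤n) = cong₂ x
  (m∸[m∸n]≡n (m≤n⇒m≤1+n (<⇒≤ (<-≤-trans i<j j≤n)))) (m∸[m∸n]≡n (m≤n⇒m≤1+n j≤n))

mirror-≈ : ∀ {n x y} → x ≈[ n ] y → mirror n x ≈[ n ] mirror n y
mirror-≈ e i j v = e _ _ (mirror-valid v)

≈-sym : ∀ {n x y} → x ≈[ n ] y → y ≈[ n ] x
≈-sym e i j v = sym (e i j v)

≈-trans : ∀ {n x y z} → x ≈[ n ] y → y ≈[ n ] z → x ≈[ n ] z
≈-trans e f i j v = trans (e i j v) (f i j v)

mirror-injective : ∀ {n x y} → mirror n x ≈[ n ] mirror n y → x ≈[ n ] y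
mirror-injective {n} {x} {y} e = ≈-trans (≈-sym (mirror-mirror x)) (≈-trans (mirror-≈ e) (mirror-mirror y))

mirror-member : ∀ {n A x} → Member n A x → Member n (mirrorA n A) (mirror n x)
mirror-member {n} {A} {x} (nonneg , bound) = (λ i j v → nonneg _ _ (mirror-valid v)) , reflected
  where
  reflected : ∀ {t k} → 1 ≤ t → suc k ≤ n → (g : Walk t k (suc k)) →
    total (mirror n x) g + mirrorA n A t ℚ.≤ mirrorA n A (suc k)
  reflected {t} {k} 1≤t k<n g =
    let s = n ∸ k
        p : s ℕ.+ suc k ≡ suc n
        p = trans (+-suc s k) (cong suc (m∸n+n≡m (<⇒≤ k<n)))
        e , r , τ , eq = toTail {n} {t} {s} {suc s} x g ≤-refl p (trans (sym (+-suc s k)) p)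
        w = append (up start) τ
        e<n : suc e ≤ n
        e<n = ≤-pred (≤-trans (≤-trans (≤-reflexive (+-comm 1 (suc e))) (+-monoʳ-≤ (suc e) 1≤t)) (≤-reflexive r))
        total-w : total x w ≡ total (mirror n x) g
        total-w = trans (total-append x (up start) τ) (trans
          (((∀ a b → 0ℚ + a + b ≡ b + a) ∋ solve-∀ ℚ-ring) (x s (suc s)) (tailSum x τ)) eq)
    in ≤-by (0≤- (bound (m<n⇒0<n∸m k<n) e<n w))
      (trans (cong₂ (λ T a → total (mirror n x) g + a + (A (suc e) - (T + A s))) total-w (mirrorA-at A r))
        (trans (((∀ T a b → T + - b + (b - (T + a)) ≡ - a) ∋ solve-∀ ℚ-ring) (total (mirror n x) g) (A s) (A (suc e)))
          (sym (mirrorA-at A p))))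

mirror-member⁻¹ : ∀ {n A y} → Member n (mirrorA n A) y → Member n A (mirror n y)
mirror-member⁻¹ {n} {A} y∈ = let nonneg , bound = mirror-member y∈ in nonneg ,
  λ {s} {e} 1≤s e<n w → subst₂ (λ a b → total _ w + a ℚ.≤ b)
    (back s (≤-trans (walk-s≤i w) (<⇒≤ e<n))) (back (suc e) e<n) (bound 1≤s e<n w)
  where
  back : ∀ k → k ≤ n → mirrorA n (mirrorA n A) k ≡ A k
  back k k≤n = trans (cong (λ m → - - A m) (m∸[m∸n]≡n (m≤n⇒m≤1+n k≤n)))
    (((∀ a → - - a ≡ a) ∋ solve-∀ ℚ-ring) (A k))

mirror-gap : ∀ {n A} → Gap n A → Gap n (mirrorA n A)
mirror-gap {n} {A} gap = record { gap-at = λ k 1≤k k<n → ≤-by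
  (0≤- (gap-at gap (n ∸ k) (m<n⇒0<n∸m k<n) (∸-monoʳ-< 1≤k (<⇒≤ k<n))))
  (trans (cong (λ m → - A m + 1ℚ + (A (suc (n ∸ k)) - (A (n ∸ k) + 1ℚ))) (+-∸-assoc 1 (<⇒≤ k<n)))
    (((∀ a b → - b + 1ℚ + (b - (a + 1ℚ)) ≡ - a) ∋ solve-∀ ℚ-ring) (A (n ∸ k)) (A (suc (n ∸ k))))) }

mirror-vertex : ∀ {n A v} → Vertex n A v → Vertex n (mirrorA n A) (mirror n v)
mirror-vertex {n} {A} {v} (v∈ , extreme) = mirror-member v∈ , λ y z t y∈ z∈ t>0 t<1 e →
  mirror-injective (extreme (mirror n y) (mirror n z) t (mirror-member⁻¹ y∈) (mirror-member⁻¹ z∈) t>0 t<1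
    (≈-trans (≈-sym (mirror-mirror v)) (mirror-≈ e)))

mirror-simplicial : ∀ {n A v} → Simplicial n A v → Simplicial n (mirrorA n A) (mirror n v)
mirror-simplicial {n} {A} {v} (m , w , indep , cone) = m , (λ k → mirror n (w k)) ,
  (λ c e → indep c (mirror-injective e)) ,
  λ u → mk⇔
    (λ (t , t>0 , h) →
      let c , c≥0 , e = Equivalence.to (cone (mirror n u)) (t , t>0 , Member-cong
            (λ i j vl → cong (_+ t * mirror n u i j) (mirror-mirror v i j vl)) (mirror-member⁻¹ h))
      in c , c≥0 , ≈-trans (≈-sym (mirror-mirror u)) (mirror-≈ e))
    (λ (c , c≥0 , e) →
      let t , t>0 , h = Equivalence.from (cone (mirror n u)) (c , c≥0 , ≈-trans (mirror-≈ e) (mirror-mirror (combo m c w)))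
      in t , t>0 , Member-cong (λ i j vl → cong (λ p → mirror n v i j + t * p) (mirror-mirror u i j vl)) (mirror-member h))

-- Tight walks through the positive coordinates of a vertex.

module Through {n A x} (gap : Gap n A) (vertex : Vertex n A x) where

  private
    x∈ = proj₁ vertex
    Φ = φ A x
    module Ψ = Potential (mirror-gap gap) (mirror-member x∈)
  open Potential gap x∈

  -- ψ i j is the minimum of A (suc e) - (sum from (i , j) on) over all walks
  -- from (i , j) to some (e , suc e), so Φ i j ≤ ψ i j + x i j.
  ψ : ℕ → ℕ → ℚ
  ψ i j = - φ (mirrorA n A) (mirror n x) (suc (n ∸ j)) (suc (n ∸ i))

  private
    value : ∀ {i j} → i ≤ n → j ≤ n → mirror n x (suc (n ∸ j)) (suc (n ∸ i)) ≡ x i j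
    value i≤n j≤n = cong₂ x (m∸[m∸n]≡n i≤n) (m∸[m∸n]≡n j≤n)

    above : ∀ {i j} → i < j → j ≤ n → suc (n ∸ j) < suc (n ∸ i)
    above i<j j≤n = s≤s (∸-monoʳ-< i<j j≤n)

    predecessor : ∀ {i} → i < n → n ∸ i ≡ suc (n ∸ suc i)
    predecessor {i} i<n = sym (trans (sym (+-∸-assoc 1 i<n)) refl)

    turn : ∀ {p q y r} → p + y ℚ.≤ q → y ≡ r → - q + r ℚ.≤ - p
    turn {p} {q} {y} h refl = ≤-by (0≤- h) (((∀ p q y → - q + y + (q - (p + y)) ≡ - p) ∋ solve-∀ ℚ-ring) p q y)

  ψ-right : ∀ {i j} → suc i < j → j ≤ n → ψ i j + x i j ℚ.≤ ψ (suc i) j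
  ψ-right {i} {j} h j≤n = turn
      (ℚP.≤-trans (ℚP.≤-reflexive (cong (λ k → φ (mirrorA n A) (mirror n x) (suc (n ∸ j)) k + mirror n x (suc (n ∸ j)) (suc (n ∸ i))) (sym (predecessor i<n))))
        (Ψ.from-left (n ∸ j) (n ∸ i) (above (<⇒≤ h) j≤n)))
      (value (<⇒≤ i<n) j≤n)
    where
    i<n : i < n
    i<n = <-trans (n<1+n i) (<-≤-trans h j≤n)

  ψ-up : ∀ {i j} → i < j → suc j ≤ n → ψ i j + x i j ℚ.≤ ψ i (suc j)
  ψ-up {i} {j} h j<n = turn
      (ℚP.≤-trans (ℚP.≤-reflexive (cong (λ k → φ (mirrorA n A) (mirror n x) k (suc (n ∸ i)) + mirror n x (suc (n ∸ j)) (suc (n ∸ i))) (sym (predecessor j<n))))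
        (Ψ.from-below (n ∸ j) (n ∸ i) (above h (<⇒≤ j<n))))
      (value (<⇒≤ (<-trans h j<n)) (<⇒≤ j<n))

  ψ-end : ∀ {e} → suc e ≤ n → ψ e (suc e) + x e (suc e) ℚ.≤ A (suc e)
  ψ-end {e} e<n = ℚP.≤-trans (turn (Ψ.from-left (n ∸ suc e) (n ∸ e) (above (n<1+n e) e<n)) (value (<⇒≤ e<n) e<n))
    (ℚP.≤-reflexive (trans (cong -_ (trans
        (cong (φ (mirrorA n A) (mirror n x) (suc (n ∸ suc e))) (predecessor e<n))
        (trans (φ-diagonal (mirrorA n A) (mirror n x) (suc (n ∸ suc e)) (s≤s z≤n))
          (cong (λ k → - A k) (m∸[m∸n]≡n e<n)))))
      (((∀ a → - - a ≡ a) ∋ solve-∀ ℚ-ring) (A (suc e)))))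

  -- Every positive coordinate of a vertex lies on a tight walk.
  saturated : ∀ {p q} → Valid n p q → 0ℚ ℚ.< x p q → ψ p q + x p q ℚ.≤ Φ p q
  saturated {p} {q} valid x>0 with ψ p q + x p q ℚP.≤? Φ p q
  ... | yes h = h
  ... | no ¬h = ⊥-elim (1≢0 (trans (sym (ind-at {p} {q} {p} {q} refl refl))
      (rigid {A = A} {v = x} vertex (ind p q) ε>0 positive slack p q valid)))
    where
    -- The slack common to all walks through (p , q) is δ, as Φ bounds them up to that point and ψ
    -- from there on. Taking ε below x p q as well lets this coordinate decrease.
    δ ε : ℚ
    δ = ψ p q + x p q - Φ p q
    ε = δ ℚ.⊓ x p q
    δ>0 : 0ℚ ℚ.< δ
    δ>0 = 0<- (ℚP.≰⇒> ¬h)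
    ε>0 : 0ℚ ℚ.< ε
    ε>0 = min>0 δ>0 x>0
    1≢0 : 1ℚ ≡ 0ℚ → ⊥
    1≢0 ()
    positive : ∀ i j → Valid n i j → ε ℚ.≤ x i j ⊎ ind p q i j ≡ 0ℚ
    positive i j _ = [ (λ { (_ , refl , refl) → inj₁ (ℚP.p⊓q≤q δ (x p q)) }) , (λ (e , _) → inj₂ e) ]′ (ind-cases p q i j)

    -- Before (p , q) a walk does not see the moved coordinate; afterwards it stays δ behind ψ + x,
    -- and this is passed on from step to step up to A (suc e).
    Claim : ∀ {s i j} → Walk s i j → Set
    Claim {s} {i} {j} w = total (ind p q) w ≡ 0ℚ ⊎ (i < j × total x w + A s + δ ℚ.≤ ψ i j + x i j)

    reach : ∀ {s i j} → i ≡ p → j ≡ q → 1 ≤ s → j ≤ n → i < j → (w : Walk s i j) → Claim w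
    reach {s} refl refl 1≤s j≤n i<j w = inj₂ (i<j , ≤-by (0≤- (walk≤φ 1≤s j≤n w))
      (((∀ T a r f → T + a + (r - f) + (f - (T + a)) ≡ r) ∋ solve-∀ ℚ-ring) (total x w) (A s) (ψ p q + x p q) (Φ p q)))

    carry : ∀ {T X a r r′} → T + a + δ ℚ.≤ r → r ℚ.≤ r′ → T + X + a + δ ℚ.≤ r′ + X
    carry {T} {X} {a} {r} {r′} h k = ≤-by (0≤- h ⊹ 0≤- k)
      (((∀ T X a d r r′ → T + X + a + d + ((r - (T + a + d)) + (r′ - r)) ≡ r′ + X) ∋ solve-∀ ℚ-ring) T X a δ r r′)

    add-zero : ∀ {a b} → a ≡ 0ℚ → b ≡ 0ℚ → a + b ≡ 0ℚ
    add-zero refl refl = ℚP.+-identityʳ 0ℚ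

    claim : ∀ {s i j} → 1 ≤ s → j ≤ n → (w : Walk s i j) → Claim w
    claim 1≤s j≤n start = inj₁ refl
    claim {s} 1≤s j≤n (right {i} {j} w h) = [ (λ (_ , e , f) → reach e f 1≤s j≤n h (right w h))
      , (λ (z , _) → [ (λ t → inj₁ (add-zero t z)) , (λ (i<j , c) → inj₂ (h , carry {total x w} {x (suc i) j} {A s} c (ψ-right h j≤n))) ]′ (claim 1≤s j≤n w)) ]′
      (ind-cases p q (suc i) j)
    claim {s} 1≤s j≤n (up {i} {j} w) = [ (λ (_ , e , f) → reach e f 1≤s j≤n (s≤s (walk-i≤j w)) (up w))
      , (λ (z , _) → [ (λ t → inj₁ (add-zero t z)) , (λ (i<j , c) → inj₂ (s≤s (walk-i≤j w) , carry {total x w} {x i (suc j)} {A s} c (ψ-up i<j j≤n))) ]′ (claim 1≤s (<⇒≤ j≤n) w)) ]′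
      (ind-cases p q i (suc j))

    slack : ∀ {s e} → 1 ≤ s → suc e ≤ n → (w : Walk s e (suc e)) → total x w + A s + ε ℚ.≤ A (suc e) ⊎ total (ind p q) w ≡ 0ℚ
    slack {s} {e} 1≤s e<n w = [ inj₂ , (λ (_ , c) → inj₁ (ℚP.≤-trans
      (≤-by (0≤- (ℚP.p⊓q≤p δ (x p q)) ⊹ 0≤- c) (((∀ T d ε r → T + ε + ((d - ε) + (r - (T + d))) ≡ r) ∋ solve-∀ ℚ-ring) (total x w + A s) δ ε (ψ e (suc e) + x e (suc e))))
      (ψ-end e<n))) ]′ (claim 1≤s e<n w)

  -- A walk attaining the reflected maximum, read backwards, is a continuation realising ψ.
  -- Saturation gives one inequality; the other is the bound for a maximal walk followed by this
  -- continuation.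
  tight-tail : ∀ {i j} → Valid n i j → 0ℚ ℚ.< x i j →
    Σ[ e ∈ ℕ ] (suc e ≤ n × Σ[ τ ∈ Tail e i j ] Φ i j + tailSum x τ ≡ A (suc e))
  tight-tail {i} {j} valid@(1≤i , i<j , j≤n) x>0 =
    let i≤n = <⇒≤ (<-≤-trans i<j j≤n)
        t , 1≤t , g , g≡ = Ψ.attained (suc (n ∸ j)) (suc (n ∸ i)) (s≤s z≤n) (<⇒≤ (above i<j j≤n)) (≤-trans (s≤s (∸-monoʳ-≤ n 1≤i)) (≤-reflexive (sym (predecessor (≤-trans 1≤i i≤n)))))
        e , r , τ , τ≡ = toTail {n} {t} {i} {j} x g (above i<j j≤n) (trans (+-suc i (n ∸ i)) (cong suc (m+[n∸m]≡n i≤n))) (trans (+-suc j (n ∸ j)) (cong suc (m+[n∸m]≡n j≤n)))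
        e<n : suc e ≤ n
        e<n = ≤-pred (≤-trans (≤-trans (≤-reflexive (+-comm 1 (suc e))) (+-monoʳ-≤ (suc e) 1≤t)) (≤-reflexive r))
        s , 1≤s , w , w≡ = attained i j 1≤i (<⇒≤ i<j) j≤n
        ψ≡ : ψ i j ≡ A (suc e) - (tailSum x τ + x i j)
        ψ≡ = trans (cong -_ (trans (sym g≡) (cong₂ _+_ (sym τ≡) (mirrorA-at A r))))
          (((∀ a T → - (T + - a) ≡ a - T) ∋ solve-∀ ℚ-ring) (A (suc e)) (tailSum x τ + x i j))
    in e , e<n , τ , ℚP.≤-antisym
        (ℚP.≤-trans (ℚP.≤-reflexive (trans (cong (_+ tailSum x τ) (sym w≡)) (trans
            (((∀ T a S → T + a + S ≡ T + S + a) ∋ solve-∀ ℚ-ring) (total x w) (A s) (tailSum x τ))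
            (cong (_+ A s) (sym (total-append x w τ))))))
          (proj₂ x∈ 1≤s e<n (append w τ)))
        (≤-by (0≤- (saturated valid x>0)) (trans (cong (λ p → A (suc e) + (Φ i j - (p + x i j))) ψ≡)
          (((∀ a f S X → a + (f - (a - (S + X) + X)) ≡ f + S) ∋ solve-∀ ℚ-ring) (A (suc e)) (Φ i j) (tailSum x τ) (x i j))))

module Row {n A x} (gap : Gap n A) (vertex : Vertex n A x) (simplicial : Simplicial n A x) where

  private
    x∈ = proj₁ vertex
    Φ = φ A x
  open Potential gap x∈
  open Through gap vertex using (tight-tail)
  open Corner gap x∈ simplicial using (no-corner)

  private
    -- The point moves left along row i while the tight tail grows by `up` at its front. If the
    -- maximum came only from row i - 1, a positive coordinate would contradict `left-dominates`; at
    -- a zero the tail begins upwards by hypothesis, so a tight walk would turn right-then-up there,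
    -- against `no-corner`.
    descend : ∀ {e i} j → 1 ≤ i → i ≤ j → j ≤ n → suc e ≤ n → (τ : Tail e i j) → Φ i j + tailSum x τ ≡ A (suc e) →
      0ℚ ℚ.< x i j ⊎ (Σ[ σ ∈ Tail e i (suc j) ] τ ≡ up σ) → Φ i j ℚ.≤ A i + (row x i j - row x i i)
    descend zero 1≤i i≤0 _ _ _ _ _ = ⊥-elim (<⇒≱ 1≤i i≤0)
    descend {e} {suc i} (suc j) 1≤i i≤j j≤n e<n τ tight first = [ off , (λ { refl → ℚP.≤-reflexive (trans (φ-diagonal A x (suc i) 1≤i)
        (((∀ a r → a ≡ a + (r - r)) ∋ solve-∀ ℚ-ring) (A (suc i)) (row x (suc i) (suc i)))) }) ]′ (m≤n⇒m<n∨m≡n i≤j)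
      where
      X = x (suc i) (suc j)
      Goal = Φ (suc i) (suc j) ℚ.≤ A (suc i) + (row x (suc i) (suc j) - row x (suc i) (suc i))

      from-row : suc i < suc j → Φ i (suc j) ℚ.≤ Φ (suc i) j → Goal
      from-row h le = ℚP.≤-trans (ℚP.≤-reflexive (step-left i j h le)) (≤-by
        (0≤- (descend j 1≤i (≤-pred h) (<⇒≤ j≤n) e<n (up τ)
          (trans (sym (ℚP.+-assoc (Φ (suc i) j) X (tailSum x τ))) (trans (cong (_+ tailSum x τ) (sym (step-left i j h le))) tight))
          (inj₂ (τ , refl))))
        (((∀ f X a r s → f + X + ((a + (r - s)) - f) ≡ a + ((r + X) - s)) ∋ solve-∀ ℚ-ring) (Φ (suc i) j) X (A (suc i)) (row x (suc i) j) (row x (suc i) (suc i))))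

      corner : suc i < suc j → ∀ k → k ≡ i → Φ (suc i) j ℚ.< Φ k (suc j) → X ≡ 0ℚ → Σ[ σ ∈ Tail e (suc i) (suc (suc j)) ] τ ≡ up σ → ⊥
      corner h zero refl lt _ _ = ≤⇒<⇒⊥ (A≤φ 1≤i (≤-pred h) (<⇒≤ j≤n)) (ℚP.<-≤-trans lt (ℚP.≤-reflexive (φ-zero A x (suc j))))
      corner h (suc k) refl lt X≡0 (σ , refl) =
        let s , 1≤s , w , w≡ = attained i (suc j) (s≤s z≤n) (<⇒≤ (<⇒≤ h)) j≤n
            Y = x (suc i) (suc (suc j))
        in no-corner w h σ 1≤s e<n X≡0 (trans (cong (_+ A s) (total-append x (up (right w h)) σ))
             (trans (((∀ T a b S c → T + a + b + S + c ≡ (T + c) + a + (b + S)) ∋ solve-∀ ℚ-ring) (total x w) X Y (tailSum x σ) (A s))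
               (trans (cong (λ f → f + X + (Y + tailSum x σ)) w≡)
                 (trans (cong (_+ (Y + tailSum x σ)) (sym (step-below i j h (ℚP.<⇒≤ lt)))) tight))))

      off : suc i < suc j → Goal
      off h with Φ i (suc j) ℚP.≤? Φ (suc i) j
      ... | yes le = from-row h le
      ... | no ¬le = ⊥-elim ([ (λ X≡0 → [ (λ X>0 → ℚP.<-irrefl (sym X≡0) X>0) , corner h i refl (ℚP.≰⇒> ¬le) X≡0 ]′ first)
                             , (λ X>0 → ¬le (left-dominates gap vertex (1≤i , h , j≤n) X>0)) ]′
                             (zero⊎positive (proj₁ x∈ (suc i) (suc j) (1≤i , h , j≤n))))

  row-tight : ∀ {i j} → Valid n i j → 0ℚ ℚ.< x i j → Φ i j ℚ.≤ A i + (row x i j - row x i i)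
  row-tight {i} {j} valid@(1≤i , i<j , j≤n) x>0 = let e , e<n , τ , tight = tight-tail valid x>0
    in descend j 1≤i (<⇒≤ i<j) j≤n e<n τ tight (inj₁ x>0)

-- The term x i (suc e) is the corner, which the reflected row counts and the difference of column
-- sums does not.
mirror-row : ∀ {n} x {e j′} → suc e ℕ.+ j′ ≡ suc n → ∀ d {i} → i ℕ.+ d ≡ e →
  row (mirror n x) j′ (suc d ℕ.+ j′) - row (mirror n x) j′ j′ ≡ (col x (suc e) e - col x (suc e) i) + x i (suc e)
mirror-row {n} x {e} {j′} p zero {i} q = trans
    (((∀ r y → (r + y) - r ≡ y) ∋ solve-∀ ℚ-ring) (row (mirror n x) j′ j′) (mirror n x j′ (suc j′)))
    (trans (mirror-at x (trans (+-suc i j′) (trans (cong (λ k → suc k ℕ.+ j′) i≡e) p)) p)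
      (trans (((∀ c y → y ≡ (c - c) + y) ∋ solve-∀ ℚ-ring) (col x (suc e) i) (x i (suc e)))
        (cong (λ k → (col x (suc e) k - col x (suc e) i) + x i (suc e)) i≡e)))
  where
  i≡e : i ≡ e
  i≡e = trans (sym (+-identityʳ i)) q
mirror-row {n} x {e} {j′} p (suc d) {i} q = trans
    (((∀ r y s → (r + y) - s ≡ (r - s) + y) ∋ solve-∀ ℚ-ring) (row (mirror n x) j′ (suc d ℕ.+ j′)) (mirror n x j′ (suc (suc d) ℕ.+ j′)) (row (mirror n x) j′ j′))
    (cong₂ _+_
      (trans (mirror-row x p d {suc i} (trans (sym (+-suc i d)) q))
        (((∀ c c′ y → (c - (c′ + y)) + y ≡ c - c′) ∋ solve-∀ ℚ-ring) (col x (suc e) e) (col x (suc e) i) (x (suc i) (suc e))))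
      (mirror-at x (trans (sym (+-assoc i (suc (suc d)) j′)) (trans (cong (ℕ._+ j′) (trans (+-suc i (suc d)) (cong suc q))) p)) p))

-- `row-tight` bounds Φ by the row of the hook, and its reflection bounds - ψ by the column. Both
-- count the corner; `saturated`, which is ψ + x ≤ Φ, joins them and removes one copy.
positive⇒hook-tight : ∀ {n A x} → Gap n A → Vertex n A x → Simplicial n A x → ∀ {i e} (h : i ≤ e) → Valid n i (suc e) →
  0ℚ ℚ.< x i (suc e) → total x (hook i e h) + A i ≡ A (suc e)
positive⇒hook-tight {n} {A} {x} gap vertex simplicial {i} {e} h valid@(1≤i , i<j , j≤n) x>0 =
    ℚP.≤-antisym (proj₂ (proj₁ vertex) 1≤i j≤n (hook i e h))
      (ℚP.≤-trans (≤-by (0≤- (Through.saturated gap vertex valid x>0) ⊹ 0≤- (Row.row-tight gap vertex simplicial valid x>0) ⊹ 0≤- column)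
        (((∀ a b f F r c X → b + ((f - (- F + X)) + ((a + r) - f) + ((- b + (c + X)) - F)) ≡ r + c + a) ∋ solve-∀ ℚ-ring)
          (A i) (A (suc e)) (φ A x i (suc e)) (φ A* x* j′ i′) (row x i (suc e) - row x i i) (col x (suc e) e - col x (suc e) i) (x i (suc e))))
        (ℚP.≤-reflexive (cong (_+ A i) (sym (total-hook x i e h)))))
  where
  A* = mirrorA n A
  x* = mirror n x
  j′ i′ : ℕ
  j′ = suc (n ∸ suc e)
  i′ = suc (n ∸ i)
  i≤n : i ≤ n
  i≤n = ≤-trans h (<⇒≤ j≤n)
  j+j′ : suc e ℕ.+ j′ ≡ suc n
  j+j′ = trans (+-suc (suc e) (n ∸ suc e)) (cong suc (m+[n∸m]≡n j≤n))
  i+i′ : i ℕ.+ i′ ≡ suc n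
  i+i′ = trans (+-suc i (n ∸ i)) (cong suc (m+[n∸m]≡n i≤n))
  i′≡ : i′ ≡ suc (e ∸ i) ℕ.+ j′
  i′≡ = +-cancelˡ-≡ i i′ (suc (e ∸ i) ℕ.+ j′) (trans i+i′ (trans (sym j+j′)
    (trans (cong (λ k → suc k ℕ.+ j′) (sym (m+[n∸m]≡n h))) (trans (cong (ℕ._+ j′) (sym (+-suc i (e ∸ i)))) (+-assoc i (suc (e ∸ i)) j′)))))
  valid′ : Valid n j′ i′
  valid′ = s≤s z≤n , s≤s (∸-monoʳ-< i<j j≤n) , ≤-trans (s≤s (∸-monoʳ-≤ n 1≤i)) (≤-reflexive (m+[n∸m]≡n (≤-trans 1≤i i≤n)))
  column : φ A* x* j′ i′ ℚ.≤ - A (suc e) + ((col x (suc e) e - col x (suc e) i) + x i (suc e))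
  column = ℚP.≤-trans
    (Row.row-tight (mirror-gap gap) (mirror-vertex vertex) (mirror-simplicial {n} {A} {x} simplicial) valid′ (ℚP.<-≤-trans x>0 (ℚP.≤-reflexive (sym (mirror-at x i+i′ j+j′)))))
    (ℚP.≤-reflexive (cong₂ _+_ (mirrorA-at A j+j′)
      (trans (cong (λ k → row x* j′ k - row x* j′ j′) i′≡) (mirror-row x j+j′ (e ∸ i) (m+[n∸m]≡n h)))))

-- The points x(E) as solutions of a triangular system.

S-++ : ∀ x d d′ → S x (d ++ d′) ≡ S x d + S x d′
S-++ x []            d′ = sym (ℚP.+-identityˡ (S x d′))
S-++ x ((i , j) ∷ d) d′ = trans (cong (x i j +_) (S-++ x d d′)) (sym (ℚP.+-assoc (x i j) (S x d) (S x d′)))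

S-row : ∀ x i l len (f : ℕ → ℕ) → (∀ t → f t ≡ suc (l ℕ.+ t)) →
  S x (map (λ k → (i , k)) (applyUpTo f len)) + row x i l ≡ row x i (l ℕ.+ len)
S-row x i l zero f eq = trans (ℚP.+-identityˡ (row x i l)) (cong (row x i) (sym (+-identityʳ l)))
S-row x i l (suc len) f eq = trans
  (((∀ a b r → a + b + r ≡ b + (r + a)) ∋ solve-∀ ℚ-ring) (x i (f 0)) rest (row x i l))
  (trans (cong (λ k → rest + (row x i l + x i k)) (trans (eq 0) (cong suc (+-identityʳ l))))
    (trans (S-row x i (suc l) len (f ∘ suc) (λ t → trans (eq (suc t)) (cong suc (+-suc l t))))
      (cong (row x i) (sym (+-suc l len)))))
  where
  rest = S x (map (λ k → (i , k)) (applyUpTo (f ∘ suc) len))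

S-col : ∀ x j l len (f : ℕ → ℕ) → (∀ t → f t ≡ suc (l ℕ.+ t)) →
  S x (map (λ k → (k , j)) (applyUpTo f len)) + col x j l ≡ col x j (l ℕ.+ len)
S-col x j l zero f eq = trans (ℚP.+-identityˡ (col x j l)) (cong (col x j) (sym (+-identityʳ l)))
S-col x j l (suc len) f eq = trans
  (((∀ a b r → a + b + r ≡ b + (r + a)) ∋ solve-∀ ℚ-ring) (x (f 0) j) rest (col x j l))
  (trans (cong (λ k → rest + (col x j l + x k j)) (trans (eq 0) (cong suc (+-identityʳ l))))
    (trans (S-col x j (suc l) len (f ∘ suc) (λ t → trans (eq (suc t)) (cong suc (+-suc l t))))
      (cong (col x j) (sym (+-suc l len)))))
  where
  rest = S x (map (λ k → (k , j)) (applyUpTo (f ∘ suc) len))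

S-dpath : ∀ x i e → i ≤ e → S x (dpath i (suc e)) ≡ hookSum x i e
S-dpath x i e h = trans (S-++ x (map (λ k → (i , k)) (range (suc i) (suc (suc e)))) (map (λ k → (k , suc e)) (range (suc i) (suc e))))
    (cong₂ _+_
      (isolate (S x (map (λ k → (i , k)) (range (suc i) (suc (suc e))))) (row x i i) (trans (S-row x i i (suc e ∸ i) (λ t → suc i ℕ.+ t) (λ _ → refl)) (cong (row x i) (m+[n∸m]≡n (m≤n⇒m≤1+n h)))))
      (isolate (S x (map (λ k → (k , suc e)) (range (suc i) (suc e)))) (col x (suc e) i) (trans (S-col x (suc e) i (e ∸ i) (λ t → suc i ℕ.+ t) (λ _ → refl)) (cong (col x (suc e)) (m+[n∸m]≡n h)))))
  where
  isolate : ∀ a b {c} → a + b ≡ c → a ≡ c - b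
  isolate a b refl = ((∀ a b → a ≡ (a + b) - b) ∋ solve-∀ ℚ-ring) a b

HasCorners : ℕ → (ℕ → ℚ) → SegSet → Point → Set
HasCorners n A E x = ∀ i e → i ≤ e → Valid n i (suc e) →
  (E i (suc e) ≡ false → x i (suc e) ≡ 0ℚ) × (E i (suc e) ≡ true → hookSum x i e + A i ≡ A (suc e))

IsXE⇒HasCorners : ∀ {n a E x} → IsXE n a E x → HasCorners n (potential a) E x
IsXE⇒HasCorners {n} {a} {E} {x} h i e i≤e valid = proj₁ (h i (suc e) valid) , λ t →
  trans (cong (_+ potential a i) (trans (sym (S-dpath x i e i≤e)) (proj₂ (h i (suc e) valid) t))) (sumA-potential a (m≤n⇒m≤1+n i≤e))

HasCorners⇒IsXE : ∀ {n a E x} → HasCorners n (potential a) E x → IsXE n a E x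
HasCorners⇒IsXE {n} {a} {E} {x} h i (suc e) valid@(_ , s≤s i≤e , _) = proj₁ (h i e i≤e valid) , λ t →
  trans (S-dpath x i e i≤e) (same-total (proj₂ (h i e i≤e valid) t) (sumA-potential a (m≤n⇒m≤1+n i≤e)))

-- The functionals whose values 0 and A i - A (suc e) characterise x(E); they
-- are the inequalities active at x(E), written as lower bounds.
active : SegSet → Point → ℕ → ℕ → ℚ
active E x i e = if E i (suc e) then - hookSum x i e else x i (suc e)

row-cong : ∀ {x y : Point} {i} j → i ≤ j → (∀ k → i < k → k ≤ j → x i k ≡ y i k) → row x i j - row x i i ≡ row y i j - row y i i
row-cong {x} {y} {i} zero z≤n h = refl
row-cong {x} {y} {i} (suc j) i≤j h = [ (λ i<j → trans
    (((∀ r p s → (r + p) - s ≡ (r - s) + p) ∋ solve-∀ ℚ-ring) (row x i j) (x i (suc j)) (row x i i))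
    (trans (cong₂ _+_ (row-cong j (≤-pred i<j) (λ k a b → h k a (m≤n⇒m≤1+n b))) (h (suc j) i<j ≤-refl))
      (((∀ r p s → (r - s) + p ≡ (r + p) - s) ∋ solve-∀ ℚ-ring) (row y i j) (y i (suc j)) (row y i i))))
  , (λ { refl → trans (ℚP.+-inverseʳ (row x i i)) (sym (ℚP.+-inverseʳ (row y i i))) }) ]′ (m≤n⇒m<n∨m≡n i≤j)

col-cong : ∀ {x y : Point} {j i} e → i ≤ e → (∀ k → i < k → k ≤ e → x k j ≡ y k j) → col x j e - col x j i ≡ col y j e - col y j i
col-cong {x} {y} {j} {i} zero z≤n h = refl
col-cong {x} {y} {j} {i} (suc e) i≤e h = [ (λ i<e → trans
    (((∀ r p s → (r + p) - s ≡ (r - s) + p) ∋ solve-∀ ℚ-ring) (col x j e) (x (suc e) j) (col x j i))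
    (trans (cong₂ _+_ (col-cong e (≤-pred i<e) (λ k a b → h k a (m≤n⇒m≤1+n b))) (h (suc e) i<e ≤-refl))
      (((∀ r p s → (r - s) + p ≡ (r + p) - s) ∋ solve-∀ ℚ-ring) (col y j e) (y (suc e) j) (col y j i))))
  , (λ { refl → trans (ℚP.+-inverseʳ (col x j i)) (sym (ℚP.+-inverseʳ (col y j i))) }) ]′ (m≤n⇒m<n∨m≡n i≤e)

-- Apart from its corner, a hook consists of strictly shorter segments. So the active system is
-- triangular with diagonal entries 1 and -1, solvable over the integers.
hookSum-split : ∀ x i e → hookSum x i e ≡ x i (suc e) + ((row x i e - row x i i) + (col x (suc e) e - col x (suc e) i))
hookSum-split x i e = ((∀ r p s c → ((r + p) - s) + c ≡ p + ((r - s) + c)) ∋ solve-∀ ℚ-ring) (row x i e) (x i (suc e)) (row x i i) (col x (suc e) e - col x (suc e) i)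

-- The system is triangular with respect to the length of the segments.
active-unique : ∀ {n} E {x y} → (∀ i e → i ≤ e → Valid n i (suc e) → active E x i e ≡ active E y i e) → x ≈[ n ] y
active-unique {n} E {x} {y} eq i (suc e) valid@(_ , s≤s i≤e , _) = go (suc (e ∸ i)) i e ≤-refl i≤e valid
  where
  go : ∀ N i e → e ∸ i < N → i ≤ e → Valid n i (suc e) → x i (suc e) ≡ y i (suc e)
  go (suc N) i e (s≤s d≤N) i≤e valid@(1≤i , i<j , j≤n) = decide (E i (suc e)) refl
    where
    row≡ : row x i e - row x i i ≡ row y i e - row y i i
    row≡ = row-cong e i≤e λ { (suc k) (s≤s i≤k) k<e → go N i k (<-≤-trans (∸-monoˡ-< k<e i≤k) d≤N) i≤k
      (1≤i , s≤s i≤k , ≤-trans (m≤n⇒m≤1+n k<e) j≤n) }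
    col≡ : col x (suc e) e - col x (suc e) i ≡ col y (suc e) e - col y (suc e) i
    col≡ = col-cong e i≤e λ k i<k k≤e → go N k e (<-≤-trans (∸-monoʳ-< i<k k≤e) d≤N) k≤e
      (≤-trans 1≤i (<⇒≤ i<k) , s≤s k≤e , j≤n)
    decide : ∀ b → E i (suc e) ≡ b → x i (suc e) ≡ y i (suc e)
    decide false E≡ = subst (λ b → (if b then - hookSum x i e else x i (suc e)) ≡ (if b then - hookSum y i e else y i (suc e))) E≡ (eq i e i≤e valid)
    decide true E≡ = trans (((∀ p q → p ≡ - - (p + q) - q) ∋ solve-∀ ℚ-ring) (x i (suc e)) R)
      (trans (cong₂ (λ h r → - h - r) hooks (cong₂ _+_ row≡ col≡)) (((∀ p q → - - (p + q) - q ≡ p) ∋ solve-∀ ℚ-ring) (y i (suc e)) R′))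
      where
      R = (row x i e - row x i i) + (col x (suc e) e - col x (suc e) i)
      R′ = (row y i e - row y i i) + (col y (suc e) e - col y (suc e) i)
      hooks : - (x i (suc e) + R) ≡ - (y i (suc e) + R′)
      hooks = trans (cong -_ (sym (hookSum-split x i e))) (trans
        (subst (λ b → (if b then - hookSum x i e else x i (suc e)) ≡ (if b then - hookSum y i e else y i (suc e))) E≡ (eq i e i≤e valid))
        (cong -_ (hookSum-split y i e)))

-- The solution of the system with right-hand side b: z k i is its value at
-- (i , suc (k + i)), and ρ, γ are the row and column sums found so far.
module Solve (E : SegSet) (b : ℕ → ℕ → ℤ) where
  mutual
    z : ℕ → ℕ → ℤ
    -- On E the active functional is - (z + ρ + γ), and it is to equal b.
    z k i = if E i (suc (k ℕ.+ i)) then (ℤ.- b i (k ℕ.+ i)) ℤ.+ (ℤ.- (ρ k i ℤ.+ γ k (suc i))) else b i (k ℕ.+ i)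

    ρ γ : ℕ → ℕ → ℤ
    ρ zero    i = ℤ.0ℤ
    ρ (suc k) i = ρ k i ℤ.+ z k i
    γ zero    i = ℤ.0ℤ
    γ (suc k) i = z k i ℤ.+ γ k (suc i)

  solution : LVec
  solution i j = z (j ∸ suc i) i

  private
    x = toPoint solution

    at : ∀ {k i e} → k ℕ.+ i ≡ e → x i (suc e) ≡ ℤtoℚ (z k i)
    at {k} {i} refl = cong (λ k → ℤtoℚ (z k i)) (m+n∸n≡m k i)

    row-ρ : ∀ k i → row x i (k ℕ.+ i) - row x i i ≡ ℤtoℚ (ρ k i)
    row-ρ zero i = ℚP.+-inverseʳ (row x i i)
    row-ρ (suc k) i = trans (((∀ r p s → (r + p) - s ≡ (r - s) + p) ∋ solve-∀ ℚ-ring) (row x i (k ℕ.+ i)) (x i (suc (k ℕ.+ i))) (row x i i))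
      (trans (cong₂ _+_ (row-ρ k i) (at {k} {i} refl)) (sym (ℤtoℚ-+ (ρ k i) (z k i))))

    col-γ : ∀ k i e → k ℕ.+ i ≡ e → col x (suc e) e - col x (suc e) i ≡ ℤtoℚ (γ k (suc i))
    col-γ zero i e refl = ℚP.+-inverseʳ (col x (suc e) i)
    col-γ (suc k) i e eq = trans (((∀ c d p → c - d ≡ p + (c - (d + p))) ∋ solve-∀ ℚ-ring) (col x (suc e) e) (col x (suc e) i) (x (suc i) (suc e)))
      (trans (cong₂ _+_ (at {k} {suc i} eq′) (col-γ k (suc i) e eq′)) (sym (ℤtoℚ-+ (z k (suc i)) (γ k (suc (suc i))))))
      where
      eq′ : k ℕ.+ suc i ≡ e
      eq′ = trans (+-suc k i) eq

  active-solution : ∀ i e → i ≤ e → active E x i e ≡ ℤtoℚ (b i e)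
  active-solution i e i≤e = subst (λ e → active E x i e ≡ ℤtoℚ (b i e)) (m∸n+n≡m i≤e) (decide (E i (suc (k ℕ.+ i))) refl)
    where
    k = e ∸ i
    rest = ρ k i ℤ.+ γ k (suc i)
    z≡ : ∀ {c} → E i (suc (k ℕ.+ i)) ≡ c → z k i ≡ (if c then (ℤ.- b i (k ℕ.+ i)) ℤ.+ (ℤ.- rest) else b i (k ℕ.+ i))
    z≡ e = cong (λ c → if c then (ℤ.- b i (k ℕ.+ i)) ℤ.+ (ℤ.- rest) else b i (k ℕ.+ i)) e
    decide : ∀ c → E i (suc (k ℕ.+ i)) ≡ c → active E x i (k ℕ.+ i) ≡ ℤtoℚ (b i (k ℕ.+ i))
    decide false E≡ = trans (cong (λ c → if c then - hookSum x i (k ℕ.+ i) else x i (suc (k ℕ.+ i))) E≡)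
      (trans (at {k} {i} refl) (cong ℤtoℚ (z≡ E≡)))
    decide true E≡ = trans (cong (λ c → if c then - hookSum x i (k ℕ.+ i) else x i (suc (k ℕ.+ i))) E≡)
      (trans (cong -_ (trans (hookSum-split x i (k ℕ.+ i)) (cong₂ _+_
          (trans (at {k} {i} refl) (trans (cong ℤtoℚ (z≡ E≡)) (trans (ℤtoℚ-+ (ℤ.- b i (k ℕ.+ i)) (ℤ.- rest)) (cong₂ _+_ (ℤtoℚ-neg (b i (k ℕ.+ i))) (ℤtoℚ-neg rest)))))
          (trans (cong₂ _+_ (row-ρ k i) (col-γ k i (k ℕ.+ i) refl)) (sym (ℤtoℚ-+ (ρ k i) (γ k (suc i))))))))
        (((∀ b r → - ((- b + - r) + r) ≡ b) ∋ solve-∀ ℚ-ring) (ℤtoℚ (b i (k ℕ.+ i))) (ℤtoℚ rest)))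

active⇒HasCorners : ∀ {n A E x} → (∀ i e → i ≤ e → Valid n i (suc e) → active E x i e ≡ (if E i (suc e) then A i - A (suc e) else 0ℚ)) → HasCorners n A E x
active⇒HasCorners {n} {A} {E} {x} h i e i≤e valid =
    (λ f → subst (λ c → (if c then - hookSum x i e else x i (suc e)) ≡ (if c then A i - A (suc e) else 0ℚ)) f (h i e i≤e valid))
  , (λ t → trans (((∀ h a → h + a ≡ a - - h) ∋ solve-∀ ℚ-ring) (hookSum x i e) (A i))
      (trans (cong (λ p → A i - p) (subst (λ c → (if c then - hookSum x i e else x i (suc e)) ≡ (if c then A i - A (suc e) else 0ℚ)) t (h i e i≤e valid)))
        (((∀ a b → a - (a - b) ≡ b) ∋ solve-∀ ℚ-ring) (A i) (A (suc e)))))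

corner-point : ∀ n a E → Σ[ x ∈ Point ] HasCorners n (potential a) E x
corner-point n a E = toPoint (Solve.solution E target) , active⇒HasCorners {E = E} λ i e i≤e _ → trans (Solve.active-solution E target i e i≤e) (cast (E i (suc e)) i e)
  where
  value : Bool → ℕ → ℕ → ℤ
  value c i e = if c then (ℤ.+ prefix a i) ℤ.+ (ℤ.- (ℤ.+ prefix a (suc e))) else ℤ.0ℤ
  target : ℕ → ℕ → ℤ
  target i e = value (E i (suc e)) i e
  cast : ∀ c i e → ℤtoℚ (value c i e) ≡ (if c then potential a i - potential a (suc e) else 0ℚ)
  cast false i e = refl
  cast true i e = trans (ℤtoℚ-+ (ℤ.+ prefix a i) (ℤ.- (ℤ.+ prefix a (suc e)))) (cong (potential a i +_) (ℤtoℚ-neg (ℤ.+ prefix a (suc e))))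

-- Entries of x(E) for laminar E.

if-true : ∀ {X : Set} {c : Bool} {a b : X} → c ≡ true → (if c then a else b) ≡ a
if-true refl = refl

if-false : ∀ {X : Set} {c : Bool} {a b : X} → c ≡ false → (if c then a else b) ≡ b
if-false refl = refl

-- For laminar E the point x(E) has x_{i,j} = A (c (i+1, j)) - A (r (i, j-1)) at
-- [i , j] ∈ E, where A (r (i, j)) - A i and A j - A (c (i, j)) are its partial row
-- and column sums.  Below, r k i and c k i belong to the segment [i , k + i].
module Indices (E : SegSet) where
  mutual
    r c : ℕ → ℕ → ℕ
    r zero    i = i
    r (suc k) i = if E i (suc (k ℕ.+ i)) then c k (suc i) else r k i
    c zero    i = i
    c (suc k) i = if E i (suc (k ℕ.+ i)) then r k i else c k (suc i)

  RowFacts ColFacts : ℕ → ℕ → Set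
  RowFacts k i = i ≤ r k i × r k i ≤ k ℕ.+ i ×
    (r k i ≡ i ⊎ (∃ λ q → i < q × q ≤ k ℕ.+ i × E i q ≡ true × r k i ≤ q))
  ColFacts k i = i ≤ c k i × c k i ≤ k ℕ.+ i ×
    (c k i ≡ k ℕ.+ i ⊎ (∃ λ p → i ≤ p × p < k ℕ.+ i × E p (k ℕ.+ i) ≡ true × p ≤ c k i))

  module _ {n} (laminar : Laminar n E) where

    private
      -- In the main case r ≤ q for some [i , q] in E and p ≤ c for some [p , j] in E, where i < p
      -- and q < j. If p ≤ q, these two segments would cross; hence r ≤ q < p ≤ c.
      separated : ∀ {k i} → 1 ≤ i → suc (k ℕ.+ i) ≤ n → RowFacts k i → ColFacts k (suc i) → r k i < c k (suc i)
      separated {k} {i} 1≤i h (_ , r≤ , rw) (i<c , _ , cw) = cases rw cw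
        where
        j≡ = +-suc k i
        cases : r k i ≡ i ⊎ (∃ λ q → i < q × q ≤ k ℕ.+ i × E i q ≡ true × r k i ≤ q) →
          c k (suc i) ≡ k ℕ.+ suc i ⊎ (∃ λ p → suc i ≤ p × p < k ℕ.+ suc i × E p (k ℕ.+ suc i) ≡ true × p ≤ c k (suc i)) → r k i < c k (suc i)
        cases (inj₁ e) _ = ≤-trans (s≤s (≤-reflexive e)) i<c
        cases (inj₂ _) (inj₁ e) = ≤-trans (s≤s r≤) (≤-reflexive (trans (sym j≡) (sym e)))
        cases (inj₂ (q , i<q , q≤ , Eq , r≤q)) (inj₂ (p , i<p , p< , Ep , p≤c)) with q ℕ.<? p
        ... | yes q<p = ≤-trans (s≤s r≤q) (≤-trans q<p p≤c)
        ... | no q≮p = [ (λ (p≤i , _) → ⊥-elim (<⇒≱ i<p p≤i))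
                       , (λ (_ , j≤q) → ⊥-elim (<-irrefl refl (≤-trans (≤-reflexive (sym j≡)) (≤-trans j≤q q≤)))) ]′
                       (laminar i q p (k ℕ.+ suc i)
                         (1≤i , i<q , ≤-trans q≤ (<⇒≤ h)) (≤-trans (s≤s z≤n) i<p , p< , ≤-trans (≤-reflexive j≡) h)
                         Eq Ep (≮⇒≥ q≮p , ≤-trans (m≤n⇒m≤1+n (m≤n+m i k)) (≤-reflexive (sym j≡))))

      facts : ∀ k i → 1 ≤ i → k ℕ.+ i ≤ n → RowFacts k i × ColFacts k i
      facts zero i _ _ = (≤-refl , ≤-refl , inj₁ refl) , (≤-refl , ≤-refl , inj₁ refl)
      facts (suc k) i 1≤i h = decide (E i (suc (k ℕ.+ i))) refl
        where
        h′ : k ℕ.+ suc i ≤ n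
        h′ = ≤-trans (≤-reflexive (+-suc k i)) h
        rf = proj₁ (facts k i 1≤i (<⇒≤ h))
        cf = proj₂ (facts k (suc i) (s≤s z≤n) h′)
        decide : ∀ b → E i (suc (k ℕ.+ i)) ≡ b → RowFacts (suc k) i × ColFacts (suc k) i
        decide true e =
            subst (λ m → i ≤ m × m ≤ suc k ℕ.+ i × (m ≡ i ⊎ (∃ λ q → i < q × q ≤ suc k ℕ.+ i × E i q ≡ true × m ≤ q))) (sym (if-true e))
              (<⇒≤ (proj₁ cf) , c≤ , inj₂ (suc (k ℕ.+ i) , s≤s (m≤n+m i k) , ≤-refl , e , c≤))
          , subst (λ m → i ≤ m × m ≤ suc k ℕ.+ i × (m ≡ suc k ℕ.+ i ⊎ (∃ λ p → i ≤ p × p < suc k ℕ.+ i × E p (suc k ℕ.+ i) ≡ true × p ≤ m))) (sym (if-true e))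
              (proj₁ rf , m≤n⇒m≤1+n (proj₁ (proj₂ rf)) , inj₂ (i , ≤-refl , s≤s (m≤n+m i k) , e , proj₁ rf))
          where
          c≤ : c k (suc i) ≤ suc k ℕ.+ i
          c≤ = ≤-trans (proj₁ (proj₂ cf)) (≤-reflexive (+-suc k i))
        decide false e =
            subst (λ m → i ≤ m × m ≤ suc k ℕ.+ i × (m ≡ i ⊎ (∃ λ q → i < q × q ≤ suc k ℕ.+ i × E i q ≡ true × m ≤ q))) (sym (if-false e))
              (proj₁ rf , m≤n⇒m≤1+n (proj₁ (proj₂ rf)) ,
               [ inj₁ , (λ (q , a , b , d) → inj₂ (q , a , m≤n⇒m≤1+n b , d)) ]′ (proj₂ (proj₂ rf)))
          , subst (λ m → i ≤ m × m ≤ suc k ℕ.+ i × (m ≡ suc k ℕ.+ i ⊎ (∃ λ p → i ≤ p × p < suc k ℕ.+ i × E p (suc k ℕ.+ i) ≡ true × p ≤ m))) (sym (if-false e))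
              (subst (λ j → i ≤ c k (suc i) × c k (suc i) ≤ j × (c k (suc i) ≡ j ⊎ (∃ λ p → i ≤ p × p < j × E p j ≡ true × p ≤ c k (suc i)))) (+-suc k i)
                (<⇒≤ (proj₁ cf) , proj₁ (proj₂ cf) ,
                 [ inj₁ , (λ (p , a , b , d) → inj₂ (p , <⇒≤ a , b , d)) ]′ (proj₂ (proj₂ cf))))

    i≤r : ∀ {k i} → 1 ≤ i → k ℕ.+ i ≤ n → i ≤ r k i
    i≤r {k} {i} 1≤i h = proj₁ (proj₁ (facts k i 1≤i h))

    r≤j : ∀ {k i} → 1 ≤ i → k ℕ.+ i ≤ n → r k i ≤ k ℕ.+ i
    r≤j {k} {i} 1≤i h = proj₁ (proj₂ (proj₁ (facts k i 1≤i h)))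

    c≤j : ∀ {k i} → 1 ≤ i → k ℕ.+ i ≤ n → c k i ≤ k ℕ.+ i
    c≤j {k} {i} 1≤i h = proj₁ (proj₂ (proj₂ (facts k i 1≤i h)))

    r<c : ∀ {k i} → 1 ≤ i → suc (k ℕ.+ i) ≤ n → r k i < c k (suc i)
    r<c {k} {i} 1≤i h = separated 1≤i h (proj₁ (facts k i 1≤i (<⇒≤ h)))
      (proj₂ (facts k (suc i) (s≤s z≤n) (≤-trans (≤-reflexive (+-suc k i)) h)))

    r-mono : ∀ {k k′ i} → 1 ≤ i → k ≤′ k′ → k′ ℕ.+ i ≤ n → r k i ≤ r k′ i
    r-mono 1≤i ≤′-refl _ = ≤-refl
    r-mono {k} {suc k′} {i} 1≤i (≤′-step h) b = ≤-trans (r-mono 1≤i h (<⇒≤ b)) (step (E i (suc (k′ ℕ.+ i))) refl)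
      where
      step : ∀ e → E i (suc (k′ ℕ.+ i)) ≡ e → r k′ i ≤ r (suc k′) i
      step true e = ≤-trans (<⇒≤ (r<c {k′} 1≤i b)) (≤-reflexive (sym (if-true e)))
      step false e = ≤-reflexive (sym (if-false e))

    c-mono : ∀ d {k i} → 1 ≤ i → d ℕ.+ k ℕ.+ i ≤ n → c (d ℕ.+ k) i ≤ c k (d ℕ.+ i)
    c-mono zero _ _ = ≤-refl
    c-mono (suc d) {k} {i} 1≤i b = ≤-trans (step (E i (suc (d ℕ.+ k ℕ.+ i))) refl)
      (≤-trans (c-mono d {k} {suc i} (s≤s z≤n) (≤-trans (≤-reflexive (+-suc (d ℕ.+ k) i)) b)) (≤-reflexive (cong (c k) (+-suc d i))))
      where
      step : ∀ e → E i (suc (d ℕ.+ k ℕ.+ i)) ≡ e → c (suc (d ℕ.+ k)) i ≤ c (d ℕ.+ k) (suc i)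
      step true e = ≤-trans (≤-reflexive (if-true e)) (<⇒≤ (r<c {d ℕ.+ k} 1≤i b))
      step false e = ≤-reflexive (if-false e)

    -- The intervals [r , c] of comparable elements of E do not overlap.
    ordered : ∀ {k′ i′ k i} → 1 ≤ i′ → i′ ≤ i → suc (k′ ℕ.+ i′) ≤ suc (k ℕ.+ i) → suc (k ℕ.+ i) ≤ n →
      ¬ (i′ ≡ i × suc (k′ ℕ.+ i′) ≡ suc (k ℕ.+ i)) →
      E i′ (suc (k′ ℕ.+ i′)) ≡ true → E i (suc (k ℕ.+ i)) ≡ true → r (suc k′) i′ ≤ r k i
    ordered {k′} {i′} {k} {i} 1≤i′ i′≤i j′≤j j≤n distinct E′ Eij with suc (k′ ℕ.+ i′) ℕ.<? i
    ... | yes j′<i = ≤-trans (r≤j {suc k′} 1≤i′ (≤-trans j′≤j j≤n)) (≤-trans (<⇒≤ j′<i) (i≤r {k} (≤-trans 1≤i′ i′≤i) (<⇒≤ j≤n)))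
    -- The segments meet, and i′ ≤ i, j′ ≤ j; so if one contains the other, they share a row or a
    -- column.
    ... | no j′≮i = [ (λ (i≤i′ , _) → same-row (≤-antisym i′≤i i≤i′)) , (λ (_ , j≤j′) → same-column (≤-antisym j′≤j j≤j′)) ]′
        (laminar i′ (suc (k′ ℕ.+ i′)) i (suc (k ℕ.+ i))
          (1≤i′ , s≤s (m≤n+m i′ k′) , ≤-trans j′≤j j≤n) (≤-trans 1≤i′ i′≤i , s≤s (m≤n+m i k) , j≤n)
          E′ Eij (≮⇒≥ j′≮i , ≤-trans i′≤i (m≤n⇒m≤1+n (m≤n+m i k))))
      where
      same-row : i′ ≡ i → r (suc k′) i′ ≤ r k i
      same-row refl = r-mono 1≤i′ (≤⇒≤′ (≤∧≢⇒< (+-cancelʳ-≤ i k′ k (≤-pred j′≤j)) (λ e → distinct (refl , cong (λ m → suc (m ℕ.+ i)) e)))) (<⇒≤ j≤n)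
      same-column : suc (k′ ℕ.+ i′) ≡ suc (k ℕ.+ i) → r (suc k′) i′ ≤ r k i
      same-column j≡ = ≤-trans (≤-reflexive (trans (if-true E′) (cong (λ m → c m (suc i′)) k′≡)))
          (≤-trans (c-mono d {suc k} {suc i′} (s≤s z≤n) bound) (≤-reflexive (trans (cong (c (suc k)) d+) (if-true Eij))))
        where
        i′<i : i′ < i
        i′<i = ≤∧≢⇒< i′≤i (λ e → distinct (e , j≡))
        d = i ∸ suc i′
        d+ : d ℕ.+ suc i′ ≡ i
        d+ = m∸n+n≡m i′<i
        k′≡ : k′ ≡ d ℕ.+ suc k
        k′≡ = +-cancelʳ-≡ (suc i′) k′ (d ℕ.+ suc k) (trans (+-suc k′ i′) (trans j≡ (trans (cong (suc k ℕ.+_) (sym d+))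
          (trans (sym (+-assoc (suc k) d (suc i′))) (cong (ℕ._+ suc i′) (+-comm (suc k) d))))))
        bound : d ℕ.+ suc k ℕ.+ suc i′ ≤ n
        bound = ≤-trans (≤-reflexive (trans (cong (ℕ._+ suc i′) (sym k′≡)) (trans (+-suc k′ i′) j≡))) j≤n

-- Sums along walks at x(E) for laminar E.

module LaminarPoint {n A E x} (gap : Gap n A) (laminar : Laminar n E) (corners : HasCorners n A E x) where
  open Indices E

  private
    mutual
      row-sum : ∀ k i → 1 ≤ i → k ℕ.+ i ≤ n → row x i (k ℕ.+ i) - row x i i ≡ A (r k i) - A i
      row-sum zero i _ _ = trans (ℚP.+-inverseʳ (row x i i)) (sym (ℚP.+-inverseʳ (A i)))
      row-sum (suc k) i 1≤i h = trans
        (((∀ p q s → (p + q) - s ≡ (p - s) + q) ∋ solve-∀ ℚ-ring) (row x i (k ℕ.+ i)) (x i (suc (k ℕ.+ i))) (row x i i))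
        (trans (cong (_+ x i (suc (k ℕ.+ i))) (row-sum k i 1≤i (<⇒≤ h))) (decide (E i (suc (k ℕ.+ i))) refl))
        where
        decide : ∀ b → E i (suc (k ℕ.+ i)) ≡ b → A (r k i) - A i + x i (suc (k ℕ.+ i)) ≡ A (r (suc k) i) - A i
        decide true e = trans (cong (A (r k i) - A i +_) (entry k i refl 1≤i h e)) (trans
          (((∀ p a q → p - a + (q - p) ≡ q - a) ∋ solve-∀ ℚ-ring) (A (r k i)) (A i) (A (c k (suc i)))) (cong (λ m → A m - A i) (sym (if-true e))))
        decide false e = trans (cong (A (r k i) - A i +_) (proj₁ (corners i (k ℕ.+ i) (m≤n+m i k) (1≤i , s≤s (m≤n+m i k) , h)) e))
          (trans (ℚP.+-identityʳ (A (r k i) - A i)) (cong (λ m → A m - A i) (sym (if-false e))))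

      col-sum : ∀ k i {e} → k ℕ.+ i ≡ e → suc e ≤ n → col x (suc e) e - col x (suc e) i ≡ A (suc e) - A (c k (suc i))
      col-sum zero i refl _ = trans (ℚP.+-inverseʳ (col x (suc i) i)) (sym (ℚP.+-inverseʳ (A (suc i))))
      col-sum (suc k) i {e} p h = trans
        (((∀ a b q → a - b ≡ (a - (b + q)) + q) ∋ solve-∀ ℚ-ring) (col x (suc e) e) (col x (suc e) i) (x (suc i) (suc e)))
        (trans (cong (_+ x (suc i) (suc e)) (col-sum k (suc i) p′ h)) (decide (E (suc i) (suc e)) refl))
        where
        p′ : k ℕ.+ suc i ≡ e
        p′ = trans (+-suc k i) p
        i<e : suc i ≤ e
        i<e = ≤-trans (m≤n+m (suc i) k) (≤-reflexive p′)
        E≡ : E (suc i) (suc (k ℕ.+ suc i)) ≡ E (suc i) (suc e)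
        E≡ = cong (λ m → E (suc i) (suc m)) p′
        decide : ∀ b → E (suc i) (suc e) ≡ b → A (suc e) - A (c k (suc (suc i))) + x (suc i) (suc e) ≡ A (suc e) - A (c (suc k) (suc i))
        decide true t = trans (cong (A (suc e) - A (c k (suc (suc i))) +_) (entry k (suc i) p′ (s≤s z≤n) h t)) (trans
          (((∀ a p q → a - p + (p - q) ≡ a - q) ∋ solve-∀ ℚ-ring) (A (suc e)) (A (c k (suc (suc i)))) (A (r k (suc i)))) (cong (λ m → A (suc e) - A m) (sym (if-true (trans E≡ t)))))
        decide false t = trans (cong (A (suc e) - A (c k (suc (suc i))) +_) (proj₁ (corners (suc i) e i<e (s≤s z≤n , s≤s i<e , h)) t))
          (trans (ℚP.+-identityʳ (A (suc e) - A (c k (suc (suc i))))) (cong (λ m → A (suc e) - A m) (sym (if-false (trans E≡ t)))))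

      -- What the tight hook leaves for its corner: A j - A i minus the row part A r - A i and the
      -- column part A j - A c. The three statements are proved together, by length of the segment.
      entry : ∀ k i {e} → k ℕ.+ i ≡ e → 1 ≤ i → suc e ≤ n → E i (suc e) ≡ true → x i (suc e) ≡ A (c k (suc i)) - A (r k i)
      entry k i {e} refl 1≤i h t = trans
        (((∀ y R C → y ≡ (y + (R + C)) - R - C) ∋ solve-∀ ℚ-ring) (x i (suc e)) (row x i e - row x i i) (col x (suc e) e - col x (suc e) i))
        (trans (cong₂ (λ H R → H - R - (col x (suc e) e - col x (suc e) i)) total≡ (row-sum k i 1≤i (<⇒≤ h)))
          (trans (cong (λ C → A (suc e) - A i - (A (r k i) - A i) - C) (col-sum k i refl h))
            (((∀ a b p q → b - a - (p - a) - (b - q) ≡ q - p) ∋ solve-∀ ℚ-ring) (A i) (A (suc e)) (A (r k i)) (A (c k (suc i))))))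
        where
        total≡ : x i (suc e) + ((row x i e - row x i i) + (col x (suc e) e - col x (suc e) i)) ≡ A (suc e) - A i
        total≡ = trans (sym (hookSum-split x i e)) (trans (((∀ H a → H ≡ (H + a) - a) ∋ solve-∀ ℚ-ring) (hookSum x i e) (A i))
          (cong (_- A i) (proj₂ (corners i e (m≤n+m i k) (1≤i , s≤s (m≤n+m i k) , h)) t)))

    -- What is known after the part of a walk up to (i , j): its total T, and the
    -- last element [i′ , k + i′] of E met so far ([s , s] if there was none).
    record State (s i j : ℕ) (T : ℚ) (met : ℕ → ℕ → Set) : Set where
      constructor state
      field
        k i′   : ℕ
        i′≤i   : i′ ≤ i
        j′≤j   : k ℕ.+ i′ ≤ j
        s≤i′   : s ≤ i′
        kind   : (k ≡ 0 × i′ ≡ s) ⊎ (∃ λ k₀ → k ≡ suc k₀ × E i′ (suc (k₀ ℕ.+ i′)) ≡ true)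
        bound  : T + A s ℚ.≤ A (r k i′)
        -- Without a unit of slack, the walk has met nothing yet, or the column of the last element
        -- met is also that of an element of row s lying on the walk.
        slack  : T + A s + 1ℚ ℚ.≤ A (r k i′) ⊎ (k ℕ.+ i′ ≡ s ⊎ (E s (k ℕ.+ i′) ≡ true × s < k ℕ.+ i′ × met s (k ℕ.+ i′)))

    module _ {s i j T met} (1≤s : 1 ≤ s) (st : State s i j T met) {i₂ e} (i≤i₂ : i ≤ i₂) (j≤j₂ : j ≤ suc e)
      (moved : i ℕ.+ j < i₂ ℕ.+ suc e) (i₂≤e : i₂ ≤ e) (e<n : suc e ≤ n) where
      open State st

      private
        met₂ : ℕ → ℕ → Set
        met₂ p q = (i₂ ≡ p × suc e ≡ q) ⊎ met p q

        1≤i′ : 1 ≤ i′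
        1≤i′ = ≤-trans 1≤s s≤i′

        s≤i₂ : s ≤ i₂
        s≤i₂ = ≤-trans s≤i′ (≤-trans i′≤i i≤i₂)

        j′≤n : k ℕ.+ i′ ≤ n
        j′≤n = ≤-trans j′≤j (≤-trans j≤j₂ e<n)

      skip : x i₂ (suc e) ≡ 0ℚ → State s i₂ (suc e) (T + x i₂ (suc e)) met₂
      skip x≡0 = state k i′ (≤-trans i′≤i i≤i₂) (≤-trans j′≤j j≤j₂) s≤i′ kind
        (subst (λ T → T + A s ℚ.≤ A (r k i′)) T≡ bound)
        ([ (λ b → inj₁ (subst (λ T → T + A s + 1ℚ ℚ.≤ A (r k i′)) T≡ b)) , (λ o → inj₂ ([ inj₁ , (λ (a , b , m) → inj₂ (a , b , inj₂ m)) ]′ o)) ]′ slack)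
        where
        T≡ : T ≡ T + x i₂ (suc e)
        T≡ = sym (trans (cong (T +_) x≡0) (ℚP.+-identityʳ T))

      module _ (t : E i₂ (suc e) ≡ true) where
        private
          k₂ = e ∸ i₂
          k₂+ : k₂ ℕ.+ i₂ ≡ e
          k₂+ = m∸n+n≡m i₂≤e
          t₂ : E i₂ (suc (k₂ ℕ.+ i₂)) ≡ true
          t₂ = trans (cong (λ m → E i₂ (suc m)) k₂+) t
          1≤i₂ = ≤-trans 1≤s s≤i₂
          k₂<n : suc (k₂ ℕ.+ i₂) ≤ n
          k₂<n = ≤-trans (≤-reflexive (cong suc k₂+)) e<n
          ρ = r k₂ i₂
          κ = c k₂ (suc i₂)
          r₂≡ : r (suc k₂) i₂ ≡ κ
          r₂≡ = if-true t₂
          i₂≤ρ : i₂ ≤ ρ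
          i₂≤ρ = i≤r laminar {k₂} 1≤i₂ (<⇒≤ k₂<n)
          ρ≤n : ρ ≤ n
          ρ≤n = ≤-trans (r≤j laminar {k₂} 1≤i₂ (<⇒≤ k₂<n)) (<⇒≤ k₂<n)
          1≤r : 1 ≤ r k i′
          1≤r = ≤-trans 1≤i′ (i≤r laminar {k} 1≤i′ j′≤n)

          disjoint : r k i′ ≤ ρ
          disjoint = [ (λ { (refl , refl) → ≤-trans s≤i₂ i₂≤ρ })
            , (λ { (k₀ , refl , E′) → ordered laminar {k₀} {i′} {k₂} {i₂} 1≤i′ (≤-trans i′≤i i≤i₂)
                     (≤-trans j′≤j (≤-trans j≤j₂ (≤-reflexive (cong suc (sym k₂+))))) k₂<n
                     (λ (a , b) → <-irrefl refl (<-≤-trans moved (≤-trans (≤-reflexive (cong₂ ℕ._+_ (sym a) (trans (cong suc (sym k₂+)) (sym b)))) (+-mono-≤ i′≤i j′≤j))))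
                     E′ t₂ }) ]′ kind

          X≡ : x i₂ (suc e) ≡ A κ - A ρ
          X≡ = entry k₂ i₂ k₂+ 1≤i₂ e<n t

          Rest : Set
          Rest = T + x i₂ (suc e) + A s + 1ℚ ℚ.≤ A κ ⊎ (suc e ≡ s ⊎ (E s (suc e) ≡ true × s < suc e × met₂ s (suc e)))

          add : ∀ {q} → A (r k i′) + q ℚ.≤ A ρ → T + x i₂ (suc e) + A s + q ℚ.≤ A κ
          add {q} h = ≤-by (0≤- bound ⊹ 0≤- h) (trans (cong (λ X → T + X + A s + q + ((A (r k i′) - (T + A s)) + (A ρ - (A (r k i′) + q)))) X≡)
            (((∀ T a q f p z → T + (z - p) + a + q + ((f - (T + a)) + (p - (f + q))) ≡ z) ∋ solve-∀ ℚ-ring) T (A s) q (A (r k i′)) (A ρ) (A κ)))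

          -- No unit is gained here, but i₂ ≤ ρ = r ≤ j′, so the new segment meets [s , j′]. By
          -- laminarity it starts in row s, or it ends in column j′ and [s , j′] still serves.
          touching : r k i′ ≡ ρ → Rest
          touching r≡ρ = [ (λ b → inj₁ (≤-by (0≤- b ⊹ 0≤- (monotone gap 1≤r disjoint ρ≤n))
                (trans (cong (λ X → T + X + A s + 1ℚ + ((A (r k i′) - (T + A s + 1ℚ)) + (A ρ - A (r k i′)))) X≡)
                  (((∀ T a f p z → T + (z - p) + a + 1ℚ + ((f - (T + a + 1ℚ)) + (p - f)) ≡ z) ∋ solve-∀ ℚ-ring) T (A s) (A (r k i′)) (A ρ) (A κ)))))
              , (λ o → inj₂ (inj₂ ([ first , later ]′ o))) ]′ slack
            where
            i₂≤j′ : i₂ ≤ k ℕ.+ i′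
            i₂≤j′ = ≤-trans i₂≤ρ (≤-trans (≤-reflexive (sym r≡ρ)) (r≤j laminar {k} 1≤i′ j′≤n))
            here : i₂ ≡ s → E s (suc e) ≡ true × s < suc e × met₂ s (suc e)
            here i₂≡s = subst (λ m → E m (suc e) ≡ true) i₂≡s t , s≤s (≤-trans s≤i₂ i₂≤e) , inj₁ (i₂≡s , refl)
            first : k ℕ.+ i′ ≡ s → E s (suc e) ≡ true × s < suc e × met₂ s (suc e)
            first j′≡s = here (≤-antisym (≤-trans i₂≤j′ (≤-reflexive j′≡s)) s≤i₂)
            later : E s (k ℕ.+ i′) ≡ true × s < k ℕ.+ i′ × met s (k ℕ.+ i′) → E s (suc e) ≡ true × s < suc e × met₂ s (suc e)
            later (Es , s<j′ , m) = [ (λ (i₂≤s , _) → here (≤-antisym i₂≤s s≤i₂))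
              , (λ (_ , j₂≤j′) → let j≡ = ≤-antisym (≤-trans j′≤j j≤j₂) j₂≤j′ in
                   subst (λ j → E s j ≡ true × s < j × met₂ s j) j≡ (Es , s<j′ , inj₂ m)) ]′
              (laminar s (k ℕ.+ i′) i₂ (suc e) (1≤s , s<j′ , j′≤n) (1≤i₂ , s≤s i₂≤e , e<n) Es t (i₂≤j′ , ≤-trans s≤i₂ (m≤n⇒m≤1+n i₂≤e)))

          rest : Rest
          rest = [ (λ r<ρ → inj₁ (add (strict gap 1≤r r<ρ ρ≤n))) , touching ]′ (m≤n⇒m<n∨m≡n disjoint)

          j₂≡ : suc k₂ ℕ.+ i₂ ≡ suc e
          j₂≡ = cong suc k₂+

        meet : State s i₂ (suc e) (T + x i₂ (suc e)) met₂
        meet = state (suc k₂) i₂ ≤-refl (≤-reflexive j₂≡) s≤i₂ (inj₂ (k₂ , refl , t₂))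
          (subst (λ m → T + x i₂ (suc e) + A s ℚ.≤ A m) (sym r₂≡)
            (ℚP.≤-trans (ℚP.≤-reflexive (sym (ℚP.+-identityʳ (T + x i₂ (suc e) + A s)))) (add (ℚP.≤-trans (ℚP.≤-reflexive (ℚP.+-identityʳ (A (r k i′)))) (monotone gap 1≤r disjoint ρ≤n)))))
          (subst₂ (λ m j → T + x i₂ (suc e) + A s + 1ℚ ℚ.≤ A m ⊎ (j ≡ s ⊎ (E s j ≡ true × s < j × met₂ s j))) (sym r₂≡) (sym j₂≡) rest)

      next : State s i₂ (suc e) (T + x i₂ (suc e)) met₂
      next = decide (E i₂ (suc e)) refl
        where
        decide : ∀ b → E i₂ (suc e) ≡ b → State s i₂ (suc e) (T + x i₂ (suc e)) met₂
        decide true t  = meet t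
        decide false f = skip (proj₁ (corners i₂ e i₂≤e (≤-trans 1≤s s≤i₂ , s≤s i₂≤e , e<n)) f)

    walk-state : ∀ {s i j} → 1 ≤ s → j ≤ n → (w : Walk s i j) → State s i j (total x w) (On w)
    walk-state {s} 1≤s j≤n start = state 0 s ≤-refl ≤-refl ≤-refl (inj₁ (refl , refl)) (ℚP.≤-reflexive (ℚP.+-identityˡ (A s))) (inj₂ (inj₁ refl))
    walk-state 1≤s j≤n (right {i} {suc j} w h) = next 1≤s (walk-state 1≤s j≤n w) (n≤1+n i) ≤-refl ≤-refl (≤-pred h) j≤n
    walk-state 1≤s j≤n (up {i} {j} w) = next 1≤s (walk-state 1≤s (<⇒≤ j≤n) w) ≤-refl (n≤1+n j) (≤-reflexive (sym (+-suc i j))) (walk-i≤j w) j≤n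

  -- If the last element met ends before column `suc e`, the remaining potential is a unit of slack;
  -- otherwise the state leaves only the hook. That unit is the δ of `perturb` at x(E).
  slack-or-hook : ∀ {s e} → 1 ≤ s → suc e ≤ n → (w : Walk s e (suc e)) →
    total x w + A s + 1ℚ ℚ.≤ A (suc e) ⊎ (E s (suc e) ≡ true × On w s (suc e))
  slack-or-hook {s} {e} 1≤s e<n w = conclude (walk-state 1≤s e<n w)
    where
    conclude : State s e (suc e) (total x w) (On w) → total x w + A s + 1ℚ ℚ.≤ A (suc e) ⊎ (E s (suc e) ≡ true × On w s (suc e))
    conclude (state k i′ i′≤i j′≤j s≤i′ kind bound slack) =
        [ (λ b → inj₁ (ℚP.≤-trans b (monotone gap 1≤r (≤-trans r≤ j′≤j) e<n)))
        , (λ o → [ (λ j′<j → inj₁ (ℚP.≤-trans (ℚP.+-monoˡ-≤ 1ℚ bound) (strict gap 1≤r (≤-<-trans r≤ j′<j) e<n)))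
                 , (λ j′≡j → [ (λ j′≡s → ⊥-elim (<⇒≱ (s≤s (walk-s≤i w)) (≤-reflexive (trans (sym j′≡j) j′≡s))))
                             , (λ (Es , _ , o) → inj₂ (subst (λ j → E s j ≡ true × On w s j) j′≡j (Es , o))) ]′ o) ]′ (m≤n⇒m<n∨m≡n j′≤j)) ]′ slack
      where
      1≤i′ = ≤-trans 1≤s s≤i′
      j′≤n = ≤-trans j′≤j e<n
      r≤ : r k i′ ≤ k ℕ.+ i′
      r≤ = r≤j laminar {k} 1≤i′ j′≤n
      1≤r : 1 ≤ r k i′
      1≤r = ≤-trans 1≤i′ (i≤r laminar {k} 1≤i′ j′≤n)

  element≥1 : ∀ {i e} → i ≤ e → Valid n i (suc e) → E i (suc e) ≡ true → 1ℚ ℚ.≤ x i (suc e)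
  element≥1 {i} {e} i≤e (1≤i , _ , e<n) t = ≤-by (0≤- (strict gap 1≤r (r<c laminar {k} 1≤i k<n) c≤n))
      (trans (((∀ p q → 1ℚ + (q - (p + 1ℚ)) ≡ q - p) ∋ solve-∀ ℚ-ring) (A (r k i)) (A (c k (suc i)))) (sym (entry k i k+ 1≤i e<n t)))
    where
    k = e ∸ i
    k+ : k ℕ.+ i ≡ e
    k+ = m∸n+n≡m i≤e
    k<n : suc (k ℕ.+ i) ≤ n
    k<n = ≤-trans (≤-reflexive (cong suc k+)) e<n
    1≤r : 1 ≤ r k i
    1≤r = ≤-trans 1≤i (i≤r laminar {k} 1≤i (<⇒≤ k<n))
    c≤n : c k (suc i) ≤ n
    c≤n = ≤-trans (c≤j laminar {k} (s≤s z≤n) k<n′) k<n′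
      where
      k<n′ : k ℕ.+ suc i ≤ n
      k<n′ = ≤-trans (≤-reflexive (+-suc k i)) k<n


-- Enumeration of the pairs (i , e) with 1 ≤ i ≤ e ≤ m.
tri : ℕ → ℕ
tri zero    = 0
tri (suc m) = suc m ℕ.+ tri m

decode : ∀ m → Fin (tri m) → ℕ × ℕ
decode (suc m) k = [ (λ f → suc (toℕ f) , suc m) , decode m ]′ (splitAt (suc m) k)

decode-valid : ∀ m k → 1 ≤ proj₁ (decode m k) × proj₁ (decode m k) ≤ proj₂ (decode m k) × proj₂ (decode m k) ≤ m
decode-valid (suc m) k with splitAt (suc m) k
... | inj₁ f = s≤s z≤n , FinP.toℕ<n f , ≤-refl
... | inj₂ l = let a , b , c = decode-valid m l in a , b , m≤n⇒m≤1+n c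

decode-injective : ∀ m {k l} → decode m k ≡ decode m l → k ≡ l
decode-injective (suc m) {k} {l} e = trans (sym (FinP.join-splitAt (suc m) (tri m) k))
    (trans (cong (join (suc m) (tri m)) (cases (splitAt (suc m) k) (splitAt (suc m) l) e)) (FinP.join-splitAt (suc m) (tri m) l))
  where
  code : Fin (suc m) ⊎ Fin (tri m) → ℕ × ℕ
  code = [ (λ f → suc (toℕ f) , suc m) , decode m ]′
  cases : ∀ p q → code p ≡ code q → p ≡ q
  cases (inj₁ f) (inj₁ g) e = cong inj₁ (FinP.toℕ-injective (suc-injective (cong proj₁ e)))
  cases (inj₂ f) (inj₂ g) e = cong inj₂ (decode-injective m e)
  cases (inj₁ f) (inj₂ g) e = ⊥-elim (<-irrefl (sym (cong proj₂ e)) (s≤s (proj₂ (proj₂ (decode-valid m g)))))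
  cases (inj₂ f) (inj₁ g) e = ⊥-elim (<-irrefl (cong proj₂ e) (s≤s (proj₂ (proj₂ (decode-valid m f)))))

encode : ∀ m i e → 1 ≤ i → i ≤ e → e ≤ m → Σ[ k ∈ Fin (tri m) ] decode m k ≡ (i , e)
encode zero i e 1≤i i≤e e≤0 = ⊥-elim (<⇒≱ 1≤i (≤-trans i≤e e≤0))
encode (suc m) (suc i) e 1≤i i≤e e≤m = [
    (λ e<m → let k , q = encode m (suc i) e 1≤i i≤e (≤-pred e<m)
             in suc m ↑ʳ k , trans (cong [ (λ f → suc (toℕ f) , suc m) , decode m ]′ (FinP.splitAt-↑ʳ (suc m) (tri m) k)) q)
  , (λ { refl → fromℕ< i≤e ↑ˡ tri m , trans (cong [ (λ f → suc (toℕ f) , suc m) , decode m ]′ (FinP.splitAt-↑ˡ (suc m) (fromℕ< i≤e) (tri m)))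
           (cong (λ i → suc i , suc m) (FinP.toℕ-fromℕ< i≤e)) }) ]′ (m≤n⇒m<n∨m≡n e≤m)

-- Active functionals and the tangent cone at x(E).

Integral : ℚ → Set
Integral p = Σ[ z ∈ ℤ ] p ≡ ℤtoℚ z

integral-+ : ∀ {p q} → Integral p → Integral q → Integral (p + q)
integral-+ (y , e) (z , f) = y ℤ.+ z , trans (cong₂ _+_ e f) (sym (ℤtoℚ-+ y z))

integral-neg : ∀ {p} → Integral p → Integral (- p)
integral-neg (z , e) = ℤ.- z , trans (cong -_ e) (sym (ℤtoℚ-neg z))

integral-row : ∀ u i j → Integral (row (toPoint u) i j)
integral-row u i zero    = ℤ.0ℤ , refl
integral-row u i (suc j) = integral-+ (integral-row u i j) (u i (suc j) , refl)

integral-col : ∀ u j i → Integral (col (toPoint u) j i)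
integral-col u j zero    = ℤ.0ℤ , refl
integral-col u j (suc i) = integral-+ (integral-col u j i) (u (suc i) j , refl)

integral-active : ∀ E u i e → Integral (active E (toPoint u) i e)
integral-active E u i e = decide (E i (suc e))
  where
  decide : ∀ b → Integral (if b then - hookSum (toPoint u) i e else toPoint u i (suc e))
  decide false = u i (suc e) , refl
  decide true = integral-neg (integral-+ (integral-+ (integral-row u i (suc e)) (integral-neg (integral-row u i i)))
    (integral-+ (integral-col u (suc e) e) (integral-neg (integral-col u (suc e) i))))

activeFunctional : ∀ {n} E i e → i ≤ e → Valid n i (suc e) → Functional n
activeFunctional {n} E i e h valid@(1≤i , _ , e<n) = record { ev = λ x → active E x i e ; ev-≈ = cong-at (E i (suc e)) ; lin = lin-at (E i (suc e)) }
  where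
  value : Bool → Point → ℚ
  value b x = if b then - hookSum x i e else x i (suc e)
  H = negTotal {n} 1≤i e<n (hook i e h)
  cong-at : ∀ b {x y} → x ≈[ n ] y → value b x ≡ value b y
  cong-at false q = q i (suc e) valid
  cong-at true {x} {y} q = trans (cong -_ (sym (total-hook x i e h))) (trans (ev-≈ H q) (cong -_ (total-hook y i e h)))
  lin-at : ∀ b x y c d → value b (λ i j → c * x i j + d * y i j) ≡ c * value b x + d * value b y
  lin-at false x y c d = refl
  lin-at true x y c d = trans (cong -_ (sym (total-hook (λ i j → c * x i j + d * y i j) i e h)))
    (trans (lin H x y c d) (cong₂ (λ p q → c * - p + d * - q) (total-hook x i e h) (total-hook y i e h)))

extreme-value : ∀ {t m p q} → 0ℚ ℚ.< t → t ℚ.< 1ℚ → m ℚ.≤ p → m ℚ.≤ q → m ≡ t * p + (1ℚ - t) * q → p ≡ q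
extreme-value {t} {m} {p} {q} t>0 t<1 m≤p m≤q e = trans (ℚP.≤-antisym p≤m m≤p) (ℚP.≤-antisym m≤q q≤m)
  where
  p≤m : p ℚ.≤ m
  p≤m = ≤-by (0≤*⇒0≤ t>0 (ℚP.≤-trans (0≤* (ℚP.<⇒≤ (0<- t<1)) (0≤- m≤q)) (ℚP.≤-reflexive
      (trans (((∀ t m p q → (1ℚ - t) * (q - m) ≡ t * (m - p) + ((t * p + (1ℚ - t) * q) - m)) ∋ solve-∀ ℚ-ring) t m p q)
        (trans (cong (λ k → t * (m - p) + (k - m)) (sym e)) (((∀ a m → a + (m - m) ≡ a) ∋ solve-∀ ℚ-ring) (t * (m - p)) m))))))
    (((∀ p m → p + (m - p) ≡ m) ∋ solve-∀ ℚ-ring) p m)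
  q≤m : q ℚ.≤ m
  q≤m = ≤-by (0≤*⇒0≤ (0<- t<1) (ℚP.≤-trans (0≤* (ℚP.<⇒≤ t>0) (0≤- m≤p)) (ℚP.≤-reflexive
      (trans (((∀ t m p q → t * (p - m) ≡ (1ℚ - t) * (m - q) + ((t * p + (1ℚ - t) * q) - m)) ∋ solve-∀ ℚ-ring) t m p q)
        (trans (cong (λ k → (1ℚ - t) * (m - q) + (k - m)) (sym e)) (((∀ a m → a + (m - m) ≡ a) ∋ solve-∀ ℚ-ring) ((1ℚ - t) * (m - q)) m))))))
    (((∀ p m → p + (m - p) ≡ m) ∋ solve-∀ ℚ-ring) q m)

module LaminarSimple {n A E x} (gap : Gap n A) (laminar : Laminar n E) (corners : HasCorners n A E x) where
  open LaminarPoint {x = x} gap laminar corners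

  private
    hook-tight : ∀ {i e} → i ≤ e → Valid n i (suc e) → E i (suc e) ≡ true → hookSum x i e + A i ≡ A (suc e)
    hook-tight {i} {e} i≤e valid = proj₂ (corners i e i≤e valid)

    walk-hook-tight : ∀ {s e} → 1 ≤ s → suc e ≤ n → (w : Walk s e (suc e)) → E s (suc e) ≡ true → On w s (suc e) → total x w + A s ≡ A (suc e)
    walk-hook-tight {s} {e} 1≤s e<n w t o = trans (cong (_+ A s) (total-through-corner x w o)) (hook-tight (walk-s≤i w) (1≤s , s≤s (walk-s≤i w) , e<n) t)

    value≥ : ∀ {i e} → i ≤ e → Valid n i (suc e) → 1ℚ ℚ.≤ x i (suc e) ⊎ (E i (suc e) ≡ false × x i (suc e) ≡ 0ℚ)
    value≥ {i} {e} i≤e valid = decide (E i (suc e)) refl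
      where
      decide : ∀ b → E i (suc e) ≡ b → 1ℚ ℚ.≤ x i (suc e) ⊎ (E i (suc e) ≡ false × x i (suc e) ≡ 0ℚ)
      decide true t  = inj₁ (element≥1 i≤e valid t)
      decide false f = inj₂ (f , proj₁ (corners i e i≤e valid) f)

  member : Member n A x
  member = (λ { i (suc e) valid@(_ , s≤s i≤e , _) → [ ℚP.≤-trans 0≤1 , (λ (_ , z) → ℚP.≤-reflexive (sym z)) ]′ (value≥ i≤e valid) }) ,
    λ {s} {e} 1≤s e<n w → [ (λ b → ℚP.≤-trans (≤-by 0≤1 refl) b) , (λ (t , o) → ℚP.≤-reflexive (walk-hook-tight 1≤s e<n w t o)) ]′ (slack-or-hook 1≤s e<n w)

  minimal : ∀ {y} → Member n A y → ∀ i e → i ≤ e → Valid n i (suc e) → active E x i e ℚ.≤ active E y i e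
  minimal {y} y∈ i e i≤e valid@(1≤i , _ , e<n) = decide (E i (suc e)) (corners i e i≤e valid)
    where
    decide : ∀ b → (b ≡ false → x i (suc e) ≡ 0ℚ) × (b ≡ true → hookSum x i e + A i ≡ A (suc e)) →
      (if b then - hookSum x i e else x i (suc e)) ℚ.≤ (if b then - hookSum y i e else y i (suc e))
    decide false (f , _) = ℚP.≤-trans (ℚP.≤-reflexive (f refl)) (proj₁ y∈ i (suc e) valid)
    decide true (_ , t) = ≤-by (0≤- (proj₂ y∈ 1≤i e<n (hook i e i≤e)))
      (trans (cong₂ (λ a T → - hookSum x i e + (a - (T + A i))) (sym (t refl)) (total-hook y i e i≤e))
        (((∀ X Y a → - X + ((X + a) - (Y + a)) ≡ - Y) ∋ solve-∀ ℚ-ring) (hookSum x i e) (hookSum y i e) (A i)))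

  vertex : Vertex n A x
  vertex = member , λ y z t y∈ z∈ t>0 t<1 x≈ → active-unique E λ i e i≤e valid →
    let f = activeFunctional E i e i≤e valid
    in extreme-value t>0 t<1 (minimal y∈ i e i≤e valid) (minimal z∈ i e i≤e valid) (trans (ev-≈ f x≈) (lin f y z t (1ℚ - t)))

  tangent⇒ : ∀ {u} → Tangent n A x u → ∀ i e → i ≤ e → Valid n i (suc e) → 0ℚ ℚ.≤ active E u i e
  tangent⇒ {u} (t , t>0 , y∈) i e i≤e valid = 0≤*⇒0≤ t>0 (≤-by (0≤- (minimal y∈ i e i≤e valid))
      (trans (cong (λ p → 0ℚ + (p - active E x i e)) (trans (ev-≈ f (λ i j _ → cong (_+ t * u i j) (sym (ℚP.*-identityˡ (x i j))))) (lin f x u 1ℚ t)))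
        (((∀ X t U → 0ℚ + ((1ℚ * X + t * U) - X) ≡ t * U) ∋ solve-∀ ℚ-ring) (active E x i e) t (active E u i e))))
    where
    f = activeFunctional E i e i≤e valid

  -- Every inequality outside the active system has slack at least 1 at x(E), so nonnegativity of
  -- the active functionals at u is all that `perturb` asks for.
  tangent⇐ : ∀ {u} → (∀ i e → i ≤ e → Valid n i (suc e) → 0ℚ ℚ.≤ active E u i e) → Tangent n A x u
  tangent⇐ {u} h = proj₁ step , proj₁ (proj₂ step) , proj₂ (proj₂ step) u
      (λ i j (_ , i<j , j≤n) → proj₂ (proj₂ B) i j (<⇒≤ (<-≤-trans i<j j≤n)) j≤n)
      (λ { i (suc e) valid@(_ , s≤s i≤e , _) → [ inj₁ , (λ (f , z) → inj₂ (ℚP.≤-reflexive (sym z) ,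
             ℚP.≤-trans (h i e i≤e valid) (ℚP.≤-reflexive (if-false f)))) ]′ (value≥ i≤e valid) })
      (λ {s} {e} 1≤s e<n w → [ inj₁ , (λ (t , o) → inj₂ (ℚP.≤-reflexive (walk-hook-tight 1≤s e<n w t o) ,
         ≤-by (ℚP.≤-trans (h s e (walk-s≤i w) (1≤s , s≤s (walk-s≤i w) , e<n)) (ℚP.≤-reflexive (if-true t)))
           (trans (cong (_+ - hookSum u s e) (total-through-corner u w o)) (ℚP.+-inverseʳ (hookSum u s e))))) ]′ (slack-or-hook 1≤s e<n w))
    where
    B = bounded n u
    step = perturb {n} {A} {x} {1ℚ} {proj₁ B} 0<1 (proj₁ (proj₂ B))

  private
    -- One generator per coordinate of U: the pairs 1 ≤ i ≤ e ≤ n - 1, with e = j - 1.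
    m = tri (ℕ.pred n)

    position : Fin m → ℕ × ℕ
    position = decode (ℕ.pred n)

    bit : {P : Set} → Dec P → ℤ
    bit (yes _) = ℤ.1ℤ
    bit (no _)  = ℤ.0ℤ

    same? : ∀ k i e → Dec (position k ≡ (i , e))
    same? k i e with proj₁ (position k) ℕ.≟ i | proj₂ (position k) ℕ.≟ e
    ... | yes p | yes q = yes (cong₂ _,_ p q)
    ... | no ¬p | _     = no (λ h → ¬p (cong proj₁ h))
    ... | yes _ | no ¬q = no (λ h → ¬q (cong proj₂ h))

  -- With an indicator as right-hand side, this is the basis dual to the active functionals. It is
  -- integral because solving the triangular system needs no division.
  generator : Fin m → LVec
  generator k = Solve.solution E (λ i e → bit (same? k i e))

  private
    position-valid : ∀ k → let i , e = position k in i ≤ e × Valid n i (suc e)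
    position-valid k = let a , b , c = decode-valid (ℕ.pred n) k
                           1≤e = ≤-trans a b
      in b , a , s≤s b , ≤-trans (s≤s c) (≤-reflexive (suc-pred n ⦃ nonzero (≤-trans 1≤e c) ⦄))
      where
      nonzero : ∀ {n} → 1 ≤ ℕ.pred n → ℕ.NonZero n
      nonzero {suc n} _ = _

    index : ∀ i e → i ≤ e → Valid n i (suc e) → Σ[ k ∈ Fin m ] position k ≡ (i , e)
    index i e i≤e (1≤i , _ , e<n) = encode (ℕ.pred n) i e 1≤i i≤e (≤-pred (≤-trans e<n (≤-reflexive (sym (suc-pred n ⦃ ℕ.>-nonZero (≤-trans (s≤s z≤n) e<n) ⦄)))))

    active-generator : ∀ k l {i e} → i ≤ e → position k ≡ (i , e) → active E (toPoint (generator l)) i e ≡ unit k l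
    active-generator k l {i} {e} i≤e p = trans (Solve.active-solution E (λ i e → bit (same? l i e)) i e i≤e) (compare (same? l i e))
      where
      compare : (d : Dec (position l ≡ (i , e))) → ℤtoℚ (bit d) ≡ unit k l
      compare (yes q) = sym (trans (cong (unit k) (decode-injective (ℕ.pred n) (trans q (sym p)))) (unit-diagonal k))
      compare (no ¬q) = sym (unit-off-diagonal {k = k} {l} (λ { refl → ¬q p }))

    active-combo : ∀ c k {i e} → i ≤ e → Valid n i (suc e) → position k ≡ (i , e) → active E (comb m c generator) i e ≡ c k
    active-combo c k {i} {e} i≤e valid p = trans (ev-combo (activeFunctional E i e i≤e valid) m c (λ k → toPoint (generator k)))
      (trans (sumFin-cong m (λ l → trans (cong (c l *_) (active-generator k l i≤e p)) (ℚP.*-comm (c l) (unit k l)))) (sumFin-unit m k c))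

    combo-active : ∀ u → u ≈[ n ] comb m (λ k → active E u (proj₁ (position k)) (proj₂ (position k))) generator
    combo-active u = active-unique E λ i e i≤e valid → let k , p = index i e i≤e valid in
      sym (trans (active-combo (λ k → active E u (proj₁ (position k)) (proj₂ (position k))) k i≤e valid p) (cong (λ q → active E u (proj₁ q) (proj₂ q)) p))

    coefficient : ∀ c {u} → comb m c generator ≈[ n ] u → ∀ k → c k ≡ active E u (proj₁ (position k)) (proj₂ (position k))
    coefficient c {u} e k = let i≤e , valid = position-valid k in
      trans (sym (active-combo c k i≤e valid refl)) (ev-≈ (activeFunctional E (proj₁ (position k)) (proj₂ (position k)) i≤e valid) e)

  independent : LinIndep n m generator
  independent c e k = let i≤e , valid = position-valid k in
    trans (coefficient c e k) (ev-zero (activeFunctional E (proj₁ (position k)) (proj₂ (position k)) i≤e valid))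

  -- The coefficients are forced to be the values of the active functionals at u, which are signed
  -- sums of integers.
  lattice : LatticeBasisOfSpan n m generator
  lattice u c e = (λ k → proj₁ (int k)) , λ i j valid → trans
      (sumFin-cong m (λ k → cong (_* ℤtoℚ (generator k i j)) (sym (trans (coefficient c e k) (proj₂ (int k)))))) (e i j valid)
    where
    int : ∀ k → Integral (active E (toPoint u) (proj₁ (position k)) (proj₂ (position k)))
    int k = integral-active E u (proj₁ (position k)) (proj₂ (position k))

  cone : ∀ u → Tangent n A x u ⇔ (Σ[ c ∈ (Fin m → ℚ) ] ((∀ k → 0ℚ ℚ.≤ c k) × (u ≈[ n ] comb m c generator)))
  cone u = mk⇔
    (λ t → (λ k → active E u (proj₁ (position k)) (proj₂ (position k))) ,
           (λ k → let i≤e , valid = position-valid k in tangent⇒ t (proj₁ (position k)) (proj₂ (position k)) i≤e valid) ,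
           combo-active u)
    (λ (c , c≥0 , e) → tangent⇐ λ i e′ i≤e valid → let k , p = index i e′ i≤e valid in
      ℚP.≤-trans (c≥0 k) (ℚP.≤-reflexive (sym (trans (ev-≈ (activeFunctional E i e′ i≤e valid) e) (active-combo c k i≤e valid p)))))

module _ {n a E x} (gap : Gap n (potential a)) (laminar : Laminar n E) (corners : HasCorners n (potential a) E x) where
  open LaminarSimple {n} {potential a} {E} {x} gap laminar corners

  private
    isVertex : IsVertex n a x
    isVertex = Member⇒InP {n} {a} {x} member , λ y z t y∈ z∈ → proj₂ vertex y z t (InP⇒Member {n} {a} {y} y∈) (InP⇒Member {n} {a} {z} z∈)

    Generated : Point → Set
    Generated u = Σ[ c ∈ (Fin (tri (ℕ.pred n)) → ℚ) ] ((∀ k → 0ℚ ℚ.≤ c k) × (u ≈[ n ] comb (tri (ℕ.pred n)) c generator))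

    to : ∀ u → InTangentCone n a x u → Generated u
    to u (t , t>0 , h) = Equivalence.to (cone u) (t , t>0 , InP⇒Member {n} {a} {λ i j → x i j + t * u i j} h)

    from : ∀ u → Generated u → InTangentCone n a x u
    from u h = convert (Equivalence.from (cone u) h)
      where
      convert : Tangent n (potential a) x u → InTangentCone n a x u
      convert (t , t>0 , h) = t , t>0 , Member⇒InP {n} {a} {λ i j → x i j + t * u i j} h

    unimodular : SimplicialUnimodularTangentCone n a x
    unimodular = tri (ℕ.pred n) , generator , independent , lattice , λ u → mk⇔ {A = InTangentCone n a x u} {B = Generated u} (to u) (from u)

  laminar⇒simple : IsSimpleVertex n a x
  laminar⇒simple = isVertex , unimodular

-- Both directions for the prefix sums of a.

potential-gap : ∀ {n} a → (∀ i → 1 ≤ i → i < n → 1 ≤ a i) → Gap n (potential a)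
potential-gap a pos = record { gap-at = λ k 1≤k k<n → ℚP.≤-trans
  (ℚP.+-monoʳ-≤ (potential a k) (ℕtoℚ-mono (pos k 1≤k k<n))) (ℚP.≤-reflexive (sym (ℕtoℚ-+ (prefix a k) (a k)))) }

positiveᵇ : ℚ → Bool
positiveᵇ p with 0ℚ ℚP.<? p
... | yes _ = true
... | no  _ = false

positiveᵇ-true : ∀ p → positiveᵇ p ≡ true → 0ℚ ℚ.< p
positiveᵇ-true p e with 0ℚ ℚP.<? p
... | yes h = h
positiveᵇ-true p () | no _

positiveᵇ-false : ∀ p → 0ℚ ℚ.≤ p → positiveᵇ p ≡ false → p ≡ 0ℚ
positiveᵇ-false p p≥0 e with 0ℚ ℚP.<? p
... | no ¬h = ℚP.≤-antisym (ℚP.≮⇒≥ ¬h) p≥0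
positiveᵇ-false p p≥0 () | yes _

simple⇒corners : ∀ {n a v} → Gap n (potential a) → IsSimpleVertex n a v → HasCorners n (potential a) (λ i j → positiveᵇ (v i j)) v
simple⇒corners {n} {a} {v} gap simple i e i≤e valid =
    positiveᵇ-false (v i (suc e)) (proj₁ (proj₁ (simple⇒vertex simple)) i (suc e) valid)
  , λ t → trans (cong (_+ potential a i) (sym (total-hook v i e i≤e)))
      (positive⇒hook-tight {n} {potential a} {v} gap (simple⇒vertex simple) (simple⇒simplicial {n} {a} {v} simple) i≤e valid (positiveᵇ-true (v i (suc e)) t))

-- Two segments that meet without containment satisfy i < k ≤ j < l up to exchanging them, and both
-- their hooks are tight at x(E).
simple⇒laminar : ∀ {n a E x} → Gap n (potential a) → HasCorners n (potential a) E x → IsSimpleVertex n a x → Laminar n E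
simple⇒laminar {n} {a} {E} {x} gap corners simple i (suc j′) k (suc l′) ij@(1≤i , s≤s i≤j′ , j≤n) kl@(1≤k , s≤s k≤l′ , l≤n) Eij Ekl (k≤j , i≤l) = compare (≤-<-connex k i) (≤-<-connex (suc j′) (suc l′))
  where
  cross = Crossing.crossing {n} {potential a} {x} gap (proj₁ (simple⇒vertex simple)) (simple⇒simplicial {n} {a} {x} simple)
  tight : ∀ {i e} (h : i ≤ e) → Valid n i (suc e) → E i (suc e) ≡ true → total x (hook i e h) + potential a i ≡ potential a (suc e)
  tight {i} {e} h valid t = trans (cong (_+ potential a i) (total-hook x i e h)) (proj₂ (corners i e h valid) t)
  compare : k ≤ i ⊎ i < k → suc j′ ≤ suc l′ ⊎ suc l′ < suc j′ → IntersectionIsFirst i (suc j′) k (suc l′) ⊎ IntersectionIsFirst k (suc l′) i (suc j′)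
  compare (inj₁ k≤i) (inj₁ j≤l) = inj₁ (k≤i , j≤l)
  compare (inj₂ i<k) (inj₂ l<j) = inj₂ (<⇒≤ i<k , <⇒≤ l<j)
  compare (inj₂ i<k) (inj₁ j≤l) = [ (λ j<l → ⊥-elim (cross 1≤i i<k k≤j (≤-pred j<l) l≤n i≤j′ k≤l′ (tight i≤j′ ij Eij) (tight k≤l′ kl Ekl)))
    , (λ j≡l → inj₂ (<⇒≤ i<k , ≤-reflexive (sym j≡l))) ]′ (m≤n⇒m<n∨m≡n j≤l)
  compare (inj₁ k≤i) (inj₂ l<j) = [ (λ k<i → ⊥-elim (cross 1≤k k<i i≤l (≤-pred l<j) j≤n k≤l′ i≤j′ (tight k≤l′ kl Ekl) (tight i≤j′ ij Eij)))
    , (λ k≡i → inj₂ (≤-reflexive (sym k≡i) , <⇒≤ l<j)) ]′ (m≤n⇒m<n∨m≡n k≤i)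

theorem1p4 : (n : ℕ) → 2 ≤ n → (a : ℕ → ℕ) → (∀ i → 1 ≤ i → i < n → 1 ≤ a i)
    → ((v : Point) → IsSimpleVertex n a v → Σ[ E ∈ SegSet ] IsXE n a E v)
    × ((E : SegSet) → (Σ[ x ∈ Point ] IsXE n a E x)
    × ((x : Point) → IsXE n a E x → (IsSimpleVertex n a x ⇔ Laminar n E)))
theorem1p4 n _ a pos =
    (λ v simple → (λ i j → positiveᵇ (v i j)) , HasCorners⇒IsXE (simple⇒corners {n} {a} {v} gap simple))
  , λ E → (let x , corners = corner-point n a E in x , HasCorners⇒IsXE corners)
        , λ x isXE → mk⇔ (simple⇒laminar {n} {a} {E} {x} gap (IsXE⇒HasCorners isXE))
                         (λ laminar → laminar⇒simple {n} {a} {E} {x} gap laminar (IsXE⇒HasCorners isXE))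
  where
  gap : Gap n (potential a)
  gap = potential-gap a pos
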